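{- The problem $1|\max L_j|er$ (given jobs $J$ with processing times $p_j$ and due dates $d_j$, a subset $J^r\subseteq J$ and a bound $K^\gamma$, find a sequence of $J$ minimizing the length $er$ of the renting period among all sequences with $\max_{j\in J}L_j\le K^\gamma$, where $L_j=C_j-d_j$) can be solved in $\mathrm{O}(nP)$ time, where $n=|J|$ and $P=\sum_{j\in J}p_j$.
   Context: An instance has a finite set $J$ of $n$ jobs; job $j$ has a non-negative integer processing time $p_j$ and a due date $d_j$. A non-empty subset $J^r\subseteq J$ (the r-jobs) requires an external resource. A sequence is a permutation of $J$; the jobs are processed one at a time on a single machine in this order, non-preemptively, from time $0$ without idle time. $C_j$ is the completion time of job $j$. The resource is rented once, without interruption, from the start of the first r-job to the completion of the last r-job, so $er=\max_{j\in J^r} C_j-\min_{j\in J^r}(C_j-p_j)$.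
   Formalization: The time bound is read as O(n·max(P,1)): if all processing times are 0, then nP = 0, which no algorithm can meet, and the bound proved there is O(n). Due dates d_j and the bound K^γ are taken to be integers. -}

module Defs where

open import Data.Bool using (Bool; true; false; not; _∧_; if_then_else_)
open import Data.Fin using (Fin; toℕ; fromℕ<)
import Data.Fin as Fin
open import Data.Fin.Permutation using (Permutation′; _⟨$⟩ʳ_; _⟨$⟩ˡ_)
open import Data.Fin.Subset using (Subset; Nonempty)
open import Data.Fin.Subset.Properties using (_∈?_)
open import Data.Integer using (ℤ; +_; -[1+_]; 0ℤ; 1ℤ)
import Data.Integer as ℤ
import Data.Integer.Properties as ℤ
open import Data.List using (List; map; filter; allFin)
import Data.List.Extrema as Extrema
open import Data.Nat using (ℕ; _+_; _*_; _∸_; _⊔_; _≤_; _<?_; _≡ᵇ_)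
open import Data.Nat.Properties using (≤-totalOrder; +-0-commutativeMonoid)
open import Data.Product using (Σ-syntax; ∃-syntax; _×_; proj₁)
open import Data.Sum using (_⊎_)
open import Relation.Binary.PropositionalEquality using (_≡_)
open import Relation.Nullary using (¬_; yes; no; does)

open import Algebra.Properties.CommutativeMonoid.Sum +-0-commutativeMonoid using (sum)
open Extrema ≤-totalOrder using () renaming (max to maxℕ; min to minℕ)
open Extrema ℤ.≤-totalOrder using () renaming (max to maxℤ)

record Instance : Set where
  field
    n        : ℕ
    p        : Fin n → ℕ
    d        : Fin n → ℤ
    Jʳ       : Subset n
    nonempty : Nonempty Jʳ
    K        : ℤ

  P : ℕ
  P = sum p

  -- π ⟨$⟩ʳ k is the job in position k, π ⟨$⟩ˡ j the position of job j.
  Sequence : Set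
  Sequence = Permutation′ n

  -- The machine starts at time 0 and never idles, so j completes once the
  -- jobs in positions up to and including its own have been processed.
  C : Sequence → Fin n → ℕ
  C π j = sum λ i → if does ((π ⟨$⟩ˡ i) Fin.≤? (π ⟨$⟩ˡ j)) then p i else 0

  -- p j ≤ C π j, so the subtraction does not truncate.
  start : Sequence → Fin n → ℕ
  start π j = C π j ∸ p j

  L : Sequence → Fin n → ℤ
  L π j = + C π j ℤ.- d j

  -- The library's max and min take an initial value.  Some r-job serves as
  -- one: it is itself a member of each of the sets over which the extrema
  -- are taken, so it does not affect them.
  j₀ : Fin n
  j₀ = proj₁ nonempty

  rjobs : List (Fin n)
  rjobs = filter (_∈? Jʳ) (allFin n)

  maxL : Sequence → ℤ
  maxL π = maxℤ (L π j₀) (map (L π) (allFin n))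

  -- The minuend is at least the subtrahend, so again nothing is truncated.
  er : Sequence → ℕ
  er π = maxℕ (C π j₀) (map (C π) rjobs) ∸ minℕ (start π j₀) (map (start π) rjobs)

  Feasible : Sequence → Set
  Feasible π = maxL π ℤ.≤ K

  Optimal : Sequence → Set
  Optimal π = Feasible π × (∀ σ → Feasible σ → er π ≤ er σ)

open Instance public

-- A unit-cost random access machine, presented as structured programs over
-- integer registers and integer arrays, both named by natural numbers; a
-- program mentions only finitely many of each.  The arithmetic is addition
-- and subtraction only, so that k steps produce numbers of O(k) bits more than
-- those in the input and the program.  Arrays are indexed by all of ℤ to make
-- evaluation total; finitely many of them can be interleaved in one memory
-- indexed by ℕ at constant cost per access.

infix  9 _[_]
infixl 6 _⊕_ _⊖_
infix  5 _≤ₑ_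
infixr 4 _andₑ_
infix  3 _≔_ _[_]≔_
infixr 2 _⨾_

data Expr : Set where
  lit     : ℤ → Expr
  reg     : ℕ → Expr
  _[_]    : ℕ → Expr → Expr
  _⊕_ _⊖_ : Expr → Expr → Expr

data Test : Set where
  _≤ₑ_   : Expr → Expr → Test
  notₑ   : Test → Test
  _andₑ_ : Test → Test → Test

data Prog : Set where
  skip          : Prog
  _≔_           : ℕ → Expr → Prog
  _[_]≔_        : ℕ → Expr → Expr → Prog
  _⨾_           : Prog → Prog → Prog
  ifₚ_then_else_ : Test → Prog → Prog → Prog
  while_run_    : Test → Prog → Prog

record Store : Set where
  constructor store
  field
    regs   : ℕ → ℤ
    arrays : ℕ → ℤ → ℤ

open Store public

setReg : ℕ → ℤ → Store → Store
setReg x v s = store (λ y → if y ≡ᵇ x then v else regs s y) (arrays s)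

setCell : ℕ → ℤ → ℤ → Store → Store
setCell a i v s = store (regs s) λ b k →
  if (b ≡ᵇ a) ∧ does (k ℤ.≟ i) then v else arrays s b k

⟦_⟧ : Expr → Store → ℤ
⟦ lit z ⟧   s = z
⟦ reg x ⟧   s = regs s x
⟦ a [ e ] ⟧ s = arrays s a (⟦ e ⟧ s)
⟦ e ⊕ f ⟧   s = ⟦ e ⟧ s ℤ.+ ⟦ f ⟧ s
⟦ e ⊖ f ⟧   s = ⟦ e ⟧ s ℤ.- ⟦ f ⟧ s

⟦_⟧ᵗ : Test → Store → Bool
⟦ e ≤ₑ f ⟧ᵗ   s = ⟦ e ⟧ s ℤ.≤ᵇ ⟦ f ⟧ s
⟦ notₑ b ⟧ᵗ   s = not (⟦ b ⟧ᵗ s)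
⟦ b andₑ c ⟧ᵗ s = ⟦ b ⟧ᵗ s ∧ ⟦ c ⟧ᵗ s

cost : Expr → ℕ
cost (lit z)   = 1
cost (reg x)   = 1
cost (a [ e ]) = 1 + cost e
cost (e ⊕ f)   = 1 + cost e + cost f
cost (e ⊖ f)   = 1 + cost e + cost f

costᵗ : Test → ℕ
costᵗ (e ≤ₑ f)   = 1 + cost e + cost f
costᵗ (notₑ b)   = 1 + costᵗ b
costᵗ (b andₑ c) = 1 + costᵗ b + costᵗ c

-- ⟨ c , s ⟩⇓[ t ] s′ : started in s, the program c halts in s′ at cost t.
infix 1 ⟨_,_⟩⇓[_]_

data ⟨_,_⟩⇓[_]_ : Prog → Store → ℕ → Store → Set where

  skip : ∀ {s} → ⟨ skip , s ⟩⇓[ 1 ] s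

  assign : ∀ {x e s} →
    ⟨ x ≔ e , s ⟩⇓[ 1 + cost e ] setReg x (⟦ e ⟧ s) s

  write : ∀ {a e f s} →
    ⟨ a [ e ]≔ f , s ⟩⇓[ 1 + cost e + cost f ] setCell a (⟦ e ⟧ s) (⟦ f ⟧ s) s

  seq : ∀ {c₁ c₂ s s′ s″ t₁ t₂} →
    ⟨ c₁ , s ⟩⇓[ t₁ ] s′ →
    ⟨ c₂ , s′ ⟩⇓[ t₂ ] s″ →
    ⟨ c₁ ⨾ c₂ , s ⟩⇓[ t₁ + t₂ ] s″

  if-true : ∀ {b c₁ c₂ s s′ t} →
    ⟦ b ⟧ᵗ s ≡ true →
    ⟨ c₁ , s ⟩⇓[ t ] s′ →
    ⟨ ifₚ b then c₁ else c₂ , s ⟩⇓[ 1 + costᵗ b + t ] s′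

  if-false : ∀ {b c₁ c₂ s s′ t} →
    ⟦ b ⟧ᵗ s ≡ false →
    ⟨ c₂ , s ⟩⇓[ t ] s′ →
    ⟨ ifₚ b then c₁ else c₂ , s ⟩⇓[ 1 + costᵗ b + t ] s′

  while-true : ∀ {b c s s′ s″ t₁ t₂} →
    ⟦ b ⟧ᵗ s ≡ true →
    ⟨ c , s ⟩⇓[ t₁ ] s′ →
    ⟨ while b run c , s′ ⟩⇓[ t₂ ] s″ →
    ⟨ while b run c , s ⟩⇓[ 1 + costᵗ b + t₁ + t₂ ] s″

  while-false : ∀ {b c s} →
    ⟦ b ⟧ᵗ s ≡ false →
    ⟨ while b run c , s ⟩⇓[ 1 + costᵗ b ] s

contents : ∀ {n} → (Fin n → ℤ) → ℤ → ℤ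
contents {n} f (+ k) with k <? n
... | yes k<n = f (fromℕ< k<n)
... | no  _   = 0ℤ
contents f -[1+ _ ] = 0ℤ

-- Registers 0 and 1 hold n and K; arrays 0, 1 and 2 hold, from index 0, the
-- processing times, the due dates and the indicator of Jʳ.  The rest is 0.
input : Instance → Store
input I = store regs₀ arrays₀
  where
  regs₀ : ℕ → ℤ
  regs₀ 0 = + n I
  regs₀ 1 = K I
  regs₀ _ = 0ℤ

  arrays₀ : ℕ → ℤ → ℤ
  arrays₀ 0 = contents (λ j → + p I j)
  arrays₀ 1 = contents (d I)
  arrays₀ 2 = contents (λ j → if does (j ∈? Jʳ I) then 1ℤ else 0ℤ)
  arrays₀ _ = λ _ → 0ℤ

-- Register 0 answers whether a feasible sequence exists; if so, array 0 lists
-- the jobs of an optimal one in processing order.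
Answers : Instance → Store → Set
Answers I s =
    (regs s 0 ≡ 1ℤ ×
     Σ[ π ∈ Sequence I ] Optimal I π ×
       (∀ k → arrays s 0 (+ toℕ k) ≡ + toℕ (π ⟨$⟩ʳ k)))
  ⊎ (regs s 0 ≡ 0ℤ × (∀ π → ¬ Feasible I π))

SolvableInTimeO : (Instance → ℕ) → Set
SolvableInTimeO f =
  ∃[ prog ] ∃[ c ] ∀ (I : Instance) →
    ∃[ t ] ∃[ s ] (⟨ prog , input I ⟩⇓[ t ] s) × t ≤ c * f I × Answers I s

-- The bound nP with P read as at least 1.  If all processing times are 0 then
-- nP = 0, although the due dates must still be read.
nP : Instance → ℕ
nP I = n I * (P I ⊔ 1)

-- Fix a sequence and give label 0, 1, 2 to the jobs before, inside and after the renting period;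
-- all r-jobs have label 1, each class may be put in EDD order, and er is the total length of
-- class 1.  Once class 0 is chosen, class 2 may be taken to be a suffix, in EDD order, of the other
-- non-r-jobs: if such a job would be late after the renting period, then so would be every one due
-- earlier.  The jobs of class 0 are in time as soon as the EDD sequence of all jobs is, and every
-- other constraint at position i of the EDD order involves, besides prefix sums and a threshold for
-- the later r-jobs, only the total length b of the class 0 jobs at later positions.  So a dynamic
-- program over (i, b), with one bit telling whether label 2 is still available, finds an optimal
-- labelling in O(nP) steps.  Deadlines matter only up to P, hence bucket sort, by deadline and
-- later by label, stays within the same bound.

module Submission where

open import Data.Bool using (Bool; true; false; not; _∧_; _∨_; T; if_then_else_)
import Data.Bool.Properties as Bool
open import Data.Bool.Properties using (T-∧; ¬-not)
open import Data.Empty using (⊥; ⊥-elim)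
open import Data.Fin using (Fin; toℕ; fromℕ<)
import Data.Fin as Fin
import Data.Fin.Properties as Fin
open import Data.Fin.Permutation using (Permutation; Permutation′; permutation; _⟨$⟩ʳ_; _⟨$⟩ˡ_; inverseˡ; inverseʳ; ↔⇒≡)
import Data.Fin.Permutation as Perm
open import Data.Fin.Subset.Properties using (_∈?_)
open import Data.Integer using (ℤ; +_; -[1+_]; 0ℤ; 1ℤ)
import Data.Integer as ℤ
import Data.Integer.Properties as ℤ
open import Data.List using (List; []; _∷_; _++_; length; lookup; tabulate; take; map; filter; allFin)
import Data.List.Properties as List
open import Data.List.Membership.Propositional using (_∈_)
open import Data.List.Membership.Propositional.Properties using (∈-++⁺ˡ; ∈-++⁺ʳ; ∈-tabulate⁺;
  ∈-allFin; ∈-filter⁺; ∈-filter⁻; ∈-map⁺; ∈-lookup)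
open import Data.List.Relation.Unary.All using (All; []; _∷_)
import Data.List.Relation.Unary.All as All
import Data.List.Relation.Unary.All.Properties as All
import Data.List.Relation.Unary.Any as Any
import Data.List.Relation.Unary.Any.Properties as Any
open import Data.List.Relation.Unary.AllPairs using (AllPairs; []; _∷_)
import Data.List.Relation.Unary.AllPairs as AllPairs
import Data.List.Relation.Unary.AllPairs.Properties as AllPairs
import Data.List.Extrema as Extrema
open import Data.Nat using (ℕ; zero; suc; _+_; _*_; _∸_; _⊔_; _⊓_; _≤_; _<_; _≤?_; _<?_; _≟_; _≤ᵇ_; _<ᵇ_; _≡ᵇ_; z≤n; s≤s)
open import Data.Nat.Properties
open import Data.Nat.Tactic.RingSolver using (solve-∀)
open import Data.Product using (Σ-syntax; ∃-syntax; _×_; _,_; proj₁; proj₂)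
open import Data.Sum using (_⊎_; inj₁; inj₂; [_,_]′)
open import Data.Unit using (⊤; tt)
open import Function using (_∘_; _$_; id; case_of_)
open import Function.Bundles using (Equivalence)
open import Relation.Binary using (tri<; tri≈; tri>)
open import Relation.Binary.PropositionalEquality hiding ([_])
open import Relation.Nullary using (¬_; Dec; yes; no; does; contradiction; ofʸ; ofⁿ)
open import Relation.Nullary.Decidable using (dec-true; dec-false)

open import Algebra.Properties.CommutativeMonoid.Sum +-0-commutativeMonoid using (sum; sum-permute)

open import Defs

-- A program logic with costs

-- The awkward constraint is that of an r-job met while label 2 is still available: every non-r-job
-- below the position where label 2 is given up precedes it, and that position is not known yet. Its
-- check is postponed to the switch, or to the end of the scan, where one comparison with the
-- smallest slack of the r-jobs above settles all of them.
--
-- The value of the dynamic program is never shown to be the minimum over labellings. Two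
-- inequalities suffice: a labelling traced back from a value at most P meets all constraints and
-- puts at most that much non-r-work inside the renting period, and the value is at most the
-- non-r-work inside the renting period of any feasible sequence. As a violated constraint is
-- charged P + 1, comparing the value with P also decides feasibility.
--
-- The label-0 work above a position is a difference of prefix sums. Both proofs carry the equation
-- b + (label-0 work below) = total instead, which avoids truncated subtraction and reduces the
-- estimates to inequalities job by job.

record Run (c : Prog) (t : ℕ) (s : Store) (Q : Store → Set) : Set where
  constructor run
  field
    {time}  : ℕ
    {final} : Store
    exec    : ⟨ c , s ⟩⇓[ time ] final
    time≤   : time ≤ t
    post    : Q final

-- Being Boolean, the check is settled by evaluation for a concrete program, so the frame rule needs
-- no proof by hand.
keepsReg : ℕ → Prog → Bool
keepsReg x skip                   = true
keepsReg x (y ≔ e)                = not (x ≡ᵇ y)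
keepsReg x (a [ e ]≔ f)           = true
keepsReg x (c ⨾ d)                = keepsReg x c ∧ keepsReg x d
keepsReg x (ifₚ b then c else d)  = keepsReg x c ∧ keepsReg x d
keepsReg x (while b run c)        = keepsReg x c

keepsArr : ℕ → Prog → Bool
keepsArr a skip                   = true
keepsArr a (y ≔ e)                = true
keepsArr a (b [ e ]≔ f)           = not (a ≡ᵇ b)
keepsArr a (c ⨾ d)                = keepsArr a c ∧ keepsArr a d
keepsArr a (ifₚ b then c else d)  = keepsArr a c ∧ keepsArr a d
keepsArr a (while b run c)        = keepsArr a c

T-∧ˡ : ∀ {x y} → T (x ∧ y) → T x
T-∧ˡ = proj₁ ∘ Equivalence.to T-∧

T-∧ʳ : ∀ x {y} → T (x ∧ y) → T y
T-∧ʳ x = proj₂ ∘ Equivalence.to (T-∧ {x})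

setReg-other : ∀ {x y v s} → T (not (x ≡ᵇ y)) → regs (setReg y v s) x ≡ regs s x
setReg-other {x} {y} h with x ≡ᵇ y
... | false = refl

setCell-other : ∀ {a b i v s k} → T (not (a ≡ᵇ b)) → arrays (setCell b i v s) a k ≡ arrays s a k
setCell-other {a} {b} h with a ≡ᵇ b
... | false = refl

setCell-same : ∀ a i {v s} → arrays (setCell a i v s) a i ≡ v
setCell-same a i with a ≡ᵇ a in eq | i ℤ.≟ i
... | true  | yes _ = refl
... | _     | no  q = contradiction refl q
... | false | yes _ = contradiction (≡⇒≡ᵇ a a refl) (subst (¬_ ∘ T) (sym eq) λ ())

setCell-elsewhere : ∀ {a b i v s k} → k ≢ i → arrays (setCell b i v s) a k ≡ arrays s a k
setCell-elsewhere {a} {b} {i} {k = k} k≢i with a ≡ᵇ b | k ℤ.≟ i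
... | false | _     = refl
... | true  | yes p = contradiction p k≢i
... | true  | no  _ = refl

keeps-reg : ∀ {c s t s′ x} → ⟨ c , s ⟩⇓[ t ] s′ → T (keepsReg x c) → regs s′ x ≡ regs s x
keeps-reg skip             h = refl
keeps-reg {x = x} (assign {y} {e} {s}) h = setReg-other {x} {y} {⟦ e ⟧ s} {s} h
keeps-reg write            h = refl
keeps-reg {x = x} (seq {c₁} {c₂} p q) h =
  trans (keeps-reg q (T-∧ʳ (keepsReg x c₁) h)) (keeps-reg p (T-∧ˡ h))
keeps-reg (if-true _ p)    h = keeps-reg p (T-∧ˡ h)
keeps-reg {x = x} (if-false {c₁ = c₁} _ p) h = keeps-reg p (T-∧ʳ (keepsReg x c₁) h)
keeps-reg (while-true _ p q) h = trans (keeps-reg q h) (keeps-reg p h)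
keeps-reg (while-false _)  h = refl

keeps-arr : ∀ {c s t s′ a} → ⟨ c , s ⟩⇓[ t ] s′ → T (keepsArr a c) →
            ∀ k → arrays s′ a k ≡ arrays s a k
keeps-arr skip             h k = refl
keeps-arr assign           h k = refl
keeps-arr {a = a} (write {b} {e} {f} {s}) h k = setCell-other {a} {b} {⟦ e ⟧ s} {⟦ f ⟧ s} {s} h
keeps-arr {a = a} (seq {c₁} {c₂} p q) h k =
  trans (keeps-arr q (T-∧ʳ (keepsArr a c₁) h) k) (keeps-arr p (T-∧ˡ h) k)
keeps-arr (if-true _ p)    h k = keeps-arr p (T-∧ˡ h) k
keeps-arr {a = a} (if-false {c₁ = c₁} _ p) h k = keeps-arr p (T-∧ʳ (keepsArr a c₁) h) k
keeps-arr (while-true _ p q) h k = trans (keeps-arr q h k) (keeps-arr p h k)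
keeps-arr (while-false _)  h k = refl

-- The side conditions are implicit because for a concrete program they evaluate to `⊤` and are
-- filled in by eta. Loop invariants can then omit everything that the loop body leaves alone.
record Same (c : Prog) (s s′ : Store) : Set where
  field
    reg≡ : ∀ x {h : T (keepsReg x c)} → regs s′ x ≡ regs s x
    arr≡ : ∀ a {h : T (keepsArr a c)} k → arrays s′ a k ≡ arrays s a k

open Same

Same-refl : ∀ {c s} → Same c s s
Same-refl .reg≡ _   = refl
Same-refl .arr≡ _ _ = refl

Same-trans : ∀ {c s s′ s″} → Same c s s′ → Same c s′ s″ → Same c s s″
Same-trans p q .reg≡ x {h}   = trans (q .reg≡ x {h}) (p .reg≡ x {h})
Same-trans p q .arr≡ a {h} k = trans (q .arr≡ a {h} k) (p .arr≡ a {h} k)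

framed : ∀ {c t s Q} → Run c t s Q → Run c t s (λ s′ → Same c s s′ × Q s′)
framed (run e t≤ q) =
  run e t≤ (record { reg≡ = λ x {h} → keeps-reg e h ; arr≡ = λ a {h} k → keeps-arr e h k } , q)

weaken : ∀ {c t u s} {Q R : Store → Set} → t ≤ u → (∀ {s′} → Q s′ → R s′) → Run c t s Q → Run c u s R
weaken t≤u f (run e t≤ q) = run e (≤-trans t≤ t≤u) (f q)

-- The postcondition of `c` is a run of `d`, so a correctness proof is written in continuation style
-- and follows the text of the program.
seq! : ∀ {c d t u s Q} → Run c t s (λ s′ → Run d u s′ Q) → Run (c ⨾ d) (t + u) s Q
seq! (run e t≤ (run f u≤ q)) = run (seq e f) (+-mono-≤ t≤ u≤) q

while-down : ∀ {b c u s₀} (Inv : ℕ → Store → Set) →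
  (∀ m s → Same c s₀ s → Inv (suc m) s → ⟦ b ⟧ᵗ s ≡ true × Run c u s (Inv m)) →
  (∀ s → Same c s₀ s → Inv 0 s → ⟦ b ⟧ᵗ s ≡ false) →
  ∀ m → Inv m s₀ →
  Run (while b run c) (m * (1 + costᵗ b + u) + (1 + costᵗ b)) s₀ (Inv 0)
while-down {b} {c} {u} {s₀} Inv step stop m = loop m s₀ Same-refl
  where
  loop : ∀ m s → Same c s₀ s → Inv m s →
         Run (while b run c) (m * (1 + costᵗ b + u) + (1 + costᵗ b)) s (Inv 0)
  loop zero    s same inv = run (while-false (stop s same inv)) ≤-refl inv
  loop (suc m) s same inv with step m s same inv
  ... | b≡true , body with framed body
  ...   | run e t≤ (same′ , inv′) with loop m _ (Same-trans same same′) inv′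
  ...     | run f u≤ q = run (while-true b≡true e f)
    (≤-trans (+-mono-≤ (+-monoʳ-≤ (1 + costᵗ b) t≤) u≤)
             (≤-reflexive (sym (+-assoc (1 + costᵗ b + u) (m * (1 + costᵗ b + u)) (1 + costᵗ b))))) q

-- Counting up to `k` is counting down the `m` remaining rounds with `k + m ≡ N`, so the induction
-- of `while-down` serves here too.
while-up : ∀ {b c u s₀} N (Inv : ℕ → Store → Set) →
  (∀ k s → k < N → Same c s₀ s → Inv k s → ⟦ b ⟧ᵗ s ≡ true × Run c u s (Inv (suc k))) →
  (∀ s → Same c s₀ s → Inv N s → ⟦ b ⟧ᵗ s ≡ false) →
  Inv 0 s₀ →
  Run (while b run c) (N * (1 + costᵗ b + u) + (1 + costᵗ b)) s₀ (Inv N)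
while-up {b} {c} {u} {s₀} N Inv step stop inv₀ =
  weaken ≤-refl
    (λ { (k , eq , inv) → subst (λ z → Inv z _) (trans (sym (+-identityʳ k)) eq) inv })
    (while-down (λ m s → ∃[ k ] k + m ≡ N × Inv k s)
      (λ { m s same (k , eq , inv) →
           let t , r = step k s (m+1+n≤⇒ eq) same inv
           in t , weaken ≤-refl (λ i → suc k , trans (sym (+-suc k m)) eq , i) r })
      (λ { s same (k , eq , inv) →
           stop s same (subst (λ z → Inv z s) (trans (sym (+-identityʳ k)) eq) inv) })
      N (0 , refl , inv₀))
  where
  m+1+n≤⇒ : ∀ {k m} → k + suc m ≡ N → k < N
  m+1+n≤⇒ {k} {m} eq = subst (k <_) eq (m<m+n k (s≤s z≤n))

-- The cost of a program each of whose loops runs its body once, both branches of a conditional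
-- and one spare test per loop counted; real costs are multiples of it.
size : Prog → ℕ
size skip                  = 1
size (x ≔ e)               = 1 + cost e
size (a [ e ]≔ f)          = 1 + cost e + cost f
size (c ⨾ d)               = size c + size d
size (ifₚ b then c else d) = 1 + costᵗ b + (size c + size d)
size (while b run c)       = (1 + costᵗ b) + size c + (1 + costᵗ b)

Exec : Prog → Store → (Store → Set) → Set
Exec c = Run c (size c)

skip! : ∀ {s Q} → Q s → Exec skip s Q
skip! q = run skip ≤-refl q

assign! : ∀ {x e v s Q} → ⟦ e ⟧ s ≡ v → Q (setReg x v s) → Exec (x ≔ e) s Q
assign! refl q = run assign ≤-refl q

write! : ∀ {a e f i v s Q} → ⟦ e ⟧ s ≡ i → ⟦ f ⟧ s ≡ v → Q (setCell a i v s) → Exec (a [ e ]≔ f) s Q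
write! refl refl q = run write ≤-refl q

set! : ∀ {x e v d s Q} → ⟦ e ⟧ s ≡ v → Exec d (setReg x v s) Q → Exec (x ≔ e ⨾ d) s Q
set! e≡ r = seq! (assign! e≡ r)

put! : ∀ {a e f i v d s Q} → ⟦ e ⟧ s ≡ i → ⟦ f ⟧ s ≡ v → Exec d (setCell a i v s) Q →
       Exec (a [ e ]≔ f ⨾ d) s Q
put! e≡ f≡ r = seq! (write! e≡ f≡ r)

if-true! : ∀ {b c d s Q} → ⟦ b ⟧ᵗ s ≡ true → Exec c s Q → Exec (ifₚ b then c else d) s Q
if-true! {b} {c} {d} b≡ (run e t≤ r) =
  run (if-true b≡ e) (+-monoʳ-≤ (1 + costᵗ b) (≤-trans t≤ (m≤m+n (size c) (size d)))) r

if-false! : ∀ {b c d s Q} → ⟦ b ⟧ᵗ s ≡ false → Exec d s Q → Exec (ifₚ b then c else d) s Q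
if-false! {b} {c} {d} b≡ (run e t≤ r) =
  run (if-false b≡ e) (+-monoʳ-≤ (1 + costᵗ b) (≤-trans t≤ (m≤n+m (size d) (size c)))) r

test-true : ∀ {i j m k} → i ≡ + m → j ≡ + k → m ≤ k → (i ℤ.≤ᵇ j) ≡ true
test-true {m = m} {k} refl refl m≤k with m ≤ᵇ k in eq
... | true  = refl
... | false = contradiction (≤⇒≤ᵇ m≤k) (subst (¬_ ∘ T) (sym eq) λ ())

test-false : ∀ {i j m k} → i ≡ + m → j ≡ + k → k < m → (i ℤ.≤ᵇ j) ≡ false
test-false {m = m} {k} refl refl k<m with m ≤ᵇ k in eq
... | false = refl
... | true  = contradiction (≤ᵇ⇒≤ m k (subst T (sym eq) tt)) (<⇒≱ k<m)

if-≤! : ∀ {e f c d s Q m k} → ⟦ e ⟧ s ≡ + m → ⟦ f ⟧ s ≡ + k →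
        (m ≤ k → Exec c s Q) → (k < m → Exec d s Q) → Exec (ifₚ e ≤ₑ f then c else d) s Q
if-≤! {m = m} {k} p q yes! no! with m ≤? k
... | yes m≤k = if-true! (test-true p q m≤k) (yes! m≤k)
... | no  m≰k = if-false! (test-false p q (≰⇒> m≰k)) (no! (≰⇒> m≰k))

infixl 6 _⊕≡_
_⊕≡_ : ∀ {i j m k} → i ≡ + m → j ≡ + k → i ℤ.+ j ≡ + (m + k)
refl ⊕≡ refl = refl

⊖≡ : ∀ {i j m k} → i ≡ + m → j ≡ + k → k ≤ m → i ℤ.- j ≡ + (m ∸ k)
⊖≡ {m = m} {k} refl refl k≤m = trans (ℤ.m-n≡m⊖n m k) (ℤ.⊖-≥ k≤m)

<⇒+≢ : ∀ {m k} → m < k → + m ≢ + k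
<⇒+≢ m<k refl = <-irrefl refl m<k

1ₑ : Expr
1ₑ = lit (+ 1)

bit : Bool → ℕ
bit b = if b then 1 else 0

if-bit! : ∀ {e c d s Q b} → ⟦ e ⟧ s ≡ + bit b → (b ≡ true → Exec c s Q) → (b ≡ false → Exec d s Q) →
          Exec (ifₚ 1ₑ ≤ₑ e then c else d) s Q
if-bit! {b = true}  e≡ yes! no! = if-true! (test-true refl e≡ ≤-refl) (yes! refl)
if-bit! {b = false} e≡ yes! no! = if-false! (test-false refl e≡ (s≤s z≤n)) (no! refl)

-- This and `upd-other` address the conditional to which a cell of an updated array reduces once the
-- array names are literals; the store need not be given.
upd-same : ∀ i {v x : ℤ} → (if does (i ℤ.≟ i) then v else x) ≡ v
upd-same i rewrite dec-true (i ℤ.≟ i) refl = refl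

upd-other : ∀ {k i} {v x : ℤ} → k ≢ i → (if does (k ℤ.≟ i) then v else x) ≡ x
upd-other {k} {i} k≢i rewrite dec-false (k ℤ.≟ i) k≢i = refl

-- Finite sums

∑ : ℕ → (ℕ → ℕ) → ℕ
∑ zero    f = 0
∑ (suc n) f = ∑ n f + f n

infixr 8 _⊙_
_⊙_ : Bool → ℕ → ℕ
b ⊙ x = if b then x else 0

∑-mono : ∀ n {f g} → (∀ k → k < n → f k ≤ g k) → ∑ n f ≤ ∑ n g
∑-mono zero    h = z≤n
∑-mono (suc n) h = +-mono-≤ (∑-mono n λ k k<n → h k (m<n⇒m<1+n k<n)) (h n ≤-refl)

∑-cong : ∀ n {f g} → (∀ k → k < n → f k ≡ g k) → ∑ n f ≡ ∑ n g
∑-cong zero    h = refl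
∑-cong (suc n) h = cong₂ _+_ (∑-cong n λ k k<n → h k (m<n⇒m<1+n k<n)) (h n ≤-refl)

∑-+ : ∀ n f g → ∑ n f + ∑ n g ≡ ∑ n (λ k → f k + g k)
∑-+ zero    f g = refl
∑-+ (suc n) f g = trans (interchange (∑ n f) (f n) (∑ n g) (g n)) (cong (_+ (f n + g n)) (∑-+ n f g))
  where
  interchange : ∀ a b c d → (a + b) + (c + d) ≡ (a + c) + (b + d)
  interchange = solve-∀

∑-mono-≤ : ∀ {m n} f → m ≤ n → ∑ m f ≤ ∑ n f
∑-mono-≤ {n = zero}  f z≤n = ≤-refl
∑-mono-≤ {m} {suc n} f m≤1+n with m≤n⇒m<n∨m≡n m≤1+n
... | inj₁ (s≤s m≤n) = ≤-trans (∑-mono-≤ f m≤n) (m≤m+n _ _)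
... | inj₂ refl      = ≤-refl

<ᵇ-true : ∀ {m n} → m < n → (m <ᵇ n) ≡ true
<ᵇ-true {m} {n} m<n with m <ᵇ n | <ᵇ-reflects-< m n
... | true  | _        = refl
... | false | ofⁿ m≮n  = contradiction m<n m≮n

<ᵇ-false : ∀ {m n} → n ≤ m → (m <ᵇ n) ≡ false
<ᵇ-false {m} {n} n≤m with m <ᵇ n | <ᵇ-reflects-< m n
... | true  | ofʸ m<n  = contradiction m<n (≤⇒≯ n≤m)
... | false | _        = refl

≤ᵇ-true : ∀ {m n} → m ≤ n → (m ≤ᵇ n) ≡ true
≤ᵇ-true {m} {n} m≤n with m ≤ᵇ n | ≤ᵇ-reflects-≤ m n
... | true  | _        = refl
... | false | ofⁿ m≰n  = contradiction m≤n m≰n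

≤ᵇ-false : ∀ {m n} → n < m → (m ≤ᵇ n) ≡ false
≤ᵇ-false {m} {n} n<m with m ≤ᵇ n | ≤ᵇ-reflects-≤ m n
... | true  | ofʸ m≤n  = contradiction m≤n (<⇒≱ n<m)
... | false | _        = refl

-- Turns a prefix sum into an indicator sum over all positions, so that sums with different ranges
-- can be compared summand by summand.
∑-restrict : ∀ {m} n f → m ≤ n → ∑ n (λ k → (k <ᵇ m) ⊙ f k) ≡ ∑ m f
∑-restrict {m} n f m≤n with m≤n⇒m<n∨m≡n m≤n
∑-restrict {m} n f _ | inj₂ refl = ∑-cong m λ k k<m → cong (_⊙ f k) (<ᵇ-true k<m)
∑-restrict {m} (suc n) f _ | inj₁ (s≤s m≤n) =
  trans (cong₂ _+_ (∑-restrict n f m≤n) (cong (_⊙ f n) (<ᵇ-false m≤n))) (+-identityʳ _)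

<suc-elim : ∀ {a} (Q : ℕ → Set a) {i} → (∀ k → k < i → Q k) → Q i → ∀ k → k < suc i → Q k
<suc-elim Q f q k (s≤s k≤i) with m≤n⇒m<n∨m≡n k≤i
... | inj₁ k<i  = f k k<i
... | inj₂ refl = q

module _ (_≼_ : ℕ → ℕ → Set) (≼-total : ∀ x y → x ≼ y ⊎ y ≼ x)
         (≼-trans : ∀ {x y z} → x ≼ y → y ≼ z → x ≼ z) (f : ℕ → Bool) where

  extremum? : ∀ n → (∀ k → k < n → f k ≡ false) ⊎
    (∃[ x ] x < n × f x ≡ true × ∀ k → k < n → f k ≡ true → k ≼ x)
  extremum? zero    = inj₁ λ _ ()
  extremum? (suc n) with f n in eq | extremum? n
  ... | false | inj₁ none = inj₁ (<suc-elim (λ k → f k ≡ false) none eq)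
  ... | false | inj₂ (x , x<n , fx , max) = inj₂ (x , m<n⇒m<1+n x<n , fx ,
    <suc-elim (λ k → f k ≡ true → k ≼ x) max (λ fn → case trans (sym fn) eq of λ ()))
  ... | true  | inj₁ none = inj₂ (n , ≤-refl , eq ,
    <suc-elim (λ k → f k ≡ true → k ≼ n) (λ k k<n fk → case trans (sym fk) (none k k<n) of λ ())
      (λ _ → [ id , id ]′ (≼-total n n)))
  ... | true  | inj₂ (x , x<n , fx , max) with ≼-total x n
  ...   | inj₁ x≼n = inj₂ (n , ≤-refl , eq ,
    <suc-elim (λ k → f k ≡ true → k ≼ n) (λ k k<n fk → ≼-trans (max k k<n fk) x≼n)
      (λ _ → [ id , id ]′ (≼-total n n)))
  ...   | inj₂ n≼x = inj₂ (x , m<n⇒m<1+n x<n , fx , <suc-elim (λ k → f k ≡ true → k ≼ x) max (λ _ → n≼x))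

  extremum : ∀ {n i} → i < n → f i ≡ true → ∃[ x ] x < n × f x ≡ true × ∀ k → k < n → f k ≡ true → k ≼ x
  extremum {n} i<n fi with extremum? n
  ... | inj₁ none = case trans (sym fi) (none _ i<n) of λ ()
  ... | inj₂ res  = res

module _ (τ : ℕ → ℕ) (f : ℕ → Bool) where

  argmax : ∀ {n i} → i < n → f i ≡ true → ∃[ x ] x < n × f x ≡ true × ∀ k → k < n → f k ≡ true → τ k ≤ τ x
  argmax = extremum (λ x y → τ x ≤ τ y) (λ x y → ≤-total (τ x) (τ y)) ≤-trans f

  argmin : ∀ {n i} → i < n → f i ≡ true → ∃[ x ] x < n × f x ≡ true × ∀ k → k < n → f k ≡ true → τ x ≤ τ k
  argmin = extremum (λ x y → τ y ≤ τ x) (λ x y → ≤-total (τ y) (τ x)) (λ p q → ≤-trans q p) f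

-- The scan and its dynamic program

data Phase : Set where
  early late : Phase

-- The jobs are named by their positions in EDD order: q, D and r are processing time, strict
-- deadline and membership in Jʳ.  Going down from position n, the scan gives label 0 to the jobs
-- sequenced before the renting period, 1 to those inside and 2 to those after it; b is the total
-- processing time of the positions above the current one labelled 0.  In phase early, label 2 is
-- no longer available.
module Scan (n : ℕ) (q D : ℕ → ℕ) (r : ℕ → Bool) where

  Pre Rr Oo : ℕ → ℕ
  Pre i = ∑ i q
  Rr  i = ∑ i (λ k → r k ⊙ q k)
  Oo  i = ∑ i (λ k → not (r k) ⊙ q k)

  Tot RT : ℕ
  Tot = Pre n
  RT  = Rr n

  Rr+Oo : ∀ i → Rr i + Oo i ≡ Pre i
  Rr+Oo i = trans (∑-+ i _ _) (∑-cong i λ k _ → lem (r k) (q k))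
    where
    lem : ∀ b x → b ⊙ x + not b ⊙ x ≡ x
    lem true  x = +-identityʳ x
    lem false x = refl

  -- A violated constraint costs more than any set of jobs.
  pen : ℕ → ℕ → ℕ
  pen x y = if x <ᵇ y then 0 else suc Tot

  pen-sat : ∀ {x y} → x < y → pen x y ≡ 0
  pen-sat x<y rewrite <ᵇ-true x<y = refl

  pen-viol : ∀ {x y} → y ≤ x → pen x y ≡ suc Tot
  pen-viol y≤x rewrite <ᵇ-false y≤x = refl

  -- Penalties are only ever added, so a total of at most `Tot` leaves room for none of them.
  pen⇒< : ∀ {x y} v → pen x y + v ≤ Tot → x < y
  pen⇒< {x} {y} v h with x <ᵇ y | <ᵇ-reflects-< x y
  ... | true  | ofʸ x<y = x<y
  ... | false | _       = contradiction (≤-trans (m≤m+n _ v) h) 1+n≰n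

  -- The index m is n ∸ k.
  thr : ℕ → ℕ → ℕ
  thr zero    k = suc Tot
  thr (suc m) k = if r k then thr m (suc k) ⊓ (D k ∸ Rr (suc k)) else thr m (suc k)

  -- x < ρ i iff the r-jobs at positions i and above meet their deadlines when everything
  -- else that precedes them takes time x.
  ρ : ℕ → ℕ
  ρ i = thr (n ∸ i) i

  ρ-n : ρ n ≡ suc Tot
  ρ-n = cong (λ m → thr m n) (n∸n≡0 n)

  thr-r : ∀ {k} m → r k ≡ true → thr (suc m) k ≡ thr m (suc k) ⊓ (D k ∸ Rr (suc k))
  thr-r m rk rewrite rk = refl

  thr-o : ∀ {k} m → r k ≡ false → thr (suc m) k ≡ thr m (suc k)
  thr-o m rk rewrite rk = refl

  n∸i≡suc : ∀ {i} → i < n → n ∸ i ≡ suc (n ∸ suc i)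
  n∸i≡suc i<n = +-∸-assoc 1 i<n

  ρ-r : ∀ {i} → i < n → r i ≡ true → ρ i ≡ ρ (suc i) ⊓ (D i ∸ Rr (suc i))
  ρ-r {i} i<n ri = trans (cong (λ m → thr m i) (n∸i≡suc i<n)) (thr-r (n ∸ suc i) ri)

  ρ-o : ∀ {i} → i < n → r i ≡ false → ρ i ≡ ρ (suc i)
  ρ-o {i} i<n ri = trans (cong (λ m → thr m i) (n∸i≡suc i<n)) (thr-o (n ∸ suc i) ri)

  RFits : ℕ → ℕ → Set
  RFits i x = ∀ m → i ≤ m → m < n → r m ≡ true → Rr (suc m) + x < D m

  -- Truncation does no harm: a truncated difference is 0, and nothing is strictly below 0.
  <∸⇒+< : ∀ {o a b} → a < b ∸ o → o + a < b
  <∸⇒+< {o} {a} {b} h with o ≤? b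
  ... | yes o≤b = subst (_≤ b) (cong suc (+-comm a o)) (m≤o∸n⇒m+n≤o (suc a) o≤b h)
  ... | no  o≰b = case subst (suc a ≤_) (m≤n⇒m∸n≡0 (<⇒≤ (≰⇒> o≰b))) h of λ ()

  +<⇒<∸ : ∀ {o a b} → o + a < b → a < b ∸ o
  +<⇒<∸ {o} {a} {b} h = m+n≤o⇒m≤o∸n (suc a) (subst (_≤ b) (cong suc (+-comm o a)) h)

  thr⇒ : ∀ m {i x} → i + m ≡ n → x < thr m i → RFits i x
  thr⇒ zero    {i} eq x< k i≤k k<n rk =
    contradiction (≤-<-trans i≤k k<n) (<-irrefl (trans (sym (+-identityʳ i)) eq))
  thr⇒ (suc m) {i} {x} eq x< k i≤k k<n rk with r i Bool.≟ true | m≤n⇒m<n∨m≡n i≤k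
  ... | no  ri | inj₁ i<k  =
    thr⇒ m (trans (sym (+-suc i m)) eq) (subst (x <_) (thr-o m (¬-not ri)) x<) k i<k k<n rk
  ... | no  ri | inj₂ refl = contradiction rk ri
  ... | yes ri | inj₁ i<k  =
    thr⇒ m (trans (sym (+-suc i m)) eq) (≤-trans (subst (x <_) (thr-r m ri) x<) (m⊓n≤m _ _)) k i<k k<n rk
  ... | yes ri | inj₂ refl = <∸⇒+< {Rr (suc i)} (≤-trans (subst (x <_) (thr-r m ri) x<) (m⊓n≤n _ _))

  -- The bound `x ≤ Tot` is used at the end of the range, where the value `suc Tot` of `thr` stands
  -- for infinity.
  ⇒thr : ∀ m {i x} → i + m ≡ n → x ≤ Tot → RFits i x → x < thr m i
  ⇒thr zero    eq x≤ fits = s≤s x≤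
  ⇒thr (suc m) {i} {x} eq x≤ fits with r i Bool.≟ true
                                     | ⇒thr m {suc i} (trans (sym (+-suc i m)) eq) x≤ (λ k i<k → fits k (<⇒≤ i<k))
  ... | no  ri | ih = subst (x <_) (sym (thr-o m (¬-not ri))) ih
  ... | yes ri | ih = subst (x <_) (sym (thr-r m ri))
    (⊓-glb ih (+<⇒<∸ {Rr (suc i)} (fits i ≤-refl (subst (i <_) eq (m<m+n i (s≤s z≤n))) ri)))

  ρ⇒ : ∀ {i x} → i ≤ n → x < ρ i → RFits i x
  ρ⇒ {i} i≤n = thr⇒ (n ∸ i) (m+[n∸m]≡n i≤n)

  ⇒ρ : ∀ {i x} → i ≤ n → x ≤ Tot → RFits i x → x < ρ i
  ⇒ρ {i} i≤n = ⇒thr (n ∸ i) (m+[n∸m]≡n i≤n)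

  -- The left-hand side is the completion time of job `i` under label 2: all r-jobs, all non-r-jobs
  -- at positions up to `i`, and the label-0 jobs above `i` come no later.
  fits₂ : ℕ → ℕ → Bool
  fits₂ i b = (RT + (Oo (suc i) + b)) <ᵇ D i

  pen₀ : ℕ → ℕ
  pen₀ i   = pen (Pre (suc i)) (D i)

  -- In phase early a label-1 job at `i` may be preceded by every job below it and by the label-0
  -- jobs above. `pen₂ i b` is the postponed check of the r-jobs at positions `i` and above: what
  -- precedes them, r-jobs apart, takes time `Oo i + b`.
  pen₁ pen₂ : ℕ → ℕ → ℕ
  pen₁ i b = pen (Pre (suc i) + b) (D i)
  pen₂ i b = pen (Oo i + b) (ρ i)

  -- The cheapest completion of the scan, by dynamic programming; v₁ and v₂ stand for the values
  -- one position down in phase early and in phase late.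
  put₀ : ℕ → ℕ → ℕ
  put₀ i v = pen₀ i + v

  put₁ : ℕ → ℕ → ℕ → ℕ
  put₁ i b v₁ = q i + (pen₁ i b + v₁)

  -- If label 2 fits, label 1 is not considered: label 2 costs nothing and keeps itself available.
  -- If it does not fit, it is given up for all lower positions as well, and `pen₂` checks the
  -- r-jobs above.
  put₁₂ : ℕ → ℕ → ℕ → ℕ → ℕ
  put₁₂ i b v₁ v₂ = if fits₂ i b then v₂ else pen₂ (suc i) b + put₁ i b v₁

  V : Phase → ℕ → ℕ → ℕ
  V early zero    b = 0
  V late  zero    b = pen₂ 0 b
  V early (suc i) b = if r i then pen₁ i b + V early i b
                      else put₀ i (V early i (b + q i)) ⊓ put₁ i b (V early i b)
  -- An r-job is charged nothing in phase late: its completion time depends on where the phase ends,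
  -- so `pen₂` accounts for it there.
  V late  (suc i) b = if r i then V late i b
                      else put₀ i (V late i (b + q i)) ⊓ put₁₂ i b (V early i b) (V late i b)

  choice : Phase → ℕ → ℕ → ℕ
  choice early i b = if put₀ i (V early i (b + q i)) ≤ᵇ put₁ i b (V early i b) then 0 else 1
  choice late  i b = if put₀ i (V late i (b + q i)) ≤ᵇ put₁₂ i b (V early i b) (V late i b) then 0
                     else if fits₂ i b then 2 else 1

  label : Phase → ℕ → ℕ → ℕ
  label φ i b = if r i then 1 else choice φ i b

  phase⁺ : Phase → ℕ → ℕ → Phase
  phase⁺ φ i b = if r i then φ else if choice φ i b ≡ᵇ 1 then early else φ

  b⁺ : Phase → ℕ → ℕ → ℕ
  b⁺ φ i b = if r i then b else if choice φ i b ≡ᵇ 0 then b + q i else b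

  labels : Phase → ℕ → ℕ → ℕ → ℕ
  labels φ zero    b k = 0
  labels φ (suc i) b k = if k ≡ᵇ i then label φ i b else labels (phase⁺ φ i b) i (b⁺ φ i b) k

  labels-i : ∀ φ i b → labels φ (suc i) b i ≡ label φ i b
  labels-i φ i b with i ≡ᵇ i in eq
  ... | true  = refl
  ... | false = contradiction (≡⇒≡ᵇ i i refl) (subst (¬_ ∘ T) (sym eq) λ ())

  labels-< : ∀ φ i b k → k < i → labels φ (suc i) b k ≡ labels (phase⁺ φ i b) i (b⁺ φ i b) k
  labels-< φ i b k k<i with k ≡ᵇ i in eq
  ... | false = refl
  ... | true  = contradiction (≡ᵇ⇒≡ k i (subst T (sym eq) tt)) (<⇒≢ k<i)

  -- Step φ i b ℓ φ′ b′ g: the scan at position i labels it ℓ, pays g and goes on in state φ′, b′.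
  data Step : Phase → ℕ → ℕ → ℕ → Phase → ℕ → ℕ → Set where
    r-early  : ∀ {i b} → r i ≡ true → Step early i b 1 early b (pen₁ i b)
    r-late   : ∀ {i b} → r i ≡ true → Step late i b 1 late b 0
    o-before : ∀ {φ i b} → r i ≡ false → Step φ i b 0 φ (b + q i) (pen₀ i)
    o-inside : ∀ {i b} → r i ≡ false → Step early i b 1 early b (q i + pen₁ i b)
    o-switch : ∀ {i b} → r i ≡ false → Step late i b 1 early b (pen₂ (suc i) b + (q i + pen₁ i b))
    o-after  : ∀ {i b} → r i ≡ false → RT + (Oo (suc i) + b) < D i → Step late i b 2 late b 0

  V-early-r : ∀ {i} b → r i ≡ true → V early (suc i) b ≡ pen₁ i b + V early i b
  V-early-r b ri rewrite ri = refl

  V-early-o : ∀ {i} b → r i ≡ false →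
              V early (suc i) b ≡ put₀ i (V early i (b + q i)) ⊓ put₁ i b (V early i b)
  V-early-o b ri rewrite ri = refl

  V-late-r : ∀ {i} b → r i ≡ true → V late (suc i) b ≡ V late i b
  V-late-r b ri rewrite ri = refl

  V-late-o : ∀ {i} b → r i ≡ false →
             V late (suc i) b ≡ put₀ i (V late i (b + q i)) ⊓ put₁₂ i b (V early i b) (V late i b)
  V-late-o b ri rewrite ri = refl

  next-r : ∀ φ {i} b → r i ≡ true → label φ i b ≡ 1 × phase⁺ φ i b ≡ φ × b⁺ φ i b ≡ b
  next-r φ b ri rewrite ri = refl , refl , refl

  next-0 : ∀ φ {i} b → r i ≡ false → choice φ i b ≡ 0 →
           label φ i b ≡ 0 × phase⁺ φ i b ≡ φ × b⁺ φ i b ≡ b + q i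
  next-0 φ b ri ci rewrite ri | ci = refl , refl , refl

  next-1 : ∀ φ {i} b → r i ≡ false → choice φ i b ≡ 1 →
           label φ i b ≡ 1 × phase⁺ φ i b ≡ early × b⁺ φ i b ≡ b
  next-1 φ b ri ci rewrite ri | ci = refl , refl , refl

  next-2 : ∀ φ {i m} b → r i ≡ false → choice φ i b ≡ suc (suc m) →
           label φ i b ≡ suc (suc m) × phase⁺ φ i b ≡ φ × b⁺ φ i b ≡ b
  next-2 φ b ri ci rewrite ri | ci = refl , refl , refl

  choice-early-0 : ∀ i b → put₀ i (V early i (b + q i)) ≤ put₁ i b (V early i b) → choice early i b ≡ 0
  choice-early-0 i b h rewrite ≤ᵇ-true h = refl

  choice-early-1 : ∀ i b → put₁ i b (V early i b) < put₀ i (V early i (b + q i)) → choice early i b ≡ 1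
  choice-early-1 i b h rewrite ≤ᵇ-false h = refl

  choice-late-0 : ∀ i b → put₀ i (V late i (b + q i)) ≤ put₁₂ i b (V early i b) (V late i b) →
                  choice late i b ≡ 0
  choice-late-0 i b h = cong (λ z → if z then 0 else if fits₂ i b then 2 else 1) (≤ᵇ-true h)

  choice-late-12 : ∀ i b → put₁₂ i b (V early i b) (V late i b) < put₀ i (V late i (b + q i)) →
                   choice late i b ≡ (if fits₂ i b then 2 else 1)
  choice-late-12 i b h = cong (λ z → if z then 0 else if fits₂ i b then 2 else 1) (≤ᵇ-false h)

  put₁₂-fits : ∀ i b v₁ v₂ → RT + (Oo (suc i) + b) < D i → put₁₂ i b v₁ v₂ ≡ v₂
  put₁₂-fits i b v₁ v₂ h = cong (λ z → if z then v₂ else pen₂ (suc i) b + put₁ i b v₁) (<ᵇ-true h)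

  put₁₂-tight : ∀ i b v₁ v₂ → D i ≤ RT + (Oo (suc i) + b) → put₁₂ i b v₁ v₂ ≡ pen₂ (suc i) b + put₁ i b v₁
  put₁₂-tight i b v₁ v₂ h = cong (λ z → if z then v₂ else pen₂ (suc i) b + put₁ i b v₁) (<ᵇ-false h)

  -- The traced choice attains the minimum, so the value splits exactly into the price of this step
  -- and the value of the next state. Soundness can then argue by cases on `Step` without reopening
  -- the minima.
  step : ∀ φ i b → ∃[ g ] Step φ i b (label φ i b) (phase⁺ φ i b) (b⁺ φ i b) g ×
                          V φ (suc i) b ≡ g + V (phase⁺ φ i b) i (b⁺ φ i b)
  step φ i b = decide φ (r i Bool.≟ true)
    where
    pack : ∀ {φ ℓ φ′ b′ g} → label φ i b ≡ ℓ × phase⁺ φ i b ≡ φ′ × b⁺ φ i b ≡ b′ →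
           Step φ i b ℓ φ′ b′ g → V φ (suc i) b ≡ g + V φ′ i b′ →
           ∃[ g ] Step φ i b (label φ i b) (phase⁺ φ i b) (b⁺ φ i b) g ×
                  V φ (suc i) b ≡ g + V (phase⁺ φ i b) i (b⁺ φ i b)
    pack (refl , refl , refl) st eq = _ , st , eq

    decide : ∀ φ → Dec (r i ≡ true) →
             ∃[ g ] Step φ i b (label φ i b) (phase⁺ φ i b) (b⁺ φ i b) g ×
                    V φ (suc i) b ≡ g + V (phase⁺ φ i b) i (b⁺ φ i b)
    decide early (yes ri) = pack (next-r early b ri) (r-early ri) (V-early-r b ri)
    decide late  (yes ri) = pack (next-r late b ri) (r-late ri) (V-late-r b ri)
    decide early (no ¬ri) with ri ← ¬-not ¬ri
                           | put₀ i (V early i (b + q i)) ≤? put₁ i b (V early i b)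
    ... | yes h = pack (next-0 early b ri (choice-early-0 i b h)) (o-before ri)
      (trans (V-early-o b ri) (m≤n⇒m⊓n≡m h))
    ... | no  h = pack (next-1 early b ri (choice-early-1 i b (≰⇒> h))) (o-inside ri)
      (trans (V-early-o b ri)
        (trans (m≥n⇒m⊓n≡n (≰⇒≥ h)) (sym (+-assoc (q i) (pen₁ i b) (V early i b)))))
    decide late (no ¬ri) with ri ← ¬-not ¬ri
                          | put₀ i (V late i (b + q i)) ≤? put₁₂ i b (V early i b) (V late i b)
                          | suc (RT + (Oo (suc i) + b)) ≤? D i
    ... | yes h | _ = pack (next-0 late b ri (choice-late-0 i b h)) (o-before ri)
      (trans (V-late-o b ri) (m≤n⇒m⊓n≡m h))
    ... | no  h | yes fits =
      pack (next-2 late b ri (trans (choice-late-12 i b (≰⇒> h))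
                                    (cong (λ z → if z then 2 else 1) (<ᵇ-true fits))))
        (o-after ri fits)
        (trans (V-late-o b ri) (trans (m≥n⇒m⊓n≡n (≰⇒≥ h)) (put₁₂-fits i b _ _ fits)))
    ... | no  h | no tight =
      pack (next-1 late b ri (trans (choice-late-12 i b (≰⇒> h))
                                    (cong (λ z → if z then 2 else 1) (<ᵇ-false (≮⇒≥ tight)))))
        (o-switch ri)
        (trans (V-late-o b ri) (trans (m≥n⇒m⊓n≡n (≰⇒≥ h)) (trans (put₁₂-tight i b _ _ (≮⇒≥ tight))
          (assoc₄ (pen₂ (suc i) b) (q i) (pen₁ i b) (V early i b)))))
      where
      assoc₄ : ∀ a b c d → a + (b + (c + d)) ≡ (a + (b + c)) + d
      assoc₄ = solve-∀

  labels≤2 : ∀ φ i b k → labels φ i b k ≤ 2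
  labels≤2 φ zero    b k = z≤n
  labels≤2 φ (suc i) b k with k ≡ᵇ i
  ... | false = labels≤2 (phase⁺ φ i b) i (b⁺ φ i b) k
  ... | true  = ℓ≤2 (proj₁ (proj₂ (step φ i b)))
    where
    ℓ≤2 : ∀ {φ i b ℓ φ′ b′ g} → Step φ i b ℓ φ′ b′ g → ℓ ≤ 2
    ℓ≤2 (r-early _)   = s≤s z≤n
    ℓ≤2 (r-late _)    = s≤s z≤n
    ℓ≤2 (o-before _)  = z≤n
    ℓ≤2 (o-inside _)  = s≤s z≤n
    ℓ≤2 (o-switch _)  = s≤s z≤n
    ℓ≤2 (o-after _ _) = ≤-refl

-- A labelling without penalty yields a feasible sequence

module Soundness (n : ℕ) (q D : ℕ → ℕ) (r : ℕ → Bool) (lab : ℕ → ℕ) (S : ℕ) where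
  open Scan n q D r

  B₀ : ℕ → ℕ
  B₀ i = ∑ i (λ k → (lab k ≡ᵇ 0) ⊙ q k)

  O₁ : ℕ → ℕ
  O₁ i = ∑ i (λ k → (not (r k) ∧ (lab k ≡ᵇ 1)) ⊙ q k)

  -- The inequality tested by `pen₁` with `b` the label-0 work above `k`, that is `S` minus
  -- `B₀ (suc k)`; the prefix sum stands on the right to avoid subtraction. `After` and the field
  -- `fits` of `Valid` are written in the same way.
  Early : ℕ → Set
  Early k = lab k ≡ 1 → Pre (suc k) + S < D k + B₀ (suc k)

  Before : ℕ → Set
  Before k = lab k ≡ 0 → Pre (suc k) < D k

  After : ℕ → ℕ → Set
  After i* k = lab k ≡ 2 → i* ≤ k × RT + (Oo (suc k) + S) < D k + B₀ (suc k)

  Required : ℕ → Set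
  Required k = r k ≡ true → lab k ≡ 1

  record Below (i v : ℕ) : Set where
    field
      early′   : ∀ k → k < i → Early k
      before   : ∀ k → k < i → Before k
      required : ∀ k → k < i → Required k
      low      : ∀ k → k < i → lab k < 2
      cost≥    : O₁ i ≤ v

  -- i* is the number of positions scanned in phase early.
  record Valid (i v : ℕ) : Set where
    field
      i*       : ℕ
      i*≤      : i* ≤ i
      early′   : ∀ k → k < i* → Early k
      before   : ∀ k → k < i → Before k
      required : ∀ k → k < i → Required k
      low      : ∀ k → k < i → lab k < 3
      inside   : ∀ k → k < i → i* ≤ k → lab k ≡ 1 → r k ≡ true
      after    : ∀ k → k < i → After i* k
      fits     : ∀ m → i* ≤ m → m < n → r m ≡ true → Rr (suc m) + (Oo i* + S) < D m + B₀ i*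
      cost≥    : O₁ i ≤ v

  private
    add-0 : ∀ {i b} → lab i ≡ 0 → b + B₀ (suc i) ≡ S → b + q i + B₀ i ≡ S
    add-0 {i} {b} li eq rewrite li = trans (lem b (q i) (B₀ i)) eq
      where
      lem : ∀ b x y → b + x + y ≡ b + (y + x)
      lem = solve-∀

    add-≢0 : ∀ {i b} ℓ → lab i ≡ suc ℓ → b + B₀ (suc i) ≡ S → b + B₀ i ≡ S
    add-≢0 {i} {b} ℓ li eq rewrite li = trans (cong (λ z → b + z) (sym (+-identityʳ (B₀ i)))) eq

    shift< : ∀ {a b B} d → b + B ≡ S → a + b < d → a + S < d + B
    shift< {a} {b} {B} d refl h = subst (_< d + B) (+-assoc a b B) (+-monoˡ-< B h)

    O₁-r : ∀ {i} → r i ≡ true → O₁ (suc i) ≡ O₁ i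
    O₁-r {i} ri rewrite ri = +-identityʳ _

    O₁-0 : ∀ {i} → lab i ≡ 0 → O₁ (suc i) ≡ O₁ i
    O₁-0 {i} li rewrite li | Bool.∧-zeroʳ (not (r i)) = +-identityʳ _

    O₁-2 : ∀ {i} → lab i ≡ 2 → O₁ (suc i) ≡ O₁ i
    O₁-2 {i} li rewrite li | Bool.∧-zeroʳ (not (r i)) = +-identityʳ _

    O₁-≤ : ∀ i → O₁ (suc i) ≤ q i + O₁ i
    O₁-≤ i with not (r i) ∧ (lab i ≡ᵇ 1)
    ... | true  = ≤-reflexive (+-comm (O₁ i) (q i))
    ... | false = ≤-trans (≤-reflexive (+-identityʳ _)) (m≤n+m _ (q i))

    ≢0 : ∀ {i ℓ} {A : Set} → lab i ≡ suc ℓ → lab i ≡ 0 → A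
    ≢0 p q = case trans (sym p) q of λ ()

    0≢ : ∀ {i ℓ} {A : Set} → lab i ≡ 0 → lab i ≡ suc ℓ → A
    0≢ p q = case trans (sym p) q of λ ()

    o≢r : ∀ {i} {A : Set} → r i ≡ false → r i ≡ true → A
    o≢r p q = case trans (sym p) q of λ ()

  below-step : ∀ {i b ℓ b′ g v} → Step early i b ℓ early b′ g → lab i ≡ ℓ → b + B₀ (suc i) ≡ S →
               g + v ≤ Tot → (b′ + B₀ i ≡ S → Below i v) → Below (suc i) (g + v)
  below-step {i} {b} {v = v} (r-early ri) li eq h rec = record
    { early′   = <suc-elim Early early′ λ _ → shift< {b = b} (D i) eq (pen⇒< v h)
    ; before   = <suc-elim Before before (≢0 li)
    ; required = <suc-elim Required required λ _ → li
    ; low      = <suc-elim (λ k → lab k < 2) low (subst (_< 2) (sym li) ≤-refl)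
    ; cost≥    = ≤-trans (≤-reflexive (O₁-r ri)) (≤-trans cost≥ (m≤n+m v _)) }
    where open Below (rec (add-≢0 {b = b} 0 li eq))
  below-step {i} {b} {v = v} (o-before ri) li eq h rec = record
    { early′   = <suc-elim Early early′ (0≢ li)
    ; before   = <suc-elim Before before λ _ → pen⇒< v h
    ; required = <suc-elim Required required (o≢r ri)
    ; low      = <suc-elim (λ k → lab k < 2) low (subst (_< 2) (sym li) (s≤s z≤n))
    ; cost≥    = ≤-trans (≤-reflexive (O₁-0 li)) (≤-trans cost≥ (m≤n+m v _)) }
    where open Below (rec (add-0 {b = b} li eq))
  below-step {i} {b} {v = v} (o-inside ri) li eq h rec = record
    { early′   = <suc-elim Early early′ λ _ → shift< {b = b} (D i) eq (pen⇒< v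
                   (≤-trans (+-monoˡ-≤ v (m≤n+m (pen₁ i b) (q i))) h))
    ; before   = <suc-elim Before before (≢0 li)
    ; required = <suc-elim Required required (o≢r ri)
    ; low      = <suc-elim (λ k → lab k < 2) low (subst (_< 2) (sym li) ≤-refl)
    ; cost≥    = ≤-trans (O₁-≤ i) (+-mono-≤ (m≤m+n (q i) (pen₁ i b)) cost≥) }
    where open Below (rec (add-≢0 {b = b} 0 li eq))

  -- The total `S` of the label-0 work is fixed in advance, so `b + B₀ i ≡ S` is preserved by every
  -- step and gives the state `b` its meaning. The bound `Tot` on the value excludes penalties, so
  -- each price paid yields the inequality it tests.
  below : ∀ i b → (∀ k → k < i → lab k ≡ labels early i b k) → b + B₀ i ≡ S → V early i b ≤ Tot →
          Below i (V early i b)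
  valid : ∀ i b → i ≤ n → (∀ k → k < i → lab k ≡ labels late i b k) → b + B₀ i ≡ S → V late i b ≤ Tot →
          Valid i (V late i b)

  below zero    b lab≡ eq h = record
    { early′ = λ _ () ; before = λ _ () ; required = λ _ () ; low = λ _ () ; cost≥ = z≤n }
  below (suc i) b lab≡ eq h = go (step early i b)
    (λ k k<i → trans (lab≡ k (m<n⇒m<1+n k<i)) (labels-< early i b k k<i))
    (trans (lab≡ i ≤-refl) (labels-i early i b))
    where
    go : ∀ {ℓ φ′ b′} → ∃[ g ] Step early i b ℓ φ′ b′ g × V early (suc i) b ≡ g + V φ′ i b′ →
         (∀ k → k < i → lab k ≡ labels φ′ i b′ k) → lab i ≡ ℓ → Below (suc i) (V early (suc i) b)
    go {φ′ = early} {b′} (g , st , veq) lab≡′ li = subst (Below (suc i)) (sym veq)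
      (below-step st li eq h′ λ eq′ → below i b′ lab≡′ eq′ (≤-trans (m≤n+m _ g) h′))
      where
      h′ : g + V early i b′ ≤ Tot
      h′ = subst (_≤ Tot) veq h
    go {φ′ = late} (_ , () , _) _ _

  valid zero    b i≤n lab≡ eq h = record
    -- The scan ended in phase late: no position is early, and `pen₂ 0 b` has checked every r-job.
    { i* = 0 ; i*≤ = z≤n ; early′ = λ _ () ; before = λ _ () ; required = λ _ () ; low = λ _ ()
    ; inside = λ _ () ; after = λ _ ()
    ; fits = λ m 0≤m m<n rm →
        shift< {b = b} (D m) eq (ρ⇒ {0} z≤n (pen⇒< 0 (subst (_≤ Tot) (sym (+-identityʳ _)) h)) m 0≤m m<n rm)
    ; cost≥ = z≤n }
  valid (suc i) b i<n lab≡ eq h = go (step late i b)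
    (λ k k<i → trans (lab≡ k (m<n⇒m<1+n k<i)) (labels-< late i b k k<i))
    (trans (lab≡ i ≤-refl) (labels-i late i b))
    where
    go : ∀ {ℓ φ′ b′} → ∃[ g ] Step late i b ℓ φ′ b′ g × V late (suc i) b ≡ g + V φ′ i b′ →
         (∀ k → k < i → lab k ≡ labels φ′ i b′ k) → lab i ≡ ℓ → Valid (suc i) (V late (suc i) b)
    go {ℓ} {φ′} {b′} (g , st , veq) lab≡′ li = subst (Valid (suc i)) (sym veq) (fin st lab≡′ li (subst (_≤ Tot) veq h))
      where
      fin : ∀ {ℓ φ′ b′ g} → Step late i b ℓ φ′ b′ g →
            (∀ k → k < i → lab k ≡ labels φ′ i b′ k) → lab i ≡ ℓ → g + V φ′ i b′ ≤ Tot →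
            Valid (suc i) (g + V φ′ i b′)
      fin {b′ = b′} {g} (r-late ri) lab≡ li h = record
        { i* = i* ; i*≤ = m≤n⇒m≤1+n i*≤ ; early′ = early′
        ; before   = <suc-elim Before before (≢0 li)
        ; required = <suc-elim Required required λ _ → li
        ; low      = <suc-elim (λ k → lab k < 3) low (subst (_< 3) (sym li) (s≤s (s≤s z≤n)))
        ; inside   = <suc-elim (λ k → i* ≤ k → lab k ≡ 1 → r k ≡ true) inside λ _ _ → ri
        ; after    = <suc-elim (After i*) after λ li′ → case trans (sym li) li′ of λ ()
        ; fits     = fits
        ; cost≥    = ≤-trans (≤-reflexive (O₁-r ri)) cost≥ }
        where open Valid (valid i b′ (<⇒≤ i<n) lab≡ (add-≢0 {b = b} 0 li eq) h)
      fin {b′ = b′} {g} (o-before ri) lab≡ li h = record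
        { i* = i* ; i*≤ = m≤n⇒m≤1+n i*≤ ; early′ = early′
        ; before   = <suc-elim Before before λ _ → pen⇒< _ h
        ; required = <suc-elim Required required (o≢r ri)
        ; low      = <suc-elim (λ k → lab k < 3) low (subst (_< 3) (sym li) (s≤s z≤n))
        ; inside   = <suc-elim (λ k → i* ≤ k → lab k ≡ 1 → r k ≡ true) inside λ _ → 0≢ li
        ; after    = <suc-elim (After i*) after (0≢ li)
        ; fits     = fits
        ; cost≥    = ≤-trans (≤-reflexive (O₁-0 li)) (≤-trans cost≥ (m≤n+m _ g)) }
        where open Valid (valid i b′ (<⇒≤ i<n) lab≡ (add-0 {b = b} li eq) (≤-trans (m≤n+m _ g) h))
      fin {b′ = b′} {g} (o-after ri ok) lab≡ li h = record
        { i* = i* ; i*≤ = m≤n⇒m≤1+n i*≤ ; early′ = early′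
        ; before   = <suc-elim Before before (≢0 li)
        ; required = <suc-elim Required required (o≢r ri)
        ; low      = <suc-elim (λ k → lab k < 3) low (subst (_< 3) (sym li) ≤-refl)
        ; inside   = <suc-elim (λ k → i* ≤ k → lab k ≡ 1 → r k ≡ true) inside
                       λ _ li′ → case trans (sym li) li′ of λ ()
        ; after    = <suc-elim (After i*) after λ _ → i*≤ ,
                       subst (_< D i + B₀ (suc i)) (+-assoc RT (Oo (suc i)) S)
                         (shift< {b = b} (D i) eq (subst (_< D i) (sym (+-assoc RT (Oo (suc i)) b)) ok))
        ; fits     = fits
        ; cost≥    = ≤-trans (≤-reflexive (O₁-2 li)) cost≥ }
        where open Valid (valid i b′ (<⇒≤ i<n) lab≡ (add-≢0 {b = b} 1 li eq) h)
      fin {b′ = b′} {g} (o-switch ri) lab≡ li h = record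
        -- Position `i` itself counts as early, since it takes label 1 and pays `pen₁`; the `pen₂`
        -- paid along with it checks the r-jobs from `suc i` on.
        { i* = suc i ; i*≤ = ≤-refl
        ; early′ = Lo.early′ ; before = Lo.before ; required = Lo.required
        ; low      = λ k k< → m<n⇒m<1+n (Lo.low k k<)
        ; inside   = λ k k< i<k → contradiction k< (≤⇒≯ i<k)
        ; after    = λ k k< lk → contradiction (subst (_< 2) lk (Lo.low k k<)) (<-irrefl refl)
        ; fits     = λ m i≤m m<n rm → subst (_< D m + B₀ (suc i)) (+-assoc (Rr (suc m)) (Oo (suc i)) S)
            (shift< {b = b} (D m) eq (subst (_< D m) (sym (+-assoc (Rr (suc m)) (Oo (suc i)) b))
              (ρ⇒ i<n (pen⇒< _ (subst (_≤ Tot) (+-assoc (pen₂ (suc i) b) _ _) h)) m i≤m m<n rm)))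
        ; cost≥    = ≤-trans Lo.cost≥ (≤-trans (m≤n+m _ (pen₂ (suc i) b))
                       (≤-reflexive (sym (+-assoc (pen₂ (suc i) b) _ _)))) }
        where
        h′ : q i + pen₁ i b + V early i b ≤ Tot
        h′ = ≤-trans (m≤n+m _ (pen₂ (suc i) b)) (subst (_≤ Tot) (+-assoc (pen₂ (suc i) b) _ _) h)
        module Lo = Below (below-step (o-inside ri) li eq h′
                     λ eq′ → below i b lab≡ eq′ (≤-trans (m≤n+m _ (q i + pen₁ i b)) h′))

-- Completion times in the sequence given by a labelling

∑-≤₂ : ∀ n {f g h l} → (∀ k → k < n → f k + g k ≤ h k + l k) → ∑ n f + ∑ n g ≤ ∑ n h + ∑ n l
∑-≤₂ n {f} {g} {h} {l} p = subst₂ _≤_ (sym (∑-+ n f g)) (sym (∑-+ n h l)) (∑-mono n p)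

∑-≤₃ : ∀ n {f g h l o} → (∀ k → k < n → f k + g k ≤ h k + (l k + o k)) →
       ∑ n f + ∑ n g ≤ ∑ n h + (∑ n l + ∑ n o)
∑-≤₃ n {f} {g} {h} {l} {o} p =
  ≤-trans (∑-≤₂ n {f} {g} {h} {λ k → l k + o k} p)
          (+-monoʳ-≤ (∑ n h) (≤-reflexive (sym (∑-+ n l o))))

-- The summand of `Cᵖ k + B₀ (suc k) ≤ Pre (suc k) + S`: `a` says that the job comes no later than
-- `k`, `c` that its position is at most `k`, `z` that its label is 0. A job that comes no later
-- despite a later position must have label 0.
⊙-≤₂ : ∀ a c z x → (a ≡ true → c ≡ false → z ≡ true) → a ⊙ x + c ⊙ z ⊙ x ≤ c ⊙ x + z ⊙ x
⊙-≤₂ false false z     x h = z≤n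
⊙-≤₂ false true  false x h = z≤n
⊙-≤₂ false true  true  x h = m≤m+n x x
⊙-≤₂ true  false false x h = case h refl refl of λ ()
⊙-≤₂ true  false true  x h = ≤-reflexive (+-identityʳ x)
⊙-≤₂ true  true  z     x h = ≤-refl

-- The summand of `Cᵖ k + B₀ i ≤ Rr j + (Oo i + S)`, with `e` and `c` for positions below `i` and
-- below `j`. For an r-job in the late part, `i` is `i*` and `j` is `suc k`; for a label-2 job, `i`
-- is `suc k` and `c` is constantly true.
⊙-≤₃ : ∀ a e z c r x → (z ≡ true → r ≡ false) →
       (a ≡ true → z ≡ false → r ≡ true → c ≡ true) →
       (a ≡ true → z ≡ false → r ≡ false → e ≡ true) →
       a ⊙ x + e ⊙ z ⊙ x ≤ c ⊙ r ⊙ x + (e ⊙ not r ⊙ x + z ⊙ x)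
⊙-≤₃ a     e     true  c     true  x h p q = case h refl of λ ()
⊙-≤₃ false false z     c     r     x h p q = z≤n
⊙-≤₃ false true  false c     r     x h p q = z≤n
⊙-≤₃ false true  true  c     false x h p q = ≤-trans (m≤m+n x x) (m≤n+m _ (c ⊙ 0))
⊙-≤₃ true  false true  c     false x h p q = ≤-trans (≤-reflexive (+-identityʳ x)) (m≤n+m x (c ⊙ 0))
⊙-≤₃ true  true  true  c     false x h p q = m≤n+m (x + x) (c ⊙ 0)
⊙-≤₃ true  e     false false true  x h p q = case p refl refl refl of λ ()
⊙-≤₃ true  false false true  true  x h p q = ≤-refl
⊙-≤₃ true  true  false true  true  x h p q = ≤-refl
⊙-≤₃ true  false false c     false x h p q = case q refl refl refl of λ ()
⊙-≤₃ true  true  false c     false x h p q = m≤n+m (x + 0) (c ⊙ 0)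

≡ᵇ0-false : ∀ {m} → (m ≡ᵇ 0) ≡ false → m ≢ 0
≡ᵇ0-false () refl

≡ᵇ0-true : ∀ {m} → (m ≡ᵇ 0) ≡ true → m ≡ 0
≡ᵇ0-true {zero} _ = refl

<3-cases : ∀ {m} → m < 3 → m ≡ 0 ⊎ m ≡ 1 ⊎ m ≡ 2
<3-cases {0} _ = inj₁ refl
<3-cases {1} _ = inj₂ (inj₁ refl)
<3-cases {2} _ = inj₂ (inj₂ refl)
<3-cases {suc (suc (suc _))} (s≤s (s≤s (s≤s ())))

<ᵇ-false⁻ : ∀ {m n} → (m <ᵇ n) ≡ false → n ≤ m
<ᵇ-false⁻ {m} {n} eq with m <ᵇ n | <ᵇ-reflects-< m n
... | false | ofⁿ m≮n = ≮⇒≥ m≮n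

<ᵇ-true⁻ : ∀ {m n} → (m <ᵇ n) ≡ true → m < n
<ᵇ-true⁻ {m} {n} eq = <ᵇ⇒< m n (subst T (sym eq) tt)

≤ᵇ-true⁻ : ∀ {m n} → (m ≤ᵇ n) ≡ true → m ≤ n
≤ᵇ-true⁻ {m} {n} eq = ≤ᵇ⇒≤ m n (subst T (sym eq) tt)

module Bounds (n : ℕ) (q D : ℕ → ℕ) (r : ℕ → Bool) (lab : ℕ → ℕ) (S : ℕ)
  (S≡ : Soundness.B₀ n q D r lab S n ≡ S) {v : ℕ} (val : Soundness.Valid n q D r lab S n v)
  (pre : ℕ → ℕ → Bool)
  (pre⇒ : ∀ {m k} → m < n → k < n → pre m k ≡ true → lab m < lab k ⊎ lab m ≡ lab k × m ≤ k)
  where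

  open Scan n q D r
  open Soundness n q D r lab S
  open Valid val

  Cᵖ : ℕ → ℕ
  Cᵖ k = ∑ n (λ m → pre m k ⊙ q m)

  pre⇒< : ∀ {m k} → m < n → k < n → pre m k ≡ true → lab m < lab k ⊎ lab m ≡ lab k × (m <ᵇ suc k) ≡ true
  pre⇒< m<n k<n p with pre⇒ m<n k<n p
  ... | inj₁ h         = inj₁ h
  ... | inj₂ (h , m≤k) = inj₂ (h , <ᵇ-true (s≤s m≤k))

  restrict : ∀ {k} f → k < n → ∑ n (λ m → (m <ᵇ suc k) ⊙ f m) ≡ ∑ (suc k) f
  restrict f = ∑-restrict n f

  zero⇒¬r : ∀ {m} → m < n → (lab m ≡ᵇ 0) ≡ true → r m ≡ false
  zero⇒¬r {m} m<n z = ¬-not λ rm → case trans (sym (≡ᵇ0-true z)) (required m m<n rm) of λ ()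

  lab≤ : ∀ {m k} → m < n → k < n → pre m k ≡ true → lab m ≤ lab k
  lab≤ m<n k<n p with pre⇒ m<n k<n p
  ... | inj₁ h       = <⇒≤ h
  ... | inj₂ (h , _) = ≤-reflexive h

  one : ∀ {m k} → m < n → k < n → pre m k ≡ true → lab k ≡ 1 → (lab m ≡ᵇ 0) ≡ false → lab m ≡ 1
  one {m} m<n k<n p k₁ z = ≤-antisym (subst (lab m ≤_) k₁ (lab≤ m<n k<n p)) (n≢0⇒n>0 (≡ᵇ0-false z))

  same⇒< : ∀ {m k} → m < n → k < n → pre m k ≡ true → lab m ≡ lab k → (m <ᵇ suc k) ≡ true
  same⇒< m<n k<n p e with pre⇒< m<n k<n p
  ... | inj₁ h       = contradiction h (<-irrefl e)
  ... | inj₂ (_ , h) = h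

  -- Jobs that come no later than a label-0 job are at positions up to `k`. For a label-1 job in the
  -- early part, label-0 jobs above `k` are added. For a label-2 job, these are all r-jobs,
  -- non-r-jobs up to `k`, and label-0 jobs above: a label-1 non-r-job lies below `i*`, hence below
  -- `k`.
  C<D : ∀ k → k < n → Cᵖ k < D k
  C<D k k<n with <3-cases (low k k<n)
  ... | inj₁ k₀ = ≤-<-trans (subst (Cᵖ k ≤_) (restrict q k<n) (∑-mono n bound)) (before k k<n k₀)
    where
    bound : ∀ m → m < n → pre m k ⊙ q m ≤ (m <ᵇ suc k) ⊙ q m
    bound m m<n with pre m k in p
    ... | false = z≤n
    ... | true rewrite same⇒< m<n k<n p
      (trans (n≤0⇒n≡0 (subst (lab m ≤_) k₀ (lab≤ m<n k<n p))) (sym k₀)) = ≤-refl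
  C<D k k<n | inj₂ (inj₁ k₁) with k <? i*
  ... | yes k<i* = +-cancelʳ-< (B₀ (suc k)) (Cᵖ k) (D k) (≤-<-trans
    (subst₂ _≤_ (cong (λ z → Cᵖ k + z) (restrict _ k<n)) (cong₂ _+_ (restrict q k<n) S≡)
      (∑-≤₂ n λ m m<n → ⊙-≤₂ (pre m k) (m <ᵇ suc k) (lab m ≡ᵇ 0) (q m)
        (λ p c → ¬-not-false λ z → case trans (sym c) (same⇒< m<n k<n p (trans (one m<n k<n p k₁ z) (sym k₁))) of λ ())))
    (early′ k k<i* k₁))
    where
    ¬-not-false : ∀ {b} → (b ≡ false → ⊥) → b ≡ true
    ¬-not-false {true}  _ = refl
    ¬-not-false {false} h = ⊥-elim (h refl)
  -- Here `k` is an r-job. Label-1 jobs up to it are r-jobs at positions up to `k` or non-r-jobs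
  -- below `i*`, which is the situation the threshold anticipated.
  ... | no  k≮i* = +-cancelʳ-< (B₀ i*) (Cᵖ k) (D k) (≤-<-trans
    (subst₂ _≤_ (cong (λ z → Cᵖ k + z) (∑-restrict n _ i*≤))
                (cong₂ _+_ (restrict _ k<n) (cong₂ _+_ (∑-restrict n _ i*≤) S≡))
      (∑-≤₃ n λ m m<n → ⊙-≤₃ (pre m k) (m <ᵇ i*) (lab m ≡ᵇ 0) (m <ᵇ suc k) (r m) (q m)
        (zero⇒¬r m<n)
        (λ p z rm → same⇒< m<n k<n p (trans (one m<n k<n p k₁ z) (sym k₁)))
        (λ p z rm → <ᵇ-true (≰⇒> λ i*≤m → case trans (sym rm)
          (inside m m<n i*≤m (one m<n k<n p k₁ z)) of λ ()))))
    (fits k (≮⇒≥ k≮i*) k<n (inside k k<n (≮⇒≥ k≮i*) k₁)))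
  C<D k k<n | inj₂ (inj₂ k₂) with after k k<n k₂
  ... | i*≤k , h = +-cancelʳ-< (B₀ (suc k)) (Cᵖ k) (D k) (≤-<-trans
    (subst₂ _≤_ (cong (λ z → Cᵖ k + z) (restrict _ k<n))
                (cong (λ z → RT + z) (cong₂ _+_ (restrict _ k<n) S≡))
      (∑-≤₃ n λ m m<n → ⊙-≤₃ (pre m k) (m <ᵇ suc k) (lab m ≡ᵇ 0) true (r m) (q m)
        (zero⇒¬r m<n) (λ _ _ _ → refl)
        (λ p z rm → placed m<n p z rm)))
    h)
    where
    placed : ∀ {m} → m < n → pre m k ≡ true → (lab m ≡ᵇ 0) ≡ false → r m ≡ false → (m <ᵇ suc k) ≡ true
    placed {m} m<n p z rm with <3-cases (low m m<n)
    ... | inj₁ m₀ = contradiction m₀ (≡ᵇ0-false z)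
    ... | inj₂ (inj₂ m₂) = same⇒< m<n k<n p (trans m₂ (sym k₂))
    ... | inj₂ (inj₁ m₁) = <ᵇ-true (<-trans (≰⇒> λ i*≤m → case trans (sym rm) (inside m m<n i*≤m m₁) of λ ())
                                            (s≤s i*≤k))

  -- A job no later than an r-job has label 0, or is an r-job, or is a non-r-job of label 1. Since
  -- r-jobs start at `S` or later, this leaves `RT + O₁ n` for the renting period.
  C≤ : ∀ k → k < n → r k ≡ true → Cᵖ k ≤ S + (RT + O₁ n)
  C≤ k k<n rk = subst₂ _≤_ (trans (cong (λ z → Cᵖ k + z) (∑-zero n)) (+-identityʳ (Cᵖ k)))
    (cong (λ z → z + (RT + O₁ n)) S≡)
    -- The zero family fills the second place on the left, which this estimate leaves empty.
    (∑-≤₃ n {g = λ _ → 0} λ m m<n → bound (pre m k) (lab m ≡ᵇ 0) (r m) (lab m ≡ᵇ 1) (q m)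
      λ p z → cong (_≡ᵇ 1) (one m<n k<n p (required k k<n rk) z))
    where
    ∑-zero : ∀ n → ∑ n (λ _ → 0) ≡ 0
    ∑-zero zero    = refl
    ∑-zero (suc n) = trans (+-identityʳ _) (∑-zero n)

    bound : ∀ a z r o x → (a ≡ true → z ≡ false → o ≡ true) →
            a ⊙ x + 0 ≤ z ⊙ x + (r ⊙ x + (not r ∧ o) ⊙ x)
    bound false z     r     o     x h = z≤n
    bound true  true  r     o     x h = +-monoʳ-≤ x z≤n
    bound true  false true  o     x h = ≤-refl
    bound true  false false true  x h = ≤-reflexive (+-identityʳ x)
    bound true  false false false x h = case h refl refl of λ ()

-- Every feasible sequence yields a labelling that is no more expensive

⊙-≤-last′ : ∀ e c a x → (c ≡ true → a ≡ true) → (e ≡ true → a ≡ true) →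
            e ⊙ x + c ⊙ x ≤ a ⊙ x + e ⊙ c ⊙ x
⊙-≤-last′ e     true  false x h₂ h₃ = case h₂ refl of λ ()
⊙-≤-last′ true  false false x h₂ h₃ = case h₃ refl of λ ()
⊙-≤-last′ true  c     true  x h₂ h₃ = ≤-refl
⊙-≤-last′ false true  true  x h₂ h₃ = ≤-reflexive (sym (+-identityʳ x))
⊙-≤-last′ false false a     x h₂ h₃ = z≤n

-- The summand of `Rr j + (Oo i + B n) ≤ Cτ x + B i`: `u` and `e` stand for positions below `j` and
-- `i`, `c` for jobs before the renting period, `a` for jobs no later than `x`. A job with both `e`
-- and `c` is counted twice on the left, hence the last term.
⊙-≤-last : ∀ u e r c a x → (c ≡ true → r ≡ false) → (c ≡ true → a ≡ true) → (e ≡ true → a ≡ true) →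
           (u ≡ true → r ≡ true → a ≡ true) →
           u ⊙ r ⊙ x + (e ⊙ not r ⊙ x + c ⊙ x) ≤ a ⊙ x + e ⊙ c ⊙ x
⊙-≤-last u     e     true  true  a     x h₁ h₂ h₃ h₄ = case h₁ refl of λ ()
⊙-≤-last true  e     true  false true  x h₁ h₂ h₃ h₄ = +-monoʳ-≤ x (≤-reflexive (+-identityʳ (e ⊙ 0)))
⊙-≤-last true  e     true  false false x h₁ h₂ h₃ h₄ = case h₄ refl refl of λ ()
⊙-≤-last false true  true  false a     x h₁ h₂ h₃ h₄ = z≤n
⊙-≤-last false false true  false a     x h₁ h₂ h₃ h₄ = z≤n
⊙-≤-last true  e     false c     a     x h₁ h₂ h₃ h₄ = ⊙-≤-last′ e c a x h₂ h₃
⊙-≤-last false e     false c     a     x h₁ h₂ h₃ h₄ = ⊙-≤-last′ e c a x h₂ h₃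

module Completeness (n : ℕ) (q D : ℕ → ℕ) (r : ℕ → Bool) (τ : ℕ → ℕ)
  (sorted : ∀ {i j} → i ≤ j → j < n → D i ≤ D j)
  (feasible : ∀ k → k < n → ∑ n (λ m → (τ m ≤ᵇ τ k) ⊙ q m) < D k)
  {rf rl : ℕ} (rf<n : rf < n) (r-rf : r rf ≡ true)
  (first : ∀ k → k < n → r k ≡ true → τ rf ≤ τ k)
  (last  : ∀ k → k < n → r k ≡ true → τ k ≤ τ rl)
  where

  open Scan n q D r

  Cτ : ℕ → ℕ
  Cτ k = ∑ n (λ m → (τ m ≤ᵇ τ k) ⊙ q m)

  c : ℕ → Bool
  c k = τ k <ᵇ τ rf

  B : ℕ → ℕ
  B i = ∑ i (λ k → c k ⊙ q k)

  inside : ℕ → Bool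
  inside k = not (r k) ∧ ((τ rf ≤ᵇ τ k) ∧ (τ k ≤ᵇ τ rl))

  M : ℕ → ℕ
  M i = ∑ i (λ k → inside k ⊙ q k)

  c⇒¬r : ∀ {k} → k < n → c k ≡ true → r k ≡ false
  c⇒¬r k<n ck = ¬-not λ rk → <⇒≱ (<ᵇ-true⁻ ck) (first _ k<n rk)

  r⇒¬c : ∀ {k} → k < n → r k ≡ true → c k ≡ false
  r⇒¬c k<n rk = <ᵇ-false (first _ k<n rk)

  -- x plays the last job of σ among those named on the left-hand side: it is due no later
  -- than t, and all of them have been processed when it completes.
  bound : ∀ {x t} i j {b} → i ≤ n → j ≤ n → x < n → D x ≤ D t →
          (∀ k → k < j → r k ≡ true → τ k ≤ τ x) → (∀ k → k < i → τ k ≤ τ x) → τ rf ≤ τ x →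
          b + B i ≡ B n → Rr j + (Oo i + b) < D t
  bound {x} {t} i j {b} i≤n j≤n x<n Dx≤ hr hi hf eq = ≤-<-trans
    (+-cancelʳ-≤ (B i) _ _ (subst (_≤ Cτ x + B i) (lem (Rr j) (Oo i) b (B i))
      (subst (λ z → Rr j + (Oo i + z) ≤ Cτ x + B i) (sym eq)
        (subst₂ _≤_ (cong₂ _+_ (∑-restrict n _ j≤n)
                      (trans (sym (∑-+ n _ _)) (cong (λ z → z + B n) (∑-restrict n _ i≤n))))
                    (trans (sym (∑-+ n _ _)) (cong (λ z → Cτ x + z) (∑-restrict n _ i≤n)))
          (≤-trans (≤-reflexive (∑-+ n _ _))
            (∑-mono n λ k k<n → ⊙-≤-last (k <ᵇ j) (k <ᵇ i) (r k) (c k) (τ k ≤ᵇ τ x) (q k)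
              (c⇒¬r k<n)
              (λ ck → ≤ᵇ-true (≤-trans (<⇒≤ (<ᵇ-true⁻ ck)) hf))
              (λ k<i → ≤ᵇ-true (hi k (<ᵇ-true⁻ k<i)))
              (λ k<j rk → ≤ᵇ-true (hr k (<ᵇ-true⁻ k<j) rk))))))))
    (<-≤-trans (feasible x x<n) Dx≤)
    where
    lem : ∀ a o b c → a + (o + (b + c)) ≡ (a + (o + b)) + c
    lem = solve-∀

  last-below : ∀ i → i < n → ∃[ x ] x < suc i × ∀ k → k < suc i → τ k ≤ τ x
  last-below i i<n with argmax τ (λ _ → true) {suc i} {i} ≤-refl refl
  ... | x , x≤i , _ , max = x , x≤i , λ k k≤i → max k k≤i refl

  -- The classical argument for EDD: of the jobs at positions up to `i`, the one last in the given
  -- sequence completes after all of them and is due no later than `i`.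
  pen₀≡0 : ∀ i → i < n → pen₀ i ≡ 0
  pen₀≡0 i i<n with last-below i i<n
  ... | x , x≤i , max = pen-sat (≤-<-trans
    (subst (_≤ Cτ x) (∑-restrict n q i<n) (∑-mono n λ m _ → le m))
    (<-≤-trans (feasible x (≤-trans x≤i i<n)) (sorted (≤-pred x≤i) i<n)))
    where
    le : ∀ m → (m <ᵇ suc i) ⊙ q m ≤ (τ m ≤ᵇ τ x) ⊙ q m
    le m with m <ᵇ suc i in h
    ... | false = z≤n
    ... | true  rewrite ≤ᵇ-true (max m (<ᵇ-true⁻ h)) = ≤-refl

  -- As `i` does not precede the renting period, the last job among the positions up to `i` does not
  -- either, so all label-0 jobs complete before it as well.
  pen₁≡0 : ∀ i {b} → i < n → c i ≡ false → b + B (suc i) ≡ B n → pen₁ i b ≡ 0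
  pen₁≡0 i {b} i<n ci eq with last-below i i<n
  ... | x , x≤i , max = pen-sat (subst (_< D i)
    (trans (sym (+-assoc (Rr (suc i)) (Oo (suc i)) b)) (cong (λ z → z + b) (Rr+Oo (suc i))))
    (bound (suc i) (suc i) i<n i<n (≤-trans x≤i i<n) (sorted (≤-pred x≤i) i<n)
      (λ k k≤i _ → max k k≤i) max (≤-trans (<ᵇ-false⁻ ci) (max i ≤-refl)) eq))

  -- For an r-job `m` at or above `i`, the witness is the last, in the given sequence, among the
  -- positions up to `m` that hold r-jobs or lie below `i`. The bound `small` is what `⇒ρ` needs for
  -- its infinite value.
  pen₂≡0 : ∀ i {b} → i ≤ n → b + B i ≡ B n → pen₂ i b ≡ 0
  pen₂≡0 i {b} i≤n eq = pen-sat (⇒ρ i≤n small fits)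
    where
    fits : RFits i (Oo i + b)
    fits m i≤m m<n rm with argmax τ (λ k → r k ∨ (k <ᵇ i)) {suc m} {m} ≤-refl (cong (_∨ (m <ᵇ i)) rm)
    ... | x , x≤m , _ , max = bound i (suc m) i≤n m<n (≤-trans x≤m m<n) (sorted (≤-pred x≤m) m<n)
      (λ k k≤m rk → max k k≤m (cong (_∨ (k <ᵇ i)) rk))
      (λ k k<i → max k (m≤n⇒m≤1+n (≤-trans k<i i≤m))
        (trans (cong (r k ∨_) (<ᵇ-true k<i)) (Bool.∨-zeroʳ (r k))))
      (≤-trans (first m m<n rm) (max m ≤-refl (cong (_∨ (m <ᵇ i)) rm))) eq

    pw : ∀ e c x → e ⊙ x + c ⊙ x ≤ x + e ⊙ c ⊙ x
    pw false false x = z≤n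
    pw false true  x = m≤m+n x 0
    pw true  c     x = ≤-refl

    small : Oo i + b ≤ Tot
    small = ≤-trans (+-monoˡ-≤ b (subst (Oo i ≤_) (Rr+Oo i) (m≤n+m (Oo i) (Rr i))))
      (+-cancelʳ-≤ (B i) _ _ (subst (_≤ Tot + B i)
        (trans (cong (λ z → Pre i + z) (sym eq)) (sym (+-assoc (Pre i) b (B i))))
        (subst₂ _≤_ (cong (λ z → z + B n) (∑-restrict n q i≤n))
                    (cong (λ z → Tot + z) (∑-restrict n _ i≤n))
          (∑-≤₂ n λ k _ → pw (k <ᵇ i) (c k) (q k)))))

  B-c : ∀ {i b} → c i ≡ true → b + B (suc i) ≡ B n → b + q i + B i ≡ B n
  B-c {i} {b} ci eq rewrite ci = trans (lem b (q i) (B i)) eq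
    where
    lem : ∀ b x y → b + x + y ≡ b + (y + x)
    lem = solve-∀

  B-¬c : ∀ {i b} → c i ≡ false → b + B (suc i) ≡ B n → b + B i ≡ B n
  B-¬c {i} {b} ci eq rewrite ci = trans (cong (λ z → b + z) (sym (+-identityʳ (B i)))) eq

  M-in : ∀ {i} → r i ≡ false → c i ≡ false → τ i ≤ τ rl → M (suc i) ≡ q i + M i
  M-in {i} ri ci ≤rl rewrite ri | ≤ᵇ-true (<ᵇ-false⁻ {τ i} {τ rf} ci) | ≤ᵇ-true ≤rl = +-comm (M i) (q i)

  -- The minimum is bounded by the branch that copies the given sequence: label 0 before its renting
  -- period, label 1 otherwise. The last hypothesis says that no remaining job follows the period,
  -- so each non-r-job given label 1 here is paid for by `M`.
  V-early≤ : ∀ i b → i ≤ n → b + B i ≡ B n → (∀ k → k < i → τ k ≤ τ rl) → V early i b ≤ M i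
  V-early≤ zero    b i≤n eq ≤rl = z≤n
  V-early≤ (suc i) b i<n eq ≤rl with r i Bool.≟ true | c i Bool.≟ true
  ... | yes ri | _ = begin
    V early (suc i) b        ≡⟨ V-early-r b ri ⟩
    pen₁ i b + V early i b   ≡⟨ cong (_+ V early i b) (pen₁≡0 i i<n (r⇒¬c i<n ri) eq) ⟩
    V early i b              ≤⟨ V-early≤ i b (<⇒≤ i<n) (B-¬c {b = b} (r⇒¬c i<n ri) eq)
                                             (λ k k<i → ≤rl k (m<n⇒m<1+n k<i)) ⟩
    M i                      ≤⟨ m≤m+n (M i) _ ⟩
    M (suc i)                ∎
    where open ≤-Reasoning
  ... | no ¬ri | yes ci = begin
    V early (suc i) b                   ≡⟨ V-early-o b (¬-not ¬ri) ⟩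
    _                                   ≤⟨ m⊓n≤m _ _ ⟩
    pen₀ i + V early i (b + q i)        ≡⟨ cong (_+ V early i (b + q i)) (pen₀≡0 i i<n) ⟩
    V early i (b + q i)                 ≤⟨ V-early≤ i (b + q i) (<⇒≤ i<n) (B-c {b = b} ci eq)
                                             (λ k k<i → ≤rl k (m<n⇒m<1+n k<i)) ⟩
    M i                                 ≤⟨ m≤m+n (M i) _ ⟩
    M (suc i)                           ∎
    where open ≤-Reasoning
  ... | no ¬ri | no ¬ci = begin
    V early (suc i) b                   ≡⟨ V-early-o b (¬-not ¬ri) ⟩
    _                                   ≤⟨ m⊓n≤n _ _ ⟩
    q i + (pen₁ i b + V early i b)      ≡⟨ cong (λ z → q i + (z + V early i b)) (pen₁≡0 i i<n (¬-not ¬ci) eq) ⟩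
    q i + V early i b                   ≤⟨ +-monoʳ-≤ (q i) (V-early≤ i b (<⇒≤ i<n) (B-¬c {b = b} (¬-not ¬ci) eq)
                                             (λ k k<i → ≤rl k (m<n⇒m<1+n k<i))) ⟩
    q i + M i                           ≡⟨ sym (M-in (¬-not ¬ri) (¬-not ¬ci) (≤rl i ≤-refl)) ⟩
    M (suc i)                           ∎
    where open ≤-Reasoning

  -- If i cannot follow the renting period, neither can any earlier-due job in σ: the last
  -- such job would complete too late.
  none-after : ∀ i {b} → i < n → b + B (suc i) ≡ B n → D i ≤ RT + (Oo (suc i) + b) →
               ∀ k → k < suc i → τ k ≤ τ rl
  none-after i {b} i<n eq tight k k≤i with last-below i i<n
  ... | x , x≤i , max with τ x ≤? τ rl
  ...   | yes x≤rl = ≤-trans (max k k≤i) x≤rl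
  ...   | no  x≰rl = contradiction tight (<⇒≱
    (bound (suc i) n i<n ≤-refl (≤-trans x≤i i<n) (sorted (≤-pred x≤i) i<n)
      (λ m m<n rm → ≤-trans (last m m<n rm) (≰⇒≥ x≰rl)) max
      (≤-trans (last rf rf<n r-rf) (≰⇒≥ x≰rl)) eq))

  -- The branch taken departs from the given sequence only where a job of its renting period fits
  -- after it: label 2 is then free. At the first job that does not fit, `none-after` provides the
  -- hypothesis of `V-early≤`.
  V-late≤ : ∀ i b → i ≤ n → b + B i ≡ B n → V late i b ≤ M i
  V-late≤ zero    b i≤n eq = ≤-reflexive (pen₂≡0 0 i≤n eq)
  V-late≤ (suc i) b i<n eq with r i Bool.≟ true | c i Bool.≟ true | suc (RT + (Oo (suc i) + b)) ≤? D i
  ... | yes ri | _ | _ = begin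
    V late (suc i) b   ≡⟨ V-late-r b ri ⟩
    V late i b         ≤⟨ V-late≤ i b (<⇒≤ i<n) (B-¬c {b = b} (r⇒¬c i<n ri) eq) ⟩
    M i                ≤⟨ m≤m+n (M i) _ ⟩
    M (suc i)          ∎
    where open ≤-Reasoning
  ... | no ¬ri | yes ci | _ = begin
    V late (suc i) b                    ≡⟨ V-late-o b (¬-not ¬ri) ⟩
    _                                   ≤⟨ m⊓n≤m _ _ ⟩
    pen₀ i + V late i (b + q i)         ≡⟨ cong (_+ V late i (b + q i)) (pen₀≡0 i i<n) ⟩
    V late i (b + q i)                  ≤⟨ V-late≤ i (b + q i) (<⇒≤ i<n) (B-c {b = b} ci eq) ⟩
    M i                                 ≤⟨ m≤m+n (M i) _ ⟩
    M (suc i)                           ∎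
    where open ≤-Reasoning
  ... | no ¬ri | no ¬ci | yes fits = begin
    V late (suc i) b                    ≡⟨ V-late-o b (¬-not ¬ri) ⟩
    _                                   ≤⟨ m⊓n≤n _ _ ⟩
    put₁₂ i b (V early i b) (V late i b) ≡⟨ put₁₂-fits i b _ _ fits ⟩
    V late i b                          ≤⟨ V-late≤ i b (<⇒≤ i<n) (B-¬c {b = b} (¬-not ¬ci) eq) ⟩
    M i                                 ≤⟨ m≤m+n (M i) _ ⟩
    M (suc i)                           ∎
    where open ≤-Reasoning
  ... | no ¬ri | no ¬ci | no tight = begin
    V late (suc i) b                    ≡⟨ V-late-o b (¬-not ¬ri) ⟩
    _                                   ≤⟨ m⊓n≤n _ _ ⟩
    put₁₂ i b (V early i b) (V late i b) ≡⟨ put₁₂-tight i b _ _ (≮⇒≥ tight) ⟩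
    pen₂ (suc i) b + put₁ i b (V early i b) ≡⟨ cong (_+ put₁ i b (V early i b)) (pen₂≡0 (suc i) i<n eq) ⟩
    q i + (pen₁ i b + V early i b)      ≡⟨ cong (λ z → q i + (z + V early i b)) (pen₁≡0 i i<n (¬-not ¬ci) eq) ⟩
    q i + V early i b                   ≤⟨ +-monoʳ-≤ (q i) (V-early≤ i b (<⇒≤ i<n) (B-¬c {b = b} (¬-not ¬ci) eq)
                                             (λ k k<i → ≤rl k (m<n⇒m<1+n k<i))) ⟩
    q i + M i                           ≡⟨ sym (M-in (¬-not ¬ri) (¬-not ¬ci) (≤rl i ≤-refl)) ⟩
    M (suc i)                           ∎
    where
    open ≤-Reasoning
    ≤rl : ∀ k → k < suc i → τ k ≤ τ rl
    ≤rl = none-after i i<n eq (≮⇒≥ tight)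

  V≤M : V late n 0 ≤ M n
  V≤M = V-late≤ n 0 ≤-refl refl

  M≤Tot : M n ≤ Tot
  M≤Tot = ∑-mono n λ k _ → pw (inside k) (q k)
    where
    pw : ∀ a x → a ⊙ x ≤ x
    pw true  x = ≤-refl
    pw false x = z≤n

  -- The r-jobs, the other jobs inside the period and the jobs before it are disjoint, and all are
  -- completed when `rl` is.
  RT+M≤ : RT + M n ≤ Cτ rl ∸ B n
  RT+M≤ = m+n≤o⇒m≤o∸n (RT + M n) (subst (_≤ Cτ rl)
    (trans (sym (∑-+ n _ _)) (cong (_+ B n) (sym (∑-+ n _ _))))
    (∑-mono n λ k k<n → pw k k<n))
    where
    pw : ∀ k → k < n → (r k ⊙ q k + inside k ⊙ q k) + c k ⊙ q k ≤ (τ k ≤ᵇ τ rl) ⊙ q k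
    pw k k<n with r k Bool.≟ true | c k Bool.≟ true | τ k ≤? τ rl
    ... | yes rk | _ | _ rewrite rk | r⇒¬c k<n rk | ≤ᵇ-true (last k k<n rk) =
      ≤-reflexive (trans (+-identityʳ _) (+-identityʳ (q k)))
    ... | no ¬rk | yes ck | _
      rewrite ¬-not ¬rk | ck | ≤ᵇ-false (<ᵇ-true⁻ {τ k} {τ rf} ck)
            | ≤ᵇ-true (≤-trans (<⇒≤ (<ᵇ-true⁻ {τ k} {τ rf} ck)) (last rf rf<n r-rf)) = ≤-refl
    ... | no ¬rk | no ¬ck | yes ≤rl
      rewrite ¬-not ¬rk | ¬-not ¬ck | ≤ᵇ-true (<ᵇ-false⁻ {τ k} {τ rf} (¬-not ¬ck)) | ≤ᵇ-true ≤rl =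
      ≤-reflexive (+-identityʳ (q k))
    ... | no ¬rk | no ¬ck | no ≰rl
      rewrite ¬-not ¬rk | ¬-not ¬ck | ≤ᵇ-false (≰⇒> ≰rl) | Bool.∧-zeroʳ (τ rf ≤ᵇ τ k) = z≤n

-- Sequences as permutations

-- Data indexed by `Fin n` are extended to ℕ so that prefixes and the scan use plain arithmetic; the
-- default is seen only from `n` on.
ext : ∀ {a} {A : Set a} {n} → A → (Fin n → A) → ℕ → A
ext {n = zero}  z f k       = z
ext {n = suc n} z f zero    = f Fin.zero
ext {n = suc n} z f (suc k) = ext z (f ∘ Fin.suc) k

ext-toℕ : ∀ {a} {A : Set a} {n} {z : A} (f : Fin n → A) i → ext z f (toℕ i) ≡ f i
ext-toℕ f Fin.zero    = refl
ext-toℕ f (Fin.suc i) = ext-toℕ (f ∘ Fin.suc) i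

∀-toℕ : ∀ {a n} (Q : ℕ → Set a) → (∀ (i : Fin n) → Q (toℕ i)) → ∀ k → k < n → Q k
∀-toℕ Q h k k<n = subst Q (Fin.toℕ-fromℕ< k<n) (h (fromℕ< k<n))

∑-shift : ∀ n f → ∑ (suc n) f ≡ f 0 + ∑ n (f ∘ suc)
∑-shift zero    f = sym (+-identityʳ (f 0))
∑-shift (suc n) f = trans (cong (_+ f (suc n)) (∑-shift n f)) (+-assoc (f 0) _ _)

sum≡∑ : ∀ n {f : Fin n → ℕ} {g : ℕ → ℕ} → (∀ i → f i ≡ g (toℕ i)) → sum f ≡ ∑ n g
sum≡∑ zero    h = refl
sum≡∑ (suc n) {g = g} h = trans (cong₂ _+_ (h Fin.zero) (sum≡∑ n (h ∘ Fin.suc))) (sym (∑-shift n g))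

sum≡∑∘ : ∀ {n} (ω : Permutation′ n) {f : Fin n → ℕ} {g : ℕ → ℕ} → (∀ i → f (ω ⟨$⟩ʳ i) ≡ g (toℕ i)) → sum f ≡ ∑ n g
sum≡∑∘ {n} ω {f} h = trans (sum-permute f ω) (sum≡∑ n h)

∑-single : ∀ {n k} (f : ℕ → ℕ) → k < n → ∑ n (λ m → (m ≡ᵇ k) ⊙ f m) ≡ f k
∑-single {suc n} {k} f k<1+n with m≤n⇒m<n∨m≡n (≤-pred k<1+n)
... | inj₁ k<n  = trans (cong₂ _+_ (∑-single {n} f k<n) (cong (_⊙ f n) (≢⇒≡ᵇ (<⇒≢ k<n ∘ sym)))) (+-identityʳ (f k))
  where
  ≢⇒≡ᵇ : ∀ {m n} → m ≢ n → (m ≡ᵇ n) ≡ false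
  ≢⇒≡ᵇ {m} {n} m≢n = ¬-not λ eq → m≢n (≡ᵇ⇒≡ m n (subst T (sym eq) tt))
... | inj₂ refl = cong₂ _+_ (∑-none k λ m m<k → ¬-not λ eq → <⇒≢ m<k (≡ᵇ⇒≡ m k (subst T (sym eq) tt)))
                            (cong (_⊙ f k) (Equivalence.to Bool.T-≡ (≡⇒≡ᵇ k k refl)))
  where
  ∑-none : ∀ n {c : ℕ → Bool} → (∀ m → m < n → c m ≡ false) → ∑ n (λ m → c m ⊙ f m) ≡ 0
  ∑-none zero    h = refl
  ∑-none (suc n) h = cong₂ _+_ (∑-none n λ m m<n → h m (m<n⇒m<1+n m<n)) (cong (_⊙ f n) (h n ≤-refl))

-- By injectivity the only tie with `k` is `k` itself. This exhibits a start time as the sum over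
-- strict predecessors.
∑-< : ∀ {n k} {q : ℕ → ℕ} (τ : ℕ → ℕ) → (∀ m → m < n → τ m ≡ τ k → m ≡ k) → k < n →
      ∑ n (λ m → (τ m ≤ᵇ τ k) ⊙ q m) ≡ ∑ n (λ m → (τ m <ᵇ τ k) ⊙ q m) + q k
∑-< {n} {k} {q} τ inj k<n = trans (trans (∑-cong n pw) (sym (∑-+ n _ _)))
  (cong (λ z → ∑ n (λ m → (τ m <ᵇ τ k) ⊙ q m) + z) (∑-single q k<n))
  where
  pw : ∀ m → m < n → (τ m ≤ᵇ τ k) ⊙ q m ≡ (τ m <ᵇ τ k) ⊙ q m + (m ≡ᵇ k) ⊙ q m
  pw m m<n with m ≟ k
  ... | yes refl rewrite ≤ᵇ-true (≤-refl {τ m}) | <ᵇ-false (≤-refl {τ m})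
                       | Equivalence.to Bool.T-≡ (≡⇒≡ᵇ m m refl) = refl
  ... | no m≢k with τ m ≤? τ k
  ...   | no  τm≰τk rewrite ≤ᵇ-false (≰⇒> τm≰τk) | <ᵇ-false (≰⇒≥ τm≰τk)
                      | ¬-not {m ≡ᵇ k} {true} (λ eq → m≢k (≡ᵇ⇒≡ m k (subst T (sym eq) tt))) = refl
  ...   | yes τm≤τk rewrite ≤ᵇ-true τm≤τk | <ᵇ-true (≤∧≢⇒< τm≤τk (m≢k ∘ inj m m<n))
                      | ¬-not {m ≡ᵇ k} {true} (λ eq → m≢k (≡ᵇ⇒≡ m k (subst T (sym eq) tt))) = sym (+-identityʳ _)

-- C ≤ δ in ℤ for C ≤ P becomes C < clip P δ in ℕ.
clip : ℕ → ℤ → ℕ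
clip P (+ m)    = suc (m ⊓ P)
clip P -[1+ m ] = 0

≤⇒<clip : ∀ {P c z} → c ≤ P → + c ℤ.≤ z → c < clip P z
≤⇒<clip {z = + m} c≤P (ℤ.+≤+ c≤m) = s≤s (⊓-glb c≤m c≤P)

<clip⇒≤ : ∀ {P c z} → c < clip P z → + c ℤ.≤ z
<clip⇒≤ {z = + m} (s≤s c≤) = ℤ.+≤+ (≤-trans c≤ (m⊓n≤m _ _))

private
  module Maxℕ = Extrema ≤-totalOrder
  module Maxℤ = Extrema ℤ.≤-totalOrder

module Sequences (I : Instance) where

  isR : Fin (n I) → Bool
  isR j = does (j ∈? Jʳ I)

  isR⇒∈ : ∀ {j} → isR j ≡ true → j ∈ rjobs I
  isR⇒∈ {j} eq with j ∈? Jʳ I in dec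
  ... | yes j∈ = ∈-filter⁺ (_∈? Jʳ I) (∈-allFin j) j∈

  ∈⇒isR : ∀ {j} → j ∈ rjobs I → isR j ≡ true
  ∈⇒isR {j} j∈ = dec-true (j ∈? Jʳ I) (proj₂ (∈-filter⁻ (_∈? Jʳ I) {xs = allFin (n I)} j∈))

  isR-j₀ : isR (j₀ I) ≡ true
  isR-j₀ = dec-true (j₀ I ∈? Jʳ I) (proj₂ (nonempty I))

  -- A strict deadline: `C I π j < δ j` says that the lateness of `j` is at most `K`. Its values lie
  -- between 0 and `P I + 1`, which makes it a key for bucket sort.
  δ : Fin (n I) → ℕ
  δ j = clip (P I) (d I j ℤ.+ K I)

  er-≥ : ∀ π {i j} → isR i ≡ true → isR j ≡ true → C I π i ∸ start I π j ≤ er I π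
  er-≥ π ri rj = ∸-mono (All.lookup (Maxℕ.xs≤max (C I π (j₀ I)) (map (C I π) (rjobs I))) (∈-map⁺ (C I π) (isR⇒∈ ri)))
                        (All.lookup (Maxℕ.min≤xs (start I π (j₀ I)) (map (start I π) (rjobs I)))
                                    (∈-map⁺ (start I π) (isR⇒∈ rj)))

  er-≤ : ∀ π {x y} → (∀ j → isR j ≡ true → C I π j ≤ x) → (∀ j → isR j ≡ true → y ≤ start I π j) →
         er I π ≤ x ∸ y
  er-≤ π hi lo = ∸-mono (Maxℕ.max≤v⁺ (hi _ isR-j₀) (All.map⁺ (All.tabulate λ j∈ → hi _ (∈⇒isR j∈))))
                        (Maxℕ.v≤min⁺ (lo _ isR-j₀) (All.map⁺ (All.tabulate λ j∈ → lo _ (∈⇒isR j∈))))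

  C≤P : ∀ π j → C I π j ≤ P I
  C≤P π j = subst₂ _≤_ (sym (sum≡∑ (n I) {g = ext 0 busy} λ i → sym (ext-toℕ busy i)))
                       (sym (sum≡∑ (n I) {g = ext 0 (p I)} λ i → sym (ext-toℕ (p I) i)))
    (∑-mono (n I) (∀-toℕ _ λ i → subst₂ _≤_ (sym (ext-toℕ {z = 0} busy i)) (sym (ext-toℕ {z = 0} (p I) i))
      (le (does ((π ⟨$⟩ˡ i) Fin.≤? (π ⟨$⟩ˡ j))) (p I i))))
    where
    busy : Fin (n I) → ℕ
    busy i = does ((π ⟨$⟩ˡ i) Fin.≤? (π ⟨$⟩ˡ j)) ⊙ p I i
    le : ∀ b x → b ⊙ x ≤ x
    le true  x = ≤-refl
    le false x = z≤n

  Feasible⇒ : ∀ π → Feasible I π → ∀ j → C I π j < δ j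
  Feasible⇒ π feas j = ≤⇒<clip (C≤P π j) (subst₂ ℤ._≤_ (cancel (+ C I π j) (d I j)) (ℤ.+-comm (K I) (d I j))
    (ℤ.+-monoˡ-≤ (d I j) (ℤ.≤-trans
      (All.lookup (Maxℤ.xs≤max (L I π (j₀ I)) (map (L I π) (allFin (n I)))) (∈-map⁺ (L I π) (∈-allFin j))) feas)))
    where
    cancel : ∀ x y → (x ℤ.- y) ℤ.+ y ≡ x
    cancel x y = trans (ℤ.+-assoc x (ℤ.- y) y) (trans (cong (λ z → x ℤ.+ z) (ℤ.+-inverseˡ y)) (ℤ.+-identityʳ x))

  ⇒Feasible : ∀ π → (∀ j → C I π j < δ j) → Feasible I π
  ⇒Feasible π h = Maxℤ.max≤v⁺ {xs = map (L I π) (allFin (n I))} (L≤ (j₀ I)) (All.map⁺ (All.tabulate λ {j} _ → L≤ j))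
    where
    cancel : ∀ x y → (x ℤ.+ y) ℤ.- x ≡ y
    cancel x y = trans (cong (ℤ._- x) (ℤ.+-comm x y)) (trans (ℤ.+-assoc y x (ℤ.- x))
      (trans (cong (λ z → y ℤ.+ z) (ℤ.+-inverseʳ x)) (ℤ.+-identityʳ y)))
    L≤ : ∀ j → L I π j ℤ.≤ K I
    L≤ j = subst (L I π j ℤ.≤_) (cancel (d I j) (K I)) (ℤ.+-monoˡ-≤ (ℤ.- d I j) (<clip⇒≤ (h j)))

  -- ω lists the jobs in EDD order.
  module EDD (ω : Permutation′ (n I)) (sorted : ∀ i j → i Fin.≤ j → δ (ω ⟨$⟩ʳ i) ≤ δ (ω ⟨$⟩ʳ j)) where

    q D : ℕ → ℕ
    q = ext 0 (λ k → p I (ω ⟨$⟩ʳ k))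
    D = ext 0 (λ k → δ (ω ⟨$⟩ʳ k))

    r : ℕ → Bool
    r = ext false (λ k → isR (ω ⟨$⟩ʳ k))

    open Scan (n I) q D r public

    Tot≡P : Tot ≡ P I
    Tot≡P = sym (sum≡∑∘ ω λ i → sym (ext-toℕ _ i))

    r-at : ∀ j → r (toℕ (ω ⟨$⟩ˡ j)) ≡ isR j
    r-at j = trans (ext-toℕ _ (ω ⟨$⟩ˡ j)) (cong isR (inverseʳ ω))

    D-at : ∀ j → D (toℕ (ω ⟨$⟩ˡ j)) ≡ δ j
    D-at j = trans (ext-toℕ _ (ω ⟨$⟩ˡ j)) (cong δ (inverseʳ ω))

    q-at : ∀ j → q (toℕ (ω ⟨$⟩ˡ j)) ≡ p I j
    q-at j = trans (ext-toℕ _ (ω ⟨$⟩ˡ j)) (cong (p I) (inverseʳ ω))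

    D-sorted : ∀ {i j} → i ≤ j → j < n I → D i ≤ D j
    D-sorted {i} {j} i≤j j<n =
      ∀-toℕ (λ j → i ≤ j → D i ≤ D j) (λ b i≤b →
        ∀-toℕ (λ i → i ≤ toℕ b → D i ≤ D (toℕ b))
          (λ a a≤b → subst₂ _≤_ (sym (ext-toℕ _ a)) (sym (ext-toℕ _ b)) (sorted a b a≤b))
          i (≤-<-trans i≤b (Fin.toℕ<n b)) i≤b) j j<n i≤j

    module Ranks (σ : Sequence I) where

      τ : ℕ → ℕ
      τ = ext 0 (λ k → toℕ (σ ⟨$⟩ˡ (ω ⟨$⟩ʳ k)))

      τ-at : ∀ j → τ (toℕ (ω ⟨$⟩ˡ j)) ≡ toℕ (σ ⟨$⟩ˡ j)
      τ-at j = trans (ext-toℕ _ (ω ⟨$⟩ˡ j)) (cong (λ j → toℕ (σ ⟨$⟩ˡ j)) (inverseʳ ω))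

      τ-injective : ∀ k → k < n I → ∀ m → m < n I → τ m ≡ τ k → m ≡ k
      τ-injective = ∀-toℕ _ λ k → ∀-toℕ _ λ m eq → cong toℕ (inj (Fin.toℕ-injective
        (trans (sym (ext-toℕ _ m)) (trans eq (ext-toℕ _ k)))))
        where
        inj : ∀ {m k} → σ ⟨$⟩ˡ (ω ⟨$⟩ʳ m) ≡ σ ⟨$⟩ˡ (ω ⟨$⟩ʳ k) → m ≡ k
        inj {m} {k} eq = trans (sym (inverseˡ ω)) (trans (cong (ω ⟨$⟩ˡ_)
          (trans (sym (inverseʳ σ)) (trans (cong (σ ⟨$⟩ʳ_) eq) (inverseʳ σ)))) (inverseˡ ω))

      C≡ : ∀ j → C I σ j ≡ ∑ (n I) (λ m → (τ m ≤ᵇ τ (toℕ (ω ⟨$⟩ˡ j))) ⊙ q m)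
      C≡ j = sum≡∑∘ ω λ i → cong₂ _⊙_
        (cong₂ _≤ᵇ_ (sym (ext-toℕ _ i)) (sym (τ-at j))) (sym (ext-toℕ _ i))

      start≡ : ∀ j → start I σ j ≡ ∑ (n I) (λ m → (τ m <ᵇ τ (toℕ (ω ⟨$⟩ˡ j))) ⊙ q m)
      start≡ j = trans (cong₂ _∸_ (trans (C≡ j) (∑-< τ
        (τ-injective _ (Fin.toℕ<n (ω ⟨$⟩ˡ j))) (Fin.toℕ<n (ω ⟨$⟩ˡ j)))) (sym (q-at j))) (m+n∸n≡m _ (q (toℕ (ω ⟨$⟩ˡ j))))

    at : ∀ (Q : ℕ → Set) → (∀ j → Q (toℕ (ω ⟨$⟩ˡ j))) → ∀ k → k < n I → Q k
    at Q h = ∀-toℕ Q λ i → subst (Q ∘ toℕ) (inverseˡ ω) (h (ω ⟨$⟩ʳ i))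

    -- The second component is the lower bound for optimality; the first, read contrapositively,
    -- shows that a value above `Tot` means infeasibility.
    feasible⇒V : ∀ σ → Feasible I σ → V late (n I) 0 ≤ Tot × RT + V late (n I) 0 ≤ er I σ
    feasible⇒V σ feas
      with argmin τ r {n I} (Fin.toℕ<n (ω ⟨$⟩ˡ j₀ I)) (trans (r-at _) isR-j₀)
         | argmax τ r {n I} (Fin.toℕ<n (ω ⟨$⟩ˡ j₀ I)) (trans (r-at _) isR-j₀)
      where open Ranks σ
    ... | rf , rf<n , r-rf , first | rl , rl<n , r-rl , last =
      ≤-trans V≤M M≤Tot ,
      ≤-trans (+-monoʳ-≤ RT V≤M) (≤-trans RT+M≤ er≥)
      where
      open Ranks σ
      open Completeness (n I) q D r τ D-sorted
        (at _ λ j → subst₂ _<_ (C≡ j) (sym (D-at j)) (Feasible⇒ σ feas j)) rf<n r-rf first last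
      er≥ : Cτ rl ∸ B (n I) ≤ er I σ
      er≥ = at (λ rl → r rl ≡ true → Cτ rl ∸ B (n I) ≤ er I σ)
        (λ j rj → at (λ rf → r rf ≡ true → Cτ (toℕ (ω ⟨$⟩ˡ j)) ∸ ∑ (n I) (λ k → (τ k <ᵇ τ rf) ⊙ q k) ≤ er I σ)
          (λ i ri → subst₂ (λ x y → x ∸ y ≤ er I σ) (C≡ j) (start≡ i)
            (er-≥ σ (trans (sym (r-at j)) rj) (trans (sym (r-at i)) ri)))
          rf rf<n r-rf) rl rl<n r-rl

    lab : Fin (n I) → ℕ
    lab j = labels late (n I) 0 (toℕ (ω ⟨$⟩ˡ j))

    ByLabel : Sequence I → Set
    ByLabel π = ∀ i j → π ⟨$⟩ˡ i Fin.≤ π ⟨$⟩ˡ j →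
      lab i < lab j ⊎ lab i ≡ lab j × ω ⟨$⟩ˡ i Fin.≤ ω ⟨$⟩ˡ j

    -- The chain is `er π ≤ (S + (RT + O₁)) ∸ S ≤ RT + V ≤ er σ`, with `V` the value of the scan:
    -- r-jobs start no earlier than `S`, since every label-0 job precedes them.
    optimal : ∀ π → ByLabel π → V late (n I) 0 ≤ Tot → Optimal I π
    optimal π by V≤ = ⇒Feasible π (λ j → subst₂ _<_ (sym (C≡ j)) (D-at j) (C<D _ (Fin.toℕ<n _))) ,
      λ σ feas → ≤-trans er≤ (proj₂ (feasible⇒V σ feas))
      where
      open Ranks π
      module So = Soundness (n I) q D r (labels late (n I) 0)
      S : ℕ
      S = ∑ (n I) (λ k → (labels late (n I) 0 k ≡ᵇ 0) ⊙ q k)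
      val : So.Valid S (n I) (V late (n I) 0)
      val = So.valid S (n I) 0 ≤-refl (λ _ _ → refl) refl V≤
      pre⇒ : ∀ m → m < n I → ∀ k → k < n I → (τ m ≤ᵇ τ k) ≡ true →
        labels late (n I) 0 m < labels late (n I) 0 k ⊎ labels late (n I) 0 m ≡ labels late (n I) 0 k × m ≤ k
      pre⇒ = at _ λ i → at _ λ j le → by i j (subst₂ _≤_ (τ-at i) (τ-at j) (≤ᵇ-true⁻ le))
      open Bounds (n I) q D r (labels late (n I) 0) S refl val (λ m k → τ m ≤ᵇ τ k)
        (λ m<n k<n → pre⇒ _ m<n _ k<n)
      lab-r : ∀ j → isR j ≡ true → lab j ≡ 1
      lab-r j rj = So.Valid.required val _ (Fin.toℕ<n _) (trans (r-at j) rj)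
      S≤ : ∀ j → isR j ≡ true → S ≤ start I π j
      S≤ j rj = subst (S ≤_) (sym (start≡ j)) (∑-mono (n I) (at _ pw))
        where
        pw : ∀ i → (lab i ≡ᵇ 0) ⊙ q (toℕ (ω ⟨$⟩ˡ i)) ≤
                   (τ (toℕ (ω ⟨$⟩ˡ i)) <ᵇ τ (toℕ (ω ⟨$⟩ˡ j))) ⊙ q (toℕ (ω ⟨$⟩ˡ i))
        pw i with lab i ≡ᵇ 0 in l₀ | π ⟨$⟩ˡ j Fin.≤? π ⟨$⟩ˡ i
        ... | false | _ = z≤n
        ... | true  | no  j≰i rewrite <ᵇ-true (subst₂ _<_ (sym (τ-at i)) (sym (τ-at j)) (≰⇒> j≰i)) = ≤-refl
        ... | true  | yes j≤i with by j i j≤i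
        ...   | inj₁ l<       = contradiction (subst₂ _<_ (lab-r j rj) (≡ᵇ0-true l₀) l<) λ ()
        ...   | inj₂ (l≡ , _) = case trans (sym (lab-r j rj)) (trans l≡ (≡ᵇ0-true l₀)) of λ ()
      er≤ : er I π ≤ RT + V late (n I) 0
      er≤ = ≤-trans (er-≤ π (λ j rj → subst (_≤ S + (RT + So.O₁ S (n I))) (sym (C≡ j))
                (C≤ _ (Fin.toℕ<n _) (trans (r-at j) rj))) S≤)
              (≤-trans (≤-reflexive (m+n∸m≡n S _)) (+-monoʳ-≤ RT (So.Valid.cost≥ val)))

-- Running times proportional to an iteration bound

1≤⇒≤* : ∀ k {Y} → 1 ≤ Y → k ≤ k * Y
1≤⇒≤* k {Y} 1≤Y = subst (_≤ k * Y) (*-identityʳ k) (*-monoʳ-≤ k 1≤Y)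

-- Y bounds the number of loop iterations.
record Runᵀ (c : Prog) (Y : ℕ) (s : Store) (Q : Store → Set) : Set where
  constructor runᵀ
  field
    un : Run c (size c * Y) s Q

onceᵀ : ∀ {c Y s Q} → 1 ≤ Y → Exec c s Q → Runᵀ c Y s Q
onceᵀ {c} 1≤Y r = runᵀ (weaken (1≤⇒≤* (size c) 1≤Y) id r)

execᵀ : ∀ {c s Q} → Exec c s Q → Runᵀ c 1 s Q
execᵀ = onceᵀ ≤-refl

moreᵀ : ∀ {c Y Z s Q} → Y ≤ Z → Runᵀ c Y s Q → Runᵀ c Z s Q
moreᵀ {c} Y≤Z (runᵀ r) = runᵀ (weaken (*-monoʳ-≤ (size c) Y≤Z) id r)

mapᵀ : ∀ {c Y s} {Q R : Store → Set} → (∀ {s′} → Q s′ → R s′) → Runᵀ c Y s Q → Runᵀ c Y s R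
mapᵀ f (runᵀ r) = runᵀ (weaken ≤-refl f r)

framedᵀ : ∀ {c Y s Q} → Runᵀ c Y s Q → Runᵀ c Y s (λ s′ → Same c s s′ × Q s′)
framedᵀ (runᵀ r) = runᵀ (framed r)

-- Since `size` is additive, pieces with a common `Y` compose without any calculation of constants.
seqᵀ : ∀ {c d Y s Q} → Runᵀ c Y s (λ s′ → Runᵀ d Y s′ Q) → Runᵀ (c ⨾ d) Y s Q
seqᵀ {c} {d} {Y} (runᵀ r) =
  runᵀ (weaken (≤-reflexive (sym (*-distribʳ-+ Y (size c) (size d)))) id (seq! (weaken ≤-refl Runᵀ.un r)))

setᵀ : ∀ {x e v d Y s Q} → 1 ≤ Y → ⟦ e ⟧ s ≡ v → Runᵀ d Y (setReg x v s) Q → Runᵀ (x ≔ e ⨾ d) Y s Q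
setᵀ 1≤Y e≡ r = seqᵀ (onceᵀ 1≤Y (assign! e≡ r))

putᵀ : ∀ {a e f i v d Y s Q} → 1 ≤ Y → ⟦ e ⟧ s ≡ i → ⟦ f ⟧ s ≡ v → Runᵀ d Y (setCell a i v s) Q →
       Runᵀ (a [ e ]≔ f ⨾ d) Y s Q
putᵀ 1≤Y e≡ f≡ r = seqᵀ (onceᵀ 1≤Y (write! e≡ f≡ r))

-- Of the two tests counted in `size`, one pays for the `N` successful tests and the other for the
-- final failing one.
loopᵀ : ∀ {b c N s Q} Y → 1 ≤ Y → 1 ≤ N →
        Run (while b run c) (N * (1 + costᵗ b + size c * Y) + (1 + costᵗ b)) s Q →
        Runᵀ (while b run c) (N * Y) s Q
loopᵀ {b} {c} {N} Y 1≤Y 1≤N r = runᵀ (weaken (begin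
  N * (g + size c * Y) + g               ≤⟨ +-mono-≤ (*-monoʳ-≤ N (+-monoˡ-≤ (size c * Y) (1≤⇒≤* g 1≤Y)))
                                                      (1≤⇒≤* g (*-mono-≤ 1≤N 1≤Y)) ⟩
  N * (g * Y + size c * Y) + g * (N * Y) ≡⟨ lem N g (size c) Y ⟩
  (g + size c + g) * (N * Y)             ∎) id r)
  where
  open ≤-Reasoning
  g : ℕ
  g = 1 + costᵗ b
  lem : ∀ N g k Y → N * (g * Y + k * Y) + g * (N * Y) ≡ (g + k + g) * (N * Y)
  lem = solve-∀

while-upᵀ : ∀ {b c s₀} Y N (Inv : ℕ → Store → Set) → 1 ≤ Y → 1 ≤ N →
  (∀ k s → k < N → Same c s₀ s → Inv k s → ⟦ b ⟧ᵗ s ≡ true × Runᵀ c Y s (Inv (suc k))) →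
  (∀ s → Same c s₀ s → Inv N s → ⟦ b ⟧ᵗ s ≡ false) →
  Inv 0 s₀ →
  Runᵀ (while b run c) (N * Y) s₀ (Inv N)
while-upᵀ Y N Inv 1≤Y 1≤N step stop inv₀ =
  loopᵀ Y 1≤Y 1≤N (while-up N Inv (λ k s k<N same inv → let t , runᵀ r = step k s k<N same inv in t , r) stop inv₀)

while-downᵀ : ∀ {b c s₀} Y N (Inv : ℕ → Store → Set) → 1 ≤ Y → 1 ≤ N →
  (∀ m s → Same c s₀ s → Inv (suc m) s → ⟦ b ⟧ᵗ s ≡ true × Runᵀ c Y s (Inv m)) →
  (∀ s → Same c s₀ s → Inv 0 s → ⟦ b ⟧ᵗ s ≡ false) →
  Inv N s₀ →
  Runᵀ (while b run c) (N * Y) s₀ (Inv 0)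
while-downᵀ Y N Inv 1≤Y 1≤N step stop inv =
  loopᵀ Y 1≤Y 1≤N (while-down Inv (λ m s same inv → let t , runᵀ r = step m s same inv in t , r) stop N inv)

n# K# P# RT# i# j# ptr# t# top# : ℕ
n#   = 0
K#   = 1
P#   = 2
RT#  = 3
i#   = 4
j#   = 5
ptr# = 6
t#   = 7
top# = 8

-- Bucket sort

module BucketSort (src key dst : ℕ) where

  collect : Prog
  collect =
    j# ≔ src [ reg i# ] ⨾
    (ifₚ key [ reg j# ] ≤ₑ reg t# andₑ reg t# ≤ₑ key [ reg j# ]
      then dst [ reg ptr# ]≔ reg j# ⨾ ptr# ≔ reg ptr# ⊕ lit (+ 1)
      else skip) ⨾
    i# ≔ reg i# ⊕ lit (+ 1)

  bucket : Prog
  bucket =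
    i# ≔ lit (+ 0) ⨾
    (while reg i# ⊕ lit (+ 1) ≤ₑ reg n# run collect) ⨾
    t# ≔ reg t# ⊕ lit (+ 1)

  -- One full pass over the jobs for each key value, without linked buckets. This costs a multiple
  -- of `n` times the number of keys, which the intended bound allows, and each pass keeps the
  -- source order, so the sort is stable.
  sort : Prog
  sort =
    t# ≔ lit (+ 0) ⨾
    ptr# ≔ lit (+ 0) ⨾
    while reg t# ≤ₑ reg top# run bucket

Seg : ∀ {n} → (ℤ → ℤ) → ℕ → List (Fin n) → Set
Seg f o []       = ⊤
Seg f o (x ∷ xs) = f (+ o) ≡ + toℕ x × Seg f (suc o) xs

Seg-snoc : ∀ {n f g o x} (xs : List (Fin n)) → Seg f o xs →
           (∀ k → k < o + length xs → g (+ k) ≡ f (+ k)) → g (+ (o + length xs)) ≡ + toℕ x →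
           Seg g o (xs ++ x ∷ [])
Seg-snoc {g = g} {o} {x} [] seg old new = subst (λ z → g (+ z) ≡ + toℕ x) (+-identityʳ o) new , tt
Seg-snoc {g = g} {o} {x} (y ∷ xs) (h , seg) old new =
  trans (old o (m<m+n o (s≤s z≤n))) h ,
  Seg-snoc xs seg (λ k k< → old k (subst (k <_) (sym (+-suc o (length xs))) k<))
    (subst (λ z → g (+ z) ≡ + toℕ x) (+-suc o (length xs)) new)

Seg-lookup : ∀ {n f o} (xs : List (Fin n)) → Seg f o xs → ∀ i → f (+ (o + toℕ i)) ≡ + toℕ (lookup xs i)
Seg-lookup {f = f} {o} (x ∷ xs) (h , seg) Fin.zero    = trans (cong (λ z → f (+ z)) (+-identityʳ o)) h
Seg-lookup {f = f} {o} (x ∷ xs) (h , seg) (Fin.suc i) =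
  trans (cong (λ z → f (+ z)) (+-suc o (toℕ i))) (Seg-lookup xs seg i)

AllPairs-lookup : ∀ {a r} {A : Set a} {R : A → A → Set r} {xs} → AllPairs R xs →
                  ∀ i j → i Fin.< j → R (lookup xs i) (lookup xs j)
AllPairs-lookup (px ∷ pxs) Fin.zero    (Fin.suc j) i<j       = All.lookup px (∈-lookup j)
AllPairs-lookup (px ∷ pxs) (Fin.suc i) (Fin.suc j) (s≤s i<j) = AllPairs-lookup pxs i j i<j

AllPairs-on : ∀ {a p r u} {A : Set a} {P : A → Set p} {R : A → A → Set r} {U : A → A → Set u} {xs} →
              (∀ {x y} → P x → P y → R x y → U x y) → All P xs → AllPairs R xs → AllPairs U xs
AllPairs-on f []         []         = []
AllPairs-on f (px ∷ pxs) (rx ∷ rxs) =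
  All.zipWith (λ (py , rxy) → f px py rxy) (pxs , rx) ∷ AllPairs-on f pxs rxs

filter-∷ʳ-yes : ∀ {a p} {A : Set a} {P : A → Set p} (P? : ∀ x → Dec (P x)) xs {x} → P x →
                filter P? (xs ++ x ∷ []) ≡ filter P? xs ++ x ∷ []
filter-∷ʳ-yes P? xs px = trans (List.filter-++ P? xs _) (cong (filter P? xs ++_) (List.filter-accept P? px))

filter-∷ʳ-no : ∀ {a p} {A : Set a} {P : A → Set p} (P? : ∀ x → Dec (P x)) xs {x} → ¬ P x →
               filter P? (xs ++ x ∷ []) ≡ filter P? xs
filter-∷ʳ-no P? xs ¬px =
  trans (List.filter-++ P? xs _) (trans (cong (filter P? xs ++_) (List.filter-reject P? ¬px)) (List.++-identityʳ _))

module Buckets {n : ℕ} (ω : Permutation′ n) (κ : Fin n → ℕ) where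

  jobs : List (Fin n)
  jobs = tabulate (ω ⟨$⟩ʳ_)

  key≟ : ∀ t j → Dec (κ j ≡ t)
  key≟ t j = κ j ≟ t

  buckets : ℕ → List (Fin n)
  buckets zero    = []
  buckets (suc t) = buckets t ++ filter (key≟ t) jobs

  _≺_ : Fin n → Fin n → Set
  i ≺ j = κ i < κ j ⊎ κ i ≡ κ j × ω ⟨$⟩ˡ i Fin.< ω ⟨$⟩ˡ j

  ≺-irrefl : ∀ {i} → ¬ (i ≺ i)
  ≺-irrefl (inj₁ h)       = <-irrefl refl h
  ≺-irrefl (inj₂ (_ , h)) = <-irrefl refl h

  κ-filter : ∀ t → All (λ j → κ j ≡ t) (filter (key≟ t) jobs)
  κ-filter t = All.all-filter (key≟ t) jobs

  κ-buckets : ∀ t → All (λ j → κ j < t) (buckets t)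
  κ-buckets zero    = []
  κ-buckets (suc t) = All.++⁺ (All.map m<n⇒m<1+n (κ-buckets t)) (All.map (λ { refl → ≤-refl }) (κ-filter t))

  jobs-ordered : AllPairs (λ i j → ω ⟨$⟩ˡ i Fin.< ω ⟨$⟩ˡ j) jobs
  jobs-ordered = AllPairs.tabulate⁺-< (subst₂ Fin._<_ (sym (inverseˡ ω)) (sym (inverseˡ ω)))

  buckets-ordered : ∀ t → AllPairs _≺_ (buckets t)
  buckets-ordered zero    = []
  buckets-ordered (suc t) = AllPairs.++⁺ (buckets-ordered t)
    (AllPairs-on (λ p q h → inj₂ (trans p (sym q) , h)) (κ-filter t) (AllPairs.filter⁺ (key≟ t) jobs-ordered))
    (All.map (λ κ< → All.map (λ { refl → inj₁ κ< }) (κ-filter t)) (κ-buckets t))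

  ∈-buckets : ∀ t j → κ j < t → j ∈ buckets t
  ∈-buckets (suc t) j (s≤s κ≤t) with m≤n⇒m<n∨m≡n κ≤t
  ... | inj₁ κ<t = ∈-++⁺ˡ (∈-buckets t j κ<t)
  ... | inj₂ κ≡t = ∈-++⁺ʳ (buckets t) (∈-filter⁺ (key≟ t)
    (subst (_∈ jobs) (inverseʳ ω) (∈-tabulate⁺ (ω ⟨$⟩ˡ j))) κ≡t)

  module _ {t} (κ< : ∀ j → κ j < t) where

    index : Fin n → Fin (length (buckets t))
    index j = Any.index (∈-buckets t j (κ< j))

    lookup-index : ∀ j → lookup (buckets t) (index j) ≡ j
    lookup-index j = sym (Any.lookup-index (∈-buckets t j (κ< j)))

    -- The list of buckets is strictly ordered by the irreflexive `_≺_`, so no job occurs at two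
    -- indices.
    index-lookup : ∀ k → index (lookup (buckets t) k) ≡ k
    index-lookup k with Fin.<-cmp (index (lookup (buckets t) k)) k
    ... | tri≈ _ eq _ = eq
    ... | tri< h _ _  = contradiction (AllPairs-lookup (buckets-ordered t) _ _ h)
      (subst (λ z → ¬ (z ≺ lookup (buckets t) k)) (sym (lookup-index _)) ≺-irrefl)
    ... | tri> _ _ h  = contradiction (AllPairs-lookup (buckets-ordered t) _ _ h)
      (subst (λ z → ¬ (lookup (buckets t) k ≺ z)) (sym (lookup-index _)) ≺-irrefl)

    sorted : Permutation (length (buckets t)) n
    sorted = permutation (lookup (buckets t)) index lookup-index index-lookup

    sorted-≤ : ∀ i j → sorted ⟨$⟩ˡ i Fin.≤ sorted ⟨$⟩ˡ j →
               κ i < κ j ⊎ κ i ≡ κ j × ω ⟨$⟩ˡ i Fin.≤ ω ⟨$⟩ˡ j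
    sorted-≤ i j i≤j with m≤n⇒m<n∨m≡n i≤j
    ... | inj₁ i<j with subst₂ _≺_ (lookup-index i) (lookup-index j) (AllPairs-lookup (buckets-ordered t) _ _ i<j)
    ...   | inj₁ h       = inj₁ h
    ...   | inj₂ (e , h) = inj₂ (e , <⇒≤ h)
    sorted-≤ i j i≤j | inj₂ eq with i≡j
      where
      i≡j : i ≡ j
      i≡j = trans (sym (lookup-index i)) (trans (cong (lookup (buckets t)) (Fin.toℕ-injective eq)) (lookup-index j))
    ... | refl = inj₂ (refl , ≤-refl)

-- That the bucket list has length `n` follows from the bijection itself, not from a count. Indices
-- are compared through `toℕ` because their types are identified only inside this proof.
square : ∀ {m n} (π : Permutation m n) → m ≡ n → Σ[ ρ ∈ Permutation′ n ]
         (∀ k → ∃[ k′ ] toℕ k′ ≡ toℕ k × π ⟨$⟩ʳ k′ ≡ ρ ⟨$⟩ʳ k) × (∀ j → toℕ (ρ ⟨$⟩ˡ j) ≡ toℕ (π ⟨$⟩ˡ j))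
square π refl = π , (λ k → k , refl , refl) , λ _ → refl

module BucketSortRun (src key dst : ℕ) (src≢dst : (src ≡ᵇ dst) ≡ false) (key≢dst : (key ≡ᵇ dst) ≡ false)
  {n : ℕ} (1≤n : 1 ≤ n) (ω : Permutation′ n) (κ : Fin n → ℕ) (top : ℕ) (κ≤ : ∀ j → κ j ≤ top) where

  open BucketSort src key dst
  open Buckets ω κ

  record Input (s : Store) : Set where
    field
      n≡   : regs s n# ≡ + n
      top≡ : regs s top# ≡ + top
      src≡ : ∀ (k : Fin n) → arrays s src (+ toℕ k) ≡ + toℕ (ω ⟨$⟩ʳ k)
      key≡ : ∀ (j : Fin n) → arrays s key (+ toℕ j) ≡ + κ j

  open Input

  -- Array names are parameters here, so `keepsArr` does not reduce by itself; rewriting with the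
  -- Boolean inequations supplies the side conditions.
  kept : ∀ a c → keepsArr a c ≡ true → T (keepsArr a c)
  kept a c eq = subst T (sym eq) tt

  src-kept : keepsArr src collect ≡ true
  src-kept rewrite src≢dst = refl

  key-kept : keepsArr key collect ≡ true
  key-kept rewrite key≢dst = refl

  src-kept′ : keepsArr src bucket ≡ true
  src-kept′ rewrite src≢dst = refl

  key-kept′ : keepsArr key bucket ≡ true
  key-kept′ rewrite key≢dst = refl

  carry : ∀ {s s′} → Same collect s s′ → Input s → Input s′
  carry same I .n≡     = trans (reg≡ same n#) (n≡ I)
  carry same I .top≡   = trans (reg≡ same top#) (top≡ I)
  carry same I .src≡ k = trans (arr≡ same src {kept src collect src-kept} _) (src≡ I k)
  carry same I .key≡ j = trans (arr≡ same key {kept key collect key-kept} _) (key≡ I j)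

  carry′ : ∀ {s s′} → Same bucket s s′ → Input s → Input s′
  carry′ same I .n≡     = trans (reg≡ same n#) (n≡ I)
  carry′ same I .top≡   = trans (reg≡ same top#) (top≡ I)
  carry′ same I .src≡ k = trans (arr≡ same src {kept src bucket src-kept′} _) (src≡ I k)
  carry′ same I .key≡ j = trans (arr≡ same key {kept key bucket key-kept′} _) (key≡ I j)

  record Output (t : ℕ) (out : List (Fin n)) (s : Store) : Set where
    field
      t≡   : regs s t# ≡ + t
      ptr≡ : regs s ptr# ≡ + length out
      seg  : Seg (arrays s dst) 0 out

  open Output

  partial : ℕ → ℕ → List (Fin n)
  partial t k = buckets t ++ filter (key≟ t) (take k jobs)

  Inv : ℕ → ℕ → Store → Set
  Inv t k s = regs s i# ≡ + k × Output t (partial t k) s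

  collect! : ∀ {t} k s → k < n → Input s → Inv t k s → Exec collect s (Inv t (suc k))
  collect! {t} k s k<n I (i≡ , O) = subst (λ z → regs s i# ≡ + z × Output t (partial t z) s → Exec collect s (Inv t (suc z)))
    (Fin.toℕ-fromℕ< k<n) (body (fromℕ< k<n)) (i≡ , O)
    where
    body : ∀ (f : Fin n) → regs s i# ≡ + toℕ f × Output t (partial t (toℕ f)) s →
           Exec collect s (Inv t (suc (toℕ f)))
    body f (i≡ , O) with κ (ω ⟨$⟩ʳ f) ≟ t
    ... | yes κ≡t = set! (trans (cong (arrays s src) i≡) (src≡ I f))
      (seq! (if-true! hit (put! (ptr≡ O) refl (assign! (ptr≡ O ⊕≡ refl)
        (assign! (i≡ ⊕≡ refl) (cong +_ (+-comm (toℕ f) 1) , record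
          { t≡   = t≡ O
          ; ptr≡ = trans (cong +_ (sym (List.length-++ (partial t (toℕ f)) {j ∷ []}))) (cong (λ z → + length z) (sym new))
          ; seg  = subst (Seg _ 0) (sym new) (Seg-snoc (partial t (toℕ f)) (seg O)
              (λ k k< → setCell-elsewhere {dst} {dst} {+ length (partial t (toℕ f))} {+ toℕ j} {setReg j# (+ toℕ j) s}
                (<⇒+≢ k<))
              (setCell-same dst (+ length (partial t (toℕ f))) {+ toℕ j} {setReg j# (+ toℕ j) s})) }))))))
      where
      j : Fin n
      j = ω ⟨$⟩ʳ f
      hit : (arrays s key (+ toℕ j) ℤ.≤ᵇ regs s t#) ∧ (regs s t# ℤ.≤ᵇ arrays s key (+ toℕ j)) ≡ true
      hit = cong₂ _∧_ (test-true (key≡ I j) (t≡ O) (≤-reflexive κ≡t)) (test-true (t≡ O) (key≡ I j) (≤-reflexive (sym κ≡t)))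
      new : partial t (suc (toℕ f)) ≡ partial t (toℕ f) ++ j ∷ []
      new = trans (cong (λ z → buckets t ++ filter (key≟ t) z) (List.take-suc-tabulate (ω ⟨$⟩ʳ_) f))
        (trans (cong (buckets t ++_) (filter-∷ʳ-yes (key≟ t) (take (toℕ f) jobs) κ≡t))
               (sym (List.++-assoc (buckets t) _ _)))
    ... | no  κ≢t = set! (trans (cong (arrays s src) i≡) (src≡ I f))
      (seq! (if-false! miss (skip! (assign! (i≡ ⊕≡ refl) (cong +_ (+-comm (toℕ f) 1) , record
        { t≡   = t≡ O
        ; ptr≡ = trans (ptr≡ O) (cong (λ z → + length z) (sym new))
        ; seg  = subst (Seg _ 0) (sym new) (seg O) })))))
      where
      j : Fin n
      j = ω ⟨$⟩ʳ f
      new : partial t (suc (toℕ f)) ≡ partial t (toℕ f)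
      new = cong (buckets t ++_) (trans (cong (filter (key≟ t)) (List.take-suc-tabulate (ω ⟨$⟩ʳ_) f))
        (filter-∷ʳ-no (key≟ t) (take (toℕ f) jobs) κ≢t))
      miss : (arrays s key (+ toℕ j) ℤ.≤ᵇ regs s t#) ∧ (regs s t# ℤ.≤ᵇ arrays s key (+ toℕ j)) ≡ false
      miss with <-cmp (κ j) t
      ... | tri≈ _ eq _ = contradiction eq κ≢t
      ... | tri> _ _ h  = cong (λ z → z ∧ (regs s t# ℤ.≤ᵇ arrays s key (+ toℕ j))) (test-false (key≡ I j) (t≡ O) h)
      ... | tri< h _ _  = trans (cong (λ z → (arrays s key (+ toℕ j) ℤ.≤ᵇ regs s t#) ∧ z) (test-false (t≡ O) (key≡ I j) h))
                                (Bool.∧-zeroʳ _)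

  partial-0 : ∀ t → partial t 0 ≡ buckets t
  partial-0 t = List.++-identityʳ (buckets t)

  partial-n : ∀ t → partial t n ≡ buckets (suc t)
  partial-n t = cong (λ z → buckets t ++ filter (key≟ t) z)
    (List.take-all n jobs (≤-reflexive (List.length-tabulate (ω ⟨$⟩ʳ_))))

  loop! : ∀ {t} s → Input s → Inv t 0 s →
          Runᵀ (while reg i# ⊕ lit (+ 1) ≤ₑ reg n# run collect) n s (Inv t n)
  loop! {t} s I inv = moreᵀ (≤-reflexive (*-identityʳ n)) (while-upᵀ 1 n (Inv t) ≤-refl 1≤n
    (λ k s k<n same inv → test-true (proj₁ inv ⊕≡ refl) (n≡ (carry same I)) (subst (_≤ n) (+-comm 1 k) k<n) ,
      execᵀ (collect! k s k<n (carry same I) inv))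
    (λ s same inv → test-false (proj₁ inv ⊕≡ refl) (n≡ (carry same I)) (≤-reflexive (+-comm 1 n))) inv)

  bucket! : ∀ {t} s → Input s → Output t (buckets t) s →
            Runᵀ bucket n s (Output (suc t) (buckets (suc t)))
  bucket! {t} s I O = setᵀ 1≤n refl (seqᵀ (mapᵀ
    (λ (i≡ , O) → onceᵀ 1≤n (assign! (t≡ O ⊕≡ refl) (record
      { t≡   = cong +_ (+-comm t 1)
      ; ptr≡ = trans (ptr≡ O) (cong (λ z → + length z) (partial-n t))
      ; seg  = subst (Seg _ 0) (partial-n t) (seg O) })))
    (loop! _ (record { n≡ = n≡ I ; top≡ = top≡ I ; src≡ = src≡ I ; key≡ = key≡ I })
      (refl , record
        { t≡   = t≡ O
        ; ptr≡ = trans (ptr≡ O) (cong (λ z → + length z) (sym (partial-0 t)))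
        ; seg  = subst (Seg _ 0) (sym (partial-0 t)) (seg O) }))))

  Sorted : Store → Set
  Sorted s = Σ[ ρ ∈ Permutation′ n ] (∀ k → arrays s dst (+ toℕ k) ≡ + toℕ (ρ ⟨$⟩ʳ k)) ×
    (∀ i j → ρ ⟨$⟩ˡ i Fin.≤ ρ ⟨$⟩ˡ j → κ i < κ j ⊎ κ i ≡ κ j × ω ⟨$⟩ˡ i Fin.≤ ω ⟨$⟩ˡ j)

  sort! : ∀ s → Input s → Runᵀ sort (suc top * n) s Sorted
  sort! s I = setᵀ 1≤Y refl (setᵀ 1≤Y refl (mapᵀ finish
      (while-upᵀ n (suc top) (λ t s → Output t (buckets t) s) 1≤n (s≤s z≤n)
        (λ t s t<N same O → test-true (t≡ O) (top≡ (carry′ same I₀)) (≤-pred t<N) , bucket! s (carry′ same I₀) O)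
        (λ s same O → test-false (t≡ O) (top≡ (carry′ same I₀)) ≤-refl)
        (record { t≡ = refl ; ptr≡ = refl ; seg = tt }))))
    where
    1≤Y : 1 ≤ suc top * n
    1≤Y = *-mono-≤ (s≤s (z≤n {top})) 1≤n
    I₀ : Input (setReg ptr# (+ 0) (setReg t# (+ 0) s))
    I₀ = record { n≡ = n≡ I ; top≡ = top≡ I ; src≡ = src≡ I ; key≡ = key≡ I }
    finish : ∀ {s} → Output (suc top) (buckets (suc top)) s → Sorted s
    finish {s} O with square (sorted (λ j → s≤s (κ≤ j))) (↔⇒≡ (sorted (λ j → s≤s (κ≤ j))))
    ... | ρ , at , pos = ρ ,
      (λ k → let k′ , k′≡k , eq = at k in
        trans (cong (λ z → arrays s dst (+ z)) (sym k′≡k))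
              (trans (Seg-lookup (buckets (suc top)) (seg O) k′) (cong (λ z → + toℕ z) eq))) ,
      λ i j i≤j → sorted-≤ (λ j → s≤s (κ≤ j)) i j (subst₂ _≤_ (pos i) (pos j) i≤j)

-- The main program

W# rho# R# Pre# O# base# base₂# b# q# D# isr# pen₀# pen₁# pen₂# v₀# v₁# w# l# φ# ans# : ℕ
W#     = 9
rho#   = 10
R#     = 11
Pre#   = 12
O#     = 13
base#  = 14
base₂# = 15
b#     = 16
q#     = 17
D#     = 18
isr#   = 19
pen₀#  = 20
pen₁#  = 21
pen₂#  = 22
v₀#    = 23
v₁#    = 24
w#     = 25
l#     = 26
φ#     = 27
ans#   = 28

pᴬ dᴬ rᴬ δᴬ idᴬ ordᴬ ρᴬ lateᴬ earlyᴬ lateᶜ earlyᶜ labᴬ : ℕ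
pᴬ     = 0
dᴬ     = 1
rᴬ     = 2
δᴬ     = 3
idᴬ    = 4
ordᴬ   = 5
ρᴬ     = 6
lateᴬ  = 7
earlyᴬ = 8
lateᶜ  = 9
earlyᶜ = 10
labᴬ   = 11

-- Machine subtraction does not truncate, so the innermost branch writes the 0 of `D ∸ R`
-- explicitly. During the tests `R#` holds the r-work up to and including position `i`.
thresholdStep thresholds : Prog
thresholdStep =
  i# ≔ reg i# ⊖ 1ₑ ⨾
  j# ≔ ordᴬ [ reg i# ] ⨾
  (ifₚ 1ₑ ≤ₑ rᴬ [ reg j# ]
    then (ifₚ reg rho# ⊕ reg R# ≤ₑ δᴬ [ reg j# ]
           then skip
           else (ifₚ reg R# ≤ₑ δᴬ [ reg j# ]
                   then rho# ≔ δᴬ [ reg j# ] ⊖ reg R#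
                   else (rho# ≔ lit (+ 0)))) ⨾
         R# ≔ reg R# ⊖ pᴬ [ reg j# ]
    else skip) ⨾
  ρᴬ [ reg i# ]≔ reg rho#
thresholds =
  W# ≔ reg P# ⊕ 1ₑ ⨾
  rho# ≔ reg W# ⨾
  R# ≔ reg RT# ⨾
  i# ≔ reg n# ⨾
  ρᴬ [ reg i# ]≔ reg rho# ⨾
  while 1ₑ ≤ₑ reg i# run thresholdStep

-- `W#`, which holds `P + 1`, serves both as the penalty and as the width of a table row.
pay : ℕ → Expr → Expr → Prog
pay x e f = ifₚ e ⊕ 1ₑ ≤ₑ f then x ≔ lit (+ 0) else (x ≔ reg W#)

best : ℕ → ℕ → ℕ → Expr → Prog
best a c w e =
  ifₚ reg v₀# ≤ₑ reg w
    then a [ reg base₂# ⊕ reg b# ]≔ reg v₀# ⨾ c [ reg base₂# ⊕ reg b# ]≔ lit (+ 0)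
    else (a [ reg base₂# ⊕ reg b# ]≔ reg w ⨾ c [ reg base₂# ⊕ reg b# ]≔ e)

-- The label of an r-job is forced, so `rCell` records no choice. In `oCell` the cost `v₁#` of label
-- 1 followed by phase early is shared: phase late only adds `pen₂#`.
rCell oCell cell : Prog
rCell =
  earlyᴬ [ reg base₂# ⊕ reg b# ]≔ reg pen₁# ⊕ earlyᴬ [ reg base# ⊕ reg b# ] ⨾
  lateᴬ [ reg base₂# ⊕ reg b# ]≔ lateᴬ [ reg base# ⊕ reg b# ]
oCell =
  v₀# ≔ reg pen₀# ⊕ earlyᴬ [ reg base# ⊕ (reg b# ⊕ reg q#) ] ⨾
  v₁# ≔ reg q# ⊕ (reg pen₁# ⊕ earlyᴬ [ reg base# ⊕ reg b# ]) ⨾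
  best earlyᴬ earlyᶜ v₁# 1ₑ ⨾
  pay pen₂# (reg O# ⊕ reg b#) (ρᴬ [ reg i# ⊕ 1ₑ ]) ⨾
  (ifₚ reg RT# ⊕ (reg O# ⊕ reg b#) ⊕ 1ₑ ≤ₑ reg D#
    then w# ≔ lateᴬ [ reg base# ⊕ reg b# ] ⨾ l# ≔ lit (+ 2)
    else (w# ≔ reg pen₂# ⊕ reg v₁# ⨾ l# ≔ 1ₑ)) ⨾
  v₀# ≔ reg pen₀# ⊕ lateᴬ [ reg base# ⊕ (reg b# ⊕ reg q#) ] ⨾
  best lateᴬ lateᶜ w# (reg l#)
cell =
  pay pen₁# (reg Pre# ⊕ reg b#) (reg D#) ⨾
  (ifₚ 1ₑ ≤ₑ reg isr# then rCell else oCell) ⨾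
  b# ≔ reg b# ⊕ 1ₑ

cell₀ row₀ row table : Prog
cell₀ =
  pay pen₂# (reg b#) (ρᴬ [ lit (+ 0) ]) ⨾
  lateᴬ [ reg b# ]≔ reg pen₂# ⨾
  earlyᴬ [ reg b# ]≔ lit (+ 0) ⨾
  b# ≔ reg b# ⊕ 1ₑ
row₀ =
  b# ≔ lit (+ 0) ⨾
  while reg b# ≤ₑ reg P# run cell₀
row =
  j# ≔ ordᴬ [ reg i# ] ⨾
  q# ≔ pᴬ [ reg j# ] ⨾
  D# ≔ δᴬ [ reg j# ] ⨾
  isr# ≔ rᴬ [ reg j# ] ⨾
  Pre# ≔ reg Pre# ⊕ reg q# ⨾
  -- The idle assignment lets both branches end in the same store, so one continuation serves both
  -- in the proof.
  (ifₚ 1ₑ ≤ₑ reg isr# then O# ≔ reg O# else (O# ≔ reg O# ⊕ reg q#)) ⨾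
  base₂# ≔ reg W# ⊕ reg base# ⨾
  pay pen₀# (reg Pre#) (reg D#) ⨾
  b# ≔ lit (+ 0) ⨾
  -- Jobs above the position contribute to `b` and those up to it to `Pre#`, so larger `b` cannot
  -- arise; within this range the cell at `b + q` in the row below has been filled.
  (while reg Pre# ⊕ reg b# ≤ₑ reg P# run cell) ⨾
  base# ≔ reg base₂# ⨾
  i# ≔ reg i# ⊕ 1ₑ
table =
  i# ≔ lit (+ 0) ⨾
  base# ≔ lit (+ 0) ⨾
  Pre# ≔ lit (+ 0) ⨾
  O# ≔ lit (+ 0) ⨾
  while reg i# ⊕ 1ₑ ≤ₑ reg n# run row

-- The traceback starts from the values that `table` leaves in `i#` and `base#`, namely `n` and
-- `n * W`, and undoes their increments; no multiplication is called for.
labelStep labelling : Prog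
labelStep =
  i# ≔ reg i# ⊖ 1ₑ ⨾
  j# ≔ ordᴬ [ reg i# ] ⨾
  (ifₚ 1ₑ ≤ₑ rᴬ [ reg j# ]
    then labᴬ [ reg j# ]≔ 1ₑ
    else ((ifₚ reg φ# ≤ₑ lit (+ 0)
           then l# ≔ lateᶜ [ reg base# ⊕ reg b# ]
           else (l# ≔ earlyᶜ [ reg base# ⊕ reg b# ])) ⨾
         labᴬ [ reg j# ]≔ reg l# ⨾
         ifₚ reg l# ≤ₑ lit (+ 0)
           then b# ≔ reg b# ⊕ pᴬ [ reg j# ]
           else (ifₚ reg l# ≤ₑ 1ₑ then φ# ≔ 1ₑ else skip))) ⨾
  base# ≔ reg base# ⊖ reg W#
labelling =
  (ifₚ lateᴬ [ reg base# ] ≤ₑ reg P# then ans# ≔ 1ₑ else (ans# ≔ lit (+ 0))) ⨾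
  b# ≔ lit (+ 0) ⨾
  φ# ≔ lit (+ 0) ⨾
  while 1ₑ ≤ₑ reg i# run labelStep

-- Correctness of the thresholds, the tables and the traceback

module Dynamic (n : ℕ) (1≤n : 1 ≤ n) (q D : ℕ → ℕ) (r : ℕ → Bool) (jb : ℕ → ℕ)
  (jb-injective : ∀ {k m} → k < n → m < n → jb k ≡ jb m → k ≡ m) where

  open Scan n q D r

  W : ℕ
  W = suc Tot

  record Env (s : Store) : Set where
    field
      n≡  : regs s n# ≡ + n
      P≡  : regs s P# ≡ + Tot
      RT≡ : regs s RT# ≡ + RT
      ord≡ : ∀ {k} → k < n → arrays s ordᴬ (+ k) ≡ + jb k
      p≡  : ∀ {k} → k < n → arrays s pᴬ (+ jb k) ≡ + q k
      δ≡  : ∀ {k} → k < n → arrays s δᴬ (+ jb k) ≡ + D k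
      r≡  : ∀ {k} → k < n → arrays s rᴬ (+ jb k) ≡ + bit (r k)

  open Env

  keepsEnv : Prog → Bool
  keepsEnv c = keepsReg n# c ∧ keepsReg P# c ∧ keepsReg RT# c ∧
               keepsArr ordᴬ c ∧ keepsArr pᴬ c ∧ keepsArr δᴬ c ∧ keepsArr rᴬ c

  carry : ∀ {c s s′} {h : T (keepsEnv c)} → Same c s s′ → Env s → Env s′
  carry {c} {h = h} same E with Equivalence.to (T-∧ {keepsReg n# c}) h
  ... | h₁ , h with Equivalence.to (T-∧ {keepsReg P# c}) h
  ... | h₂ , h with Equivalence.to (T-∧ {keepsReg RT# c}) h
  ... | h₃ , h with Equivalence.to (T-∧ {keepsArr ordᴬ c}) h
  ... | h₄ , h with Equivalence.to (T-∧ {keepsArr pᴬ c}) h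
  ... | h₅ , h with Equivalence.to (T-∧ {keepsArr δᴬ c}) h
  ... | h₆ , h₇ = record
    { n≡   = trans (reg≡ same n# {h₁}) (n≡ E)
    ; P≡   = trans (reg≡ same P# {h₂}) (P≡ E)
    ; RT≡  = trans (reg≡ same RT# {h₃}) (RT≡ E)
    ; ord≡ = λ k<n → trans (arr≡ same ordᴬ {h₄} _) (ord≡ E k<n)
    ; p≡   = λ k<n → trans (arr≡ same pᴬ {h₅} _) (p≡ E k<n)
    ; δ≡   = λ k<n → trans (arr≡ same δᴬ {h₆} _) (δ≡ E k<n)
    ; r≡   = λ k<n → trans (arr≡ same rᴬ {h₇} _) (r≡ E k<n) }

  pay! : ∀ {x e f s Q m k} → regs s W# ≡ + W → ⟦ e ⟧ s ≡ + m → ⟦ f ⟧ s ≡ + k →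
         Q (setReg x (+ pen m k) s) → Exec (pay x e f) s Q
  pay! {x} {s = s} {Q} {m} {k} W≡ e≡ f≡ post = if-≤! (e≡ ⊕≡ refl) f≡
    (λ h → assign! refl (subst (λ z → Q (setReg x (+ z) s)) (pen-sat (subst (_≤ k) (+-comm m 1) h)) post))
    (λ h → assign! W≡ (subst (λ z → Q (setReg x (+ z) s)) (pen-viol (≤-pred (subst (k <_) (+-comm m 1) h))) post))

  best! : ∀ {a c w e s Q B b x y l} → regs s base₂# ≡ + B → regs s b# ≡ + b → regs s v₀# ≡ + x →
          regs s w ≡ + y → (∀ v → ⟦ e ⟧ (setCell a (+ (B + b)) v s) ≡ + l) →
          Q (setCell c (+ (B + b)) (+ (if x ≤ᵇ y then 0 else l)) (setCell a (+ (B + b)) (+ (x ⊓ y)) s)) →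
          Exec (best a c w e) s Q
  best! {a} {c} {s = s} {Q} {B} {b} {x} {y} {l} B≡ b≡ x≡ y≡ e≡ post = if-≤! x≡ y≡
    (λ x≤y → seq! (write! (B≡ ⊕≡ b≡) x≡ (write! (B≡ ⊕≡ b≡) refl
      (subst₂ Store⟨_,_⟩ (m≤n⇒m⊓n≡m x≤y) (cong (λ z → if z then 0 else l) (≤ᵇ-true x≤y)) post))))
    (λ y<x → seq! (write! (B≡ ⊕≡ b≡) y≡ (write! (B≡ ⊕≡ b≡) (e≡ (+ y))
      (subst₂ Store⟨_,_⟩ (m≥n⇒m⊓n≡n (<⇒≤ y<x)) (cong (λ z → if z then 0 else l) (≤ᵇ-false y<x)) post))))
    where
    Store⟨_,_⟩ : ℕ → ℕ → Set
    Store⟨ v , z ⟩ = Q (setCell c (+ (B + b)) (+ z) (setCell a (+ (B + b)) (+ v) s))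

  record Thresholds (i : ℕ) (s : Store) : Set where
    field
      at≡   : regs s i# ≡ + i
      at≤n  : i ≤ n
      rho≡ : regs s rho# ≡ + ρ i
      R≡   : regs s R# ≡ + Rr i
      thr≡   : ∀ {k} → i ≤ k → k ≤ n → arrays s ρᴬ (+ k) ≡ + ρ k

  open Thresholds

  Rr-r : ∀ {i} → r i ≡ true → Rr (suc i) ∸ q i ≡ Rr i
  Rr-r {i} ri rewrite ri = m+n∸n≡m (Rr i) (q i)

  q≤Rr : ∀ {i} → r i ≡ true → q i ≤ Rr (suc i)
  q≤Rr {i} ri rewrite ri = m≤n+m (q i) (Rr i)

  Rr-o : ∀ {i} → r i ≡ false → Rr (suc i) ≡ Rr i
  Rr-o {i} ri rewrite ri = +-identityʳ (Rr i)

  thresholdStep! : ∀ i s → Env s → Thresholds (suc i) s → Exec thresholdStep s (Thresholds i)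
  thresholdStep! i s E H =
    set! (⊖≡ (at≡ H) refl (s≤s z≤n)) $ set! (ord≡ E i<n) $ seq! (if-bit! (r≡ E i<n) r! o!)
    where
    i<n : i < n
    i<n = at≤n H
    finish : ∀ {s′} → regs s′ i# ≡ + i → regs s′ rho# ≡ + ρ i → regs s′ R# ≡ + Rr i →
             (∀ k → arrays s′ ρᴬ k ≡ arrays s ρᴬ k) → Exec (ρᴬ [ reg i# ]≔ reg rho#) s′ (Thresholds i)
    finish {s′} i≡′ rho≡′ R≡′ old = write! i≡′ rho≡′ (record
      { at≡ = i≡′ ; at≤n = <⇒≤ i<n ; rho≡ = rho≡′ ; R≡ = R≡′
      ; thr≡ = λ {k} i≤k k≤n → case m≤n⇒m<n∨m≡n i≤k of λ
          { (inj₁ i<k)  → trans (setCell-elsewhere {ρᴬ} {ρᴬ} {+ i} {+ ρ i} {s′} (<⇒+≢ i<k ∘ sym))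
                                  (trans (old (+ k)) (thr≡ H i<k k≤n))
          ; (inj₂ refl) → setCell-same ρᴬ (+ i) {+ ρ i} {s′} } })
    s₁ : Store
    s₁ = setReg j# (+ jb i) (setReg i# (+ i) s)
    next : ∀ {s′} → r i ≡ true → regs s′ i# ≡ + i → regs s′ rho# ≡ + ρ i → regs s′ R# ≡ + Rr (suc i) →
           arrays s′ pᴬ (regs s′ j#) ≡ + q i → (∀ k → arrays s′ ρᴬ k ≡ arrays s ρᴬ k) →
           Exec (R# ≔ reg R# ⊖ pᴬ [ reg j# ]) s′ (λ s′ → Exec (ρᴬ [ reg i# ]≔ reg rho#) s′ (Thresholds i))
    next ri i≡′ rho≡′ R≡′ p≡′ old =
      assign! (trans (⊖≡ R≡′ p≡′ (q≤Rr ri)) (cong +_ (Rr-r ri))) (finish i≡′ rho≡′ refl old)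
    ρ≡rho : r i ≡ true → ρ (suc i) ≤ D i ∸ Rr (suc i) → ρ i ≡ ρ (suc i)
    ρ≡rho ri h = trans (ρ-r i<n ri) (m≤n⇒m⊓n≡m h)
    ρ≡D∸R : r i ≡ true → D i ∸ Rr (suc i) ≤ ρ (suc i) → ρ i ≡ D i ∸ Rr (suc i)
    ρ≡D∸R ri h = trans (ρ-r i<n ri) (m≥n⇒m⊓n≡n h)
    r! : r i ≡ true → Exec _ s₁ _
    r! ri = seq! (if-≤! (rho≡ H ⊕≡ R≡ H) (δ≡ E i<n)
      (λ h → skip! (next ri refl
        (trans (rho≡ H) (cong +_ (sym (ρ≡rho ri (m+n≤o⇒m≤o∸n (ρ (suc i)) h))))) (R≡ H) (p≡ E i<n) (λ _ → refl)))
      (λ h → if-≤! (R≡ H) (δ≡ E i<n)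
        (λ R≤D → assign! (trans (⊖≡ (δ≡ E i<n) (R≡ H) R≤D)
                                (cong +_ (sym (ρ≡D∸R ri (m≤n+o⇒m∸n≤o (D i) (Rr (suc i))
                                  (subst (D i ≤_) (+-comm (ρ (suc i)) (Rr (suc i))) (<⇒≤ h)))))))
          (next ri refl refl (R≡ H) (p≡ E i<n) (λ _ → refl)))
        (λ D<R → assign! (cong +_ (sym (trans (ρ≡D∸R ri (≤-trans (≤-reflexive (m≤n⇒m∸n≡0 (<⇒≤ D<R))) z≤n))
                                              (m≤n⇒m∸n≡0 (<⇒≤ D<R)))))
          (next ri refl refl (R≡ H) (p≡ E i<n) (λ _ → refl)))))
    o! : r i ≡ false → Exec skip s₁ _
    o! ri = skip! (finish refl (trans (rho≡ H) (cong +_ (sym (ρ-o i<n ri)))) (trans (R≡ H) (cong +_ (Rr-o ri))) (λ k → refl))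

  thresholds! : ∀ s → Env s → Runᵀ thresholds n s (λ s′ → regs s′ W# ≡ + W × (∀ {k} → k ≤ n → arrays s′ ρᴬ (+ k) ≡ + ρ k))
  thresholds! s E =
    setᵀ 1≤n (trans (P≡ E ⊕≡ refl) (cong +_ (+-comm Tot 1))) $ setᵀ 1≤n refl $ setᵀ 1≤n (RT≡ E) $
    setᵀ 1≤n (n≡ E) $ putᵀ 1≤n refl refl $ moreᵀ (≤-reflexive (*-identityʳ n)) $
    mapᵀ (λ (same , H) → reg≡ same W# , λ {k} → thr≡ H z≤n) $ framedᵀ $
    while-downᵀ {s₀ = s₅} 1 n Thresholds ≤-refl 1≤n
      (λ m s same H → test-true refl (at≡ H) (s≤s z≤n) , execᵀ (thresholdStep! m s (carry same E₅) H))
      (λ s same H → test-false refl (at≡ H) (s≤s z≤n))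
      (record
        { at≡ = refl ; at≤n = ≤-refl ; rho≡ = cong +_ (sym ρ-n) ; R≡ = refl
        ; thr≡ = λ n≤k k≤n → subst (λ k → arrays s₅ ρᴬ (+ k) ≡ + ρ k) (≤-antisym n≤k k≤n)
                 (trans (setCell-same ρᴬ (+ n) {+ W} {s₄}) (cong +_ (sym ρ-n))) })
    where
    s₄ s₅ : Store
    s₄ = setReg i# (+ n) (setReg R# (+ RT) (setReg rho# (+ W) (setReg W# (+ W) s)))
    s₅ = setCell ρᴬ (+ n) (+ W) s₄
    -- Each field holds definitionally in the updated store; only the record, which is indexed by
    -- the store, has to be packed again.
    E₅ : Env s₅
    E₅ = record { n≡ = n≡ E ; P≡ = P≡ E ; RT≡ = RT≡ E ; ord≡ = ord≡ E ; p≡ = p≡ E ; δ≡ = δ≡ E ; r≡ = r≡ E }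

  -- Row i of a table starts at i (P + 1); only the entries with Pre i + b ≤ P are filled.
  index : ℕ → ℕ → ℤ
  index i b = + (i * W + b)

  -- A filled entry has `b ≤ Tot < W` and so lies before the start of the next row; writing a later
  -- row cannot disturb it.
  index-< : ∀ {i b i′ b′} → i < i′ → Pre i + b ≤ Tot → index i b ≢ index i′ b′
  index-< {i} {b} {i′} {b′} i<i′ h = <⇒+≢ (begin-strict
    i * W + b   <⟨ +-monoʳ-< (i * W) (s≤s (≤-trans (m≤n+m b (Pre i)) h)) ⟩
    i * W + W   ≡⟨ +-comm (i * W) W ⟩
    suc i * W   ≤⟨ *-monoˡ-≤ W i<i′ ⟩
    i′ * W      ≤⟨ m≤m+n (i′ * W) b′ ⟩
    i′ * W + b′ ∎)
    where open ≤-Reasoning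

  index-b< : ∀ i {b b′} → b < b′ → index i b ≢ index i b′
  index-b< i b<b′ = <⇒+≢ (+-monoʳ-< (i * W) b<b′)

  Cell Choice : Store → ℕ → ℕ → Set
  Cell s i b   = arrays s lateᴬ (index i b) ≡ + V late i b × arrays s earlyᴬ (index i b) ≡ + V early i b
  Choice s i b = r i ≡ false → arrays s lateᶜ (index (suc i) b) ≡ + choice late i b ×
                               arrays s earlyᶜ (index (suc i) b) ≡ + choice early i b

  record Rows (i : ℕ) (s : Store) : Set where
    field
      cells   : ∀ i′ b → i′ ≤ i → Pre i′ + b ≤ Tot → Cell s i′ b
      choices : ∀ i′ b → i′ < i → Pre (suc i′) + b ≤ Tot → Choice s i′ b

  record Partial (i B : ℕ) (s : Store) : Set where
    field
      rows    : Rows i s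
      cells   : ∀ b → b < B → Pre (suc i) + b ≤ Tot → Cell s (suc i) b
      choices : ∀ b → b < B → Pre (suc i) + b ≤ Tot → Choice s i b

  -- All four tables are written at one common index, so r-jobs and non-r-jobs can share the
  -- preservation argument in `extend`.
  record Agree (N : ℤ) (s s′ : Store) : Set where
    field
      at-lateᴬ  : ∀ {k} → k ≢ N → arrays s′ lateᴬ k ≡ arrays s lateᴬ k
      at-earlyᴬ : ∀ {k} → k ≢ N → arrays s′ earlyᴬ k ≡ arrays s earlyᴬ k
      at-lateᶜ  : ∀ {k} → k ≢ N → arrays s′ lateᶜ k ≡ arrays s lateᶜ k
      at-earlyᶜ : ∀ {k} → k ≢ N → arrays s′ earlyᶜ k ≡ arrays s earlyᶜ k

  module _ {N s s′} (ag : Agree N s s′) where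
    open Agree ag

    keep-Cell : ∀ {i b} → index i b ≢ N → Cell s i b → Cell s′ i b
    keep-Cell ≢N (l , e) = trans (at-lateᴬ ≢N) l , trans (at-earlyᴬ ≢N) e

    keep-Choice : ∀ {i b} → index (suc i) b ≢ N → Choice s i b → Choice s′ i b
    keep-Choice ≢N ch ri = trans (at-lateᶜ ≢N) (proj₁ (ch ri)) , trans (at-earlyᶜ ≢N) (proj₂ (ch ri))

  extend : ∀ {i B s s′} → Agree (index (suc i) B) s s′ → Partial i B s → Cell s′ (suc i) B → Choice s′ i B →
           Partial i (suc B) s′
  extend {i} {B} {s} {s′} ag P cell choice = record
    { rows = record
      { cells   = λ i′ b i′≤i h → keep-Cell ag {i′} {b} (index-< {i′} (s≤s i′≤i) h) (Rows.cells rows i′ b i′≤i h)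
      ; choices = λ i′ b i′<i h → keep-Choice ag {i′} {b} (index-< {suc i′} (s≤s i′<i) h) (Rows.choices rows i′ b i′<i h) }
    ; cells   = <suc-elim (λ b → Pre (suc i) + b ≤ Tot → Cell s′ (suc i) b)
        (λ b b<B h → keep-Cell ag {suc i} {b} (index-b< (suc i) b<B) (cells b b<B h)) (λ _ → cell)
    ; choices = <suc-elim (λ b → Pre (suc i) + b ≤ Tot → Choice s′ i b)
        (λ b b<B h → keep-Choice ag {i} {b} (index-b< (suc i) b<B) (choices b b<B h)) (λ _ → choice) }
    where open Partial P

  complete : ∀ {i s} → Pre (suc i) ≤ Tot → Partial i (suc (Tot ∸ Pre (suc i))) s → Rows (suc i) s
  complete {i} {s} Pre≤ P = record
    { cells   = λ i′ b i′≤ h → case m≤n⇒m<n∨m≡n i′≤ of λ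
        { (inj₁ i′<)  → Rows.cells rows i′ b (≤-pred i′<) h
        ; (inj₂ refl) → cells b (fit b h) h }
    ; choices = λ i′ b i′< h → case m≤n⇒m<n∨m≡n (≤-pred i′<) of λ
        { (inj₁ i′<i) → Rows.choices rows i′ b i′<i h
        ; (inj₂ refl) → choices b (fit b h) h } }
    where
    open Partial P
    fit : ∀ b → Pre (suc i) + b ≤ Tot → b < suc (Tot ∸ Pre (suc i))
    fit b h = s≤s (m+n≤o⇒m≤o∸n b (subst (_≤ Tot) (+-comm (Pre (suc i)) b) h))

  record Row (i : ℕ) (s : Store) : Set where
    field
      W≡     : regs s W# ≡ + W
      RT≡′   : regs s RT# ≡ + RT
      i≡     : regs s i# ≡ + i
      base≡  : regs s base# ≡ + (i * W)
      base₂≡ : regs s base₂# ≡ + (suc i * W)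
      q≡     : regs s q# ≡ + q i
      D≡     : regs s D# ≡ + D i
      isr≡   : regs s isr# ≡ + bit (r i)
      Pre≡   : regs s Pre# ≡ + Pre (suc i)
      O≡     : regs s O# ≡ + Oo (suc i)
      pen₀≡  : regs s pen₀# ≡ + pen₀ i
      ρ≡′    : arrays s ρᴬ (+ (i + 1)) ≡ + ρ (suc i)

  carryRow : ∀ {i s s′} → Same cell s s′ → Row i s → Row i s′
  carryRow same R = record
    { W≡     = trans (reg≡ same W#) W≡
    ; RT≡′   = trans (reg≡ same RT#) RT≡′
    ; i≡     = trans (reg≡ same i#) i≡
    ; base≡  = trans (reg≡ same base#) base≡
    ; base₂≡ = trans (reg≡ same base₂#) base₂≡
    ; q≡     = trans (reg≡ same q#) q≡
    ; D≡     = trans (reg≡ same D#) D≡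
    ; isr≡   = trans (reg≡ same isr#) isr≡
    ; Pre≡   = trans (reg≡ same Pre#) Pre≡
    ; O≡     = trans (reg≡ same O#) O≡
    ; pen₀≡  = trans (reg≡ same pen₀#) pen₀≡
    ; ρ≡′    = trans (arr≡ same ρᴬ _) ρ≡′ }
    where open Row R

  shift-q : ∀ i {B} → Pre (suc i) + B ≤ Tot → Pre i + (B + q i) ≤ Tot
  shift-q i {B} h = subst (_≤ Tot) (lem (Pre i) (q i) B) h
    where
    lem : ∀ a b c → a + b + c ≡ a + (c + b)
    lem = solve-∀

  drop-q : ∀ i {B} → Pre (suc i) + B ≤ Tot → Pre i + B ≤ Tot
  drop-q i {B} h = ≤-trans (+-monoˡ-≤ B (m≤m+n (Pre i) (q i))) h

  wide! : ∀ {i B s Q} → Row i s → regs s b# ≡ + B → Cell s i B → regs s pen₂# ≡ + pen₂ (suc i) B →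
          regs s v₁# ≡ + put₁ i B (V early i B) →
          Q (setReg l# (+ (if fits₂ i B then 2 else 1)) (setReg w# (+ put₁₂ i B (V early i B) (V late i B)) s)) →
          Exec (ifₚ reg RT# ⊕ (reg O# ⊕ reg b#) ⊕ 1ₑ ≤ₑ reg D#
                 then w# ≔ lateᴬ [ reg base# ⊕ reg b# ] ⨾ l# ≔ lit (+ 2)
                 else (w# ≔ reg pen₂# ⊕ reg v₁# ⨾ l# ≔ 1ₑ)) s Q
  wide! {i} {B} {s} {Q} R b≡ cellᵢ pen₂≡ v₁≡ post = if-≤! (RT≡′ ⊕≡ (O≡ ⊕≡ b≡) ⊕≡ refl) D≡
    (λ h → let fits = subst (_≤ D i) (+-comm _ 1) h in
      set! (trans (cong (arrays s lateᴬ) (base≡ ⊕≡ b≡)) (proj₁ cellᵢ)) (assign! refl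
        (subst₂ After (put₁₂-fits i B (V early i B) (V late i B) fits)
                      (cong (λ z → if z then 2 else 1) (<ᵇ-true fits)) post)))
    (λ h → let tight = ≤-pred (subst (D i <_) (+-comm _ 1) h) in
      set! (pen₂≡ ⊕≡ v₁≡) (assign! refl
        (subst₂ After (put₁₂-tight i B (V early i B) (V late i B) tight)
                      (cong (λ z → if z then 2 else 1) (<ᵇ-false tight)) post)))
    where
    open Row R
    After : ℕ → ℕ → Set
    After w l = Q (setReg l# (+ l) (setReg w# (+ w) s))

  module _ {i B s} (R : Row i s) (P : Partial i B s) (b≡ : regs s b# ≡ + B) (h : Pre (suc i) + B ≤ Tot) where
    open Row R

    private
      N : ℤ
      N = index (suc i) B
      here-cell : Cell s i B
      here-cell = Rows.cells (Partial.rows P) i B ≤-refl (drop-q i h)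
      there-cell : Cell s i (B + q i)
      there-cell = Rows.cells (Partial.rows P) i (B + q i) ≤-refl (shift-q i h)
      Post : Store → Set
      Post s′ = regs s′ b# ≡ + suc B × Partial i (suc B) s′
      s₁ : Store
      s₁ = setReg pen₁# (+ pen₁ i B) s

    rCell! : r i ≡ true → Exec rCell s₁ (λ s′ → Exec (b# ≔ reg b# ⊕ 1ₑ) s′ Post)
    rCell! ri =
      put! (base₂≡ ⊕≡ b≡) (refl ⊕≡ trans (cong (arrays s earlyᴬ) (base≡ ⊕≡ b≡)) (proj₂ here-cell)) $
      write! (base₂≡ ⊕≡ b≡) (trans (cong (arrays s lateᴬ) (base≡ ⊕≡ b≡)) (proj₁ here-cell)) $
      assign! (b≡ ⊕≡ refl) $ cong +_ (+-comm B 1) , extend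
        (record { at-lateᴬ = upd-other ; at-earlyᴬ = upd-other ; at-lateᶜ = λ _ → refl ; at-earlyᶜ = λ _ → refl }) P
        (trans (upd-same N) (cong +_ (sym (V-late-r B ri))) , trans (upd-same N) (cong +_ (sym (V-early-r B ri))))
        (λ ri′ → case trans (sym ri) ri′ of λ ())

    oCell! : r i ≡ false → Exec oCell s₁ (λ s′ → Exec (b# ≔ reg b# ⊕ 1ₑ) s′ Post)
    oCell! ri =
      set! (pen₀≡ ⊕≡ trans (cong (arrays s earlyᴬ) (base≡ ⊕≡ (b≡ ⊕≡ q≡))) (proj₂ there-cell)) $
      set! (q≡ ⊕≡ (refl ⊕≡ trans (cong (arrays s earlyᴬ) (base≡ ⊕≡ b≡)) (proj₂ here-cell))) $
      seq! $ best! base₂≡ b≡ refl refl (λ _ → refl) $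
      seq! $ pay! W≡ (O≡ ⊕≡ b≡) (trans (cong (arrays s ρᴬ) (i≡ ⊕≡ refl)) ρ≡′) $
      seq! $ wide! (record
        { W≡ = W≡ ; RT≡′ = RT≡′ ; i≡ = i≡ ; base≡ = base≡ ; base₂≡ = base₂≡ ; q≡ = q≡ ; D≡ = D≡ ; isr≡ = isr≡
        ; Pre≡ = Pre≡ ; O≡ = O≡ ; pen₀≡ = pen₀≡ ; ρ≡′ = ρ≡′ }) b≡
        (proj₁ here-cell , trans (upd-other (index-< {i} {B} {suc i} {B} ≤-refl (drop-q i h))) (proj₂ here-cell)) refl refl $
      set! (pen₀≡ ⊕≡ trans (cong (arrays s lateᴬ) (base≡ ⊕≡ (b≡ ⊕≡ q≡))) (proj₁ there-cell)) $
      best! base₂≡ b≡ refl refl (λ _ → refl) $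
      assign! (b≡ ⊕≡ refl) $ cong +_ (+-comm B 1) , extend
        (record { at-lateᴬ = upd-other ; at-earlyᴬ = upd-other ; at-lateᶜ = upd-other ; at-earlyᶜ = upd-other }) P
        (trans (upd-same N) (cong +_ (sym (V-late-o B ri))) , trans (upd-same N) (cong +_ (sym (V-early-o B ri))))
        (λ _ → upd-same N , upd-same N)

    cell! : Exec cell s Post
    cell! = seq! $ pay! W≡ (Pre≡ ⊕≡ b≡) D≡ $ seq! $ if-bit! isr≡ rCell! oCell!

  row₀! : ∀ s → Env s → regs s W# ≡ + W → arrays s ρᴬ (+ 0) ≡ + ρ 0 → Runᵀ row₀ W s (Rows 0)
  row₀! s E W≡ ρ≡₀ = setᵀ (s≤s z≤n) refl $ moreᵀ (≤-reflexive (*-identityʳ W)) $ mapᵀ finish $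
    while-upᵀ {s₀ = s₁} 1 W Inv ≤-refl (s≤s z≤n)
      (λ k s k<W same inv → test-true (proj₁ inv) (trans (reg≡ same P#) (P≡ E)) (≤-pred k<W) ,
        execᵀ (cell₀! k s (trans (reg≡ same W#) W≡) (trans (arr≡ same ρᴬ (+ 0)) ρ≡₀) inv))
      (λ s same inv → test-false (proj₁ inv) (trans (reg≡ same P#) (P≡ E)) ≤-refl)
      (refl , λ _ ())
    where
    s₁ : Store
    s₁ = setReg b# (+ 0) s
    Inv : ℕ → Store → Set
    Inv k s = regs s b# ≡ + k × ∀ b → b < k → Cell s 0 b
    cell₀! : ∀ k s → regs s W# ≡ + W → arrays s ρᴬ (+ 0) ≡ + ρ 0 → Inv k s → Exec cell₀ s (Inv (suc k))
    cell₀! k s W≡ ρ≡₀ (b≡ , cells) = seq! $ pay! W≡ b≡ ρ≡₀ $ put! b≡ refl $ put! b≡ refl $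
      assign! (b≡ ⊕≡ refl) $ cong +_ (+-comm k 1) , <suc-elim
        (Cell (setCell earlyᴬ (+ k) (+ 0) (setCell lateᴬ (+ k) (+ pen₂ 0 k) s)) 0)
        (λ b b<k → trans (upd-other (index-b< 0 b<k)) (proj₁ (cells b b<k)) ,
                   trans (upd-other (index-b< 0 b<k)) (proj₂ (cells b b<k)))
        (upd-same (index 0 k) , upd-same (index 0 k))
    finish : ∀ {s} → Inv W s → Rows 0 s
    finish (_ , cells) = record { cells = λ { zero b z≤n h → cells b (s≤s h) } ; choices = λ _ _ () }

  record TableInv (i : ℕ) (s : Store) : Set where
    field
      W≡    : regs s W# ≡ + W
      ρ≡    : ∀ {k} → k ≤ n → arrays s ρᴬ (+ k) ≡ + ρ k
      i≡    : regs s i# ≡ + i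
      base≡ : regs s base# ≡ + (i * W)
      Pre≡  : regs s Pre# ≡ + Pre i
      O≡    : regs s O# ≡ + Oo i
      rows  : Rows i s

  row! : ∀ i s → i < n → Env s → TableInv i s → Runᵀ row W s (TableInv (suc i))
  row! i s i<n E TI =
    setᵀ 1≤W (trans (cong (arrays s ordᴬ) i≡) (ord≡ E i<n)) $ setᵀ 1≤W (p≡ E i<n) $ setᵀ 1≤W (δ≡ E i<n) $
    setᵀ 1≤W (r≡ E i<n) $ setᵀ 1≤W (Pre≡ ⊕≡ refl) $ seqᵀ $ onceᵀ 1≤W $ if-bit! refl
      (λ ri → assign! (trans O≡ (cong +_ (sym (Oo-r ri)))) rest)
      (λ ri → assign! (trans (O≡ ⊕≡ refl) (cong +_ (sym (Oo-o ri)))) rest)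
    where
    open TableInv TI
    1≤W : 1 ≤ W
    1≤W = s≤s z≤n
    Oo-r : r i ≡ true → Oo (suc i) ≡ Oo i
    Oo-r ri rewrite ri = +-identityʳ (Oo i)
    Oo-o : r i ≡ false → Oo (suc i) ≡ Oo i + q i
    Oo-o ri rewrite ri = refl
    Pre≤ : Pre (suc i) ≤ Tot
    Pre≤ = ∑-mono-≤ q i<n
    s₆ s₉ : Store
    s₆ = setReg O# (+ Oo (suc i)) (setReg Pre# (+ Pre (suc i)) (setReg isr# (+ bit (r i))
           (setReg D# (+ D i) (setReg q# (+ q i) (setReg j# (+ jb i) s)))))
    s₉ = setReg b# (+ 0) (setReg pen₀# (+ pen₀ i) (setReg base₂# (+ (suc i * W)) s₆))
    R₉ : Row i s₉
    R₉ = record { W≡ = W≡ ; RT≡′ = RT≡ E ; i≡ = i≡ ; base≡ = base≡ ; base₂≡ = refl ; q≡ = refl ; D≡ = refl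
                ; isr≡ = refl ; Pre≡ = refl ; O≡ = refl ; pen₀≡ = refl
                ; ρ≡′ = trans (cong (λ z → arrays s ρᴬ (+ z)) (+-comm i 1)) (ρ≡ i<n) }
    N : ℕ
    N = suc (Tot ∸ Pre (suc i))
    inside : ∀ {k} → k < N → Pre (suc i) + k ≤ Tot
    inside {k} (s≤s k≤) = subst (_≤ Tot) (+-comm k (Pre (suc i))) (m≤o∸n⇒m+n≤o k Pre≤ k≤)
    outside : Tot < Pre (suc i) + N
    outside = subst (Tot <_) (sym (trans (+-suc _ _) (cong suc (m+[n∸m]≡n Pre≤)))) ≤-refl
    Inv : ℕ → Store → Set
    Inv k s = regs s b# ≡ + k × Partial i k s
    finish : ∀ {s} → Same (while reg Pre# ⊕ reg b# ≤ₑ reg P# run cell) s₉ s → Partial i N s →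
             Runᵀ (base# ≔ reg base₂# ⨾ i# ≔ reg i# ⊕ 1ₑ) W s (TableInv (suc i))
    finish same P = setᵀ 1≤W (Row.base₂≡ R) $ onceᵀ 1≤W $ assign! (Row.i≡ R ⊕≡ refl) $ record
      { W≡ = Row.W≡ R ; ρ≡ = λ k≤n → trans (arr≡ same ρᴬ _) (ρ≡ k≤n) ; i≡ = cong +_ (+-comm i 1)
      ; base≡ = refl ; Pre≡ = Row.Pre≡ R ; O≡ = Row.O≡ R
      ; rows = record { cells = Rows.cells (complete Pre≤ P) ; choices = Rows.choices (complete Pre≤ P) } }
      where
      R : Row i _
      -- A loop and its body have the same side conditions, so repacking suffices to pass from one
      -- index of `Same` to the other.
      R = carryRow (record { reg≡ = λ x {h} → reg≡ same x {h} ; arr≡ = λ a {h} → arr≡ same a {h} }) R₉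
    rest : Runᵀ _ W s₆ (TableInv (suc i))
    rest = setᵀ 1≤W (W≡ ⊕≡ base≡) $ seqᵀ $ onceᵀ 1≤W $ pay! W≡ refl refl $ setᵀ 1≤W refl $ seqᵀ $
      mapᵀ (λ (same , _ , P) → finish same P) $
      framedᵀ $ moreᵀ (≤-trans (≤-reflexive (*-identityʳ N)) (s≤s (m∸n≤m Tot (Pre (suc i))))) $
      while-upᵀ {s₀ = s₉} 1 N Inv ≤-refl (s≤s z≤n)
        (λ k s k<N same (b≡ , P) → let R = carryRow same R₉ in
          test-true (Row.Pre≡ R ⊕≡ b≡) (trans (reg≡ same P#) (P≡ E)) (inside k<N) ,
          execᵀ (cell! R P b≡ (inside k<N)))
        (λ s same (b≡ , P) → test-false (Row.Pre≡ (carryRow same R₉) ⊕≡ b≡) (trans (reg≡ same P#) (P≡ E)) outside)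
        (refl , record { rows = record { cells = Rows.cells rows ; choices = Rows.choices rows }
                       ; cells = λ _ () ; choices = λ _ () })

  table! : ∀ s → Env s → regs s W# ≡ + W → (∀ {k} → k ≤ n → arrays s ρᴬ (+ k) ≡ + ρ k) → Rows 0 s →
           Runᵀ table (n * W) s (TableInv n)
  table! s E W≡ ρ≡ rows = setᵀ 1≤Y refl $ setᵀ 1≤Y refl $ setᵀ 1≤Y refl $ setᵀ 1≤Y refl $
    while-upᵀ {s₀ = s₄} W n TableInv (s≤s z≤n) 1≤n
      (λ k s k<n same TI → test-true (TableInv.i≡ TI ⊕≡ refl) (n≡ (carry same E₄)) (subst (_≤ n) (+-comm 1 k) k<n) ,
        row! k s k<n (carry same E₄) TI)
      (λ s same TI → test-false (TableInv.i≡ TI ⊕≡ refl) (n≡ (carry same E₄)) (≤-reflexive (+-comm 1 n)))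
      (record { W≡ = W≡ ; ρ≡ = ρ≡ ; i≡ = refl ; base≡ = refl ; Pre≡ = refl ; O≡ = refl
              ; rows = record { cells = Rows.cells rows ; choices = Rows.choices rows } })
    where
    1≤Y : 1 ≤ n * W
    1≤Y = *-mono-≤ 1≤n (s≤s (z≤n {Tot}))
    s₄ : Store
    s₄ = setReg O# (+ 0) (setReg Pre# (+ 0) (setReg base# (+ 0) (setReg i# (+ 0) s)))
    E₄ : Env s₄
    E₄ = record { n≡ = n≡ E ; P≡ = P≡ E ; RT≡ = RT≡ E ; ord≡ = ord≡ E ; p≡ = p≡ E ; δ≡ = δ≡ E ; r≡ = r≡ E }

  Lb : ℕ → ℕ
  Lb = labels late n 0

  code : Phase → ℕ
  code late  = 0
  code early = 1

  -- `ahead` says that the full traceback continues as the one from the present state; `fits` keeps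
  -- the choices it reads within the filled part of the tables.
  record Labelling (i : ℕ) (s : Store) : Set where
    field
      W≡    : regs s W# ≡ + W
      i≡    : regs s i# ≡ + i
      i≤n   : i ≤ n
      φ     : Phase
      b     : ℕ
      φ≡    : regs s φ# ≡ + code φ
      b≡    : regs s b# ≡ + b
      base≡ : regs s base# ≡ + (i * W)
      fits  : Pre i + b ≤ Tot
      ahead : ∀ k → k < i → Lb k ≡ labels φ i b k
      done  : ∀ k → i ≤ k → k < n → arrays s labᴬ (+ jb k) ≡ + Lb k

  labelStep! : ∀ i s → Env s →
    (∀ i b → i < n → Pre (suc i) + b ≤ Tot → Choice s i b) →
    Labelling (suc i) s → Exec labelStep s (Labelling i)
  labelStep! i s E choices H = set! (⊖≡ i≡ refl (s≤s z≤n)) $ set! (ord≡ E i<n) $ seq! $ if-bit! (r≡ E i<n)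
    (λ ri → write! refl refl (finish (next-r φ b ri) refl φ≡ b≡ W≡ base≡ (drop-q i fits)
      (upd-same (+ jb i)) (λ _ k≢i → upd-other k≢i)))
    (λ ri → seq! $ o! ri)
    where
    open Labelling H
    i<n : i < n
    i<n = i≤n
    s₂ : Store
    s₂ = setReg j# (+ jb i) (setReg i# (+ i) s)

    finish : ∀ {ℓ φ′ b′ s′} → label φ i b ≡ ℓ × phase⁺ φ i b ≡ φ′ × b⁺ φ i b ≡ b′ →
      regs s′ i# ≡ + i → regs s′ φ# ≡ + code φ′ → regs s′ b# ≡ + b′ → regs s′ W# ≡ + W →
      regs s′ base# ≡ + (suc i * W) → Pre i + b′ ≤ Tot →
      arrays s′ labᴬ (+ jb i) ≡ + ℓ → (∀ k → k ≢ + jb i → arrays s′ labᴬ k ≡ arrays s labᴬ k) →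
      Exec (base# ≔ reg base# ⊖ reg W#) s′ (Labelling i)
    finish {ℓ} {φ′} {b′} {s′} (l≡ , φ⁺≡ , b⁺≡) i≡′ φ≡′ b≡′ W≡′ base≡′ fits′ new old =
      assign! (trans (⊖≡ base≡′ W≡′ (m≤m+n W (i * W))) (cong +_ (m+n∸m≡n W (i * W)))) record
        { W≡ = W≡′ ; i≡ = i≡′ ; i≤n = <⇒≤ i<n ; φ = φ′ ; b = b′ ; φ≡ = φ≡′ ; b≡ = b≡′ ; base≡ = refl ; fits = fits′
        ; ahead = λ k k<i → trans (ahead k (m<n⇒m<1+n k<i)) (trans (labels-< φ i b k k<i)
                    (cong₂ (λ φ b → labels φ i b k) φ⁺≡ b⁺≡))
        ; done = λ k i≤k k<n → case m≤n⇒m<n∨m≡n i≤k of λ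
            { (inj₁ i<k)  → trans (old (+ jb k) (λ eq → <⇒≢ i<k (jb-injective i<n k<n (sym (ℤ.+-injective eq)))))
                                  (done k i<k k<n)
            ; (inj₂ refl) → trans new (cong +_ (sym (trans (ahead i ≤-refl) (trans (labels-i φ i b) l≡)))) } }

    tail : ∀ {c} → r i ≡ false → choice φ i b ≡ c →
      let s₄ = setCell labᴬ (+ jb i) (+ c) (setReg l# (+ c) s₂) in
      Exec (ifₚ reg l# ≤ₑ lit (+ 0)
             then b# ≔ reg b# ⊕ pᴬ [ reg j# ]
             else (ifₚ reg l# ≤ₑ 1ₑ then φ# ≔ 1ₑ else skip)) s₄
        (λ s′ → Exec (base# ≔ reg base# ⊖ reg W#) s′ (Labelling i))
    tail {0} ri c≡ = if-true! refl $ assign! (b≡ ⊕≡ p≡ E i<n) $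
      finish (next-0 φ b ri c≡) refl φ≡ refl W≡ base≡ (shift-q i fits) (upd-same (+ jb i)) (λ _ → upd-other)
    tail {1} ri c≡ = if-false! refl $ if-true! refl $ assign! refl $
      finish (next-1 φ b ri c≡) refl refl b≡ W≡ base≡ (drop-q i fits) (upd-same (+ jb i)) (λ _ → upd-other)
    tail {suc (suc c)} ri c≡ = if-false! refl $ if-false! refl $ skip! $
      finish (next-2 φ b ri c≡) refl φ≡ b≡ W≡ base≡ (drop-q i fits) (upd-same (+ jb i)) (λ _ → upd-other)

    o! : r i ≡ false → Exec _ s₂ _
    o! ri = read φ refl
      where
      chosen : Choice s i b
      chosen = choices i b i<n fits
      read : ∀ φ′ → φ ≡ φ′ → Exec (ifₚ reg φ# ≤ₑ lit (+ 0)
           then l# ≔ lateᶜ [ reg base# ⊕ reg b# ]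
           else (l# ≔ earlyᶜ [ reg base# ⊕ reg b# ])) s₂ _
      read late  eq = if-true! (test-true φ≡ refl (≤-reflexive (cong code eq))) $
        assign! (trans (cong (arrays s lateᶜ) (base≡ ⊕≡ b≡))
                       (trans (proj₁ (chosen ri)) (cong (λ φ → + choice φ i b) (sym eq)))) $
        put! refl refl (tail ri refl)
      read early eq = if-false! (test-false φ≡ refl (≤-reflexive (sym (cong code eq)))) $
        assign! (trans (cong (arrays s earlyᶜ) (base≡ ⊕≡ b≡))
                       (trans (proj₂ (chosen ri)) (cong (λ φ → + choice φ i b) (sym eq)))) $
        put! refl refl (tail ri refl)

  labelling! : ∀ s → Env s → TableInv n s → Runᵀ labelling n s (λ s′ →
    regs s′ ans# ≡ + bit (V late n 0 ≤ᵇ Tot) × (∀ k → k < n → arrays s′ labᴬ (+ jb k) ≡ + Lb k))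
  labelling! s E TI = seqᵀ $ onceᵀ 1≤n $ if-≤! V≡ (P≡ E)
    (λ V≤ → assign! (cong (λ z → + bit z) (sym (≤ᵇ-true V≤))) rest)
    (λ V> → assign! (cong (λ z → + bit z) (sym (≤ᵇ-false V>))) rest)
    where
    open TableInv TI
    V≡ : arrays s lateᴬ (regs s base#) ≡ + V late n 0
    V≡ = trans (cong (arrays s lateᴬ) (trans base≡ (cong +_ (sym (+-identityʳ (n * W))))))
               (proj₁ (Rows.cells rows n 0 ≤-refl (≤-reflexive (+-identityʳ Tot))))
    s₁ s₃ : Store
    s₁ = setReg ans# (+ bit (V late n 0 ≤ᵇ Tot)) s
    s₃ = setReg φ# (+ 0) (setReg b# (+ 0) s₁)
    E₃ : Env s₃
    E₃ = record { n≡ = n≡ E ; P≡ = P≡ E ; RT≡ = RT≡ E ; ord≡ = ord≡ E ; p≡ = p≡ E ; δ≡ = δ≡ E ; r≡ = r≡ E }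
    rest : Runᵀ _ n s₁ _
    rest = setᵀ 1≤n refl $ setᵀ 1≤n refl $ moreᵀ (≤-reflexive (*-identityʳ n)) $
      mapᵀ (λ (same , H) → reg≡ same ans# , λ k → Labelling.done H k z≤n) $ framedᵀ $
      while-downᵀ {s₀ = s₃} 1 n Labelling ≤-refl 1≤n
        (λ m s same H → test-true refl (Labelling.i≡ H) (s≤s z≤n) ,
          execᵀ (labelStep! m s (carry same E₃)
            (λ i b i<n h ri → let l , e = Rows.choices rows i b i<n h ri in
              trans (arr≡ same lateᶜ _) l , trans (arr≡ same earlyᶜ _) e) H))
        (λ s same H → test-false refl (Labelling.i≡ H) (s≤s z≤n))
        (record { W≡ = W≡ ; i≡ = i≡ ; i≤n = ≤-refl ; φ = late ; b = 0 ; φ≡ = refl ; b≡ = refl ; base≡ = base≡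
                ; fits = ≤-reflexive (+-identityʳ Tot) ; ahead = λ _ _ → refl
                ; done = λ k n≤k k<n → contradiction k<n (≤⇒≯ n≤k) })

-- Preprocessing, the two sorts and the overall bound

totalStep totals deadlineStep deadlines : Prog
totalStep =
  P# ≔ reg P# ⊕ pᴬ [ reg i# ] ⨾
  (ifₚ 1ₑ ≤ₑ rᴬ [ reg i# ] then RT# ≔ reg RT# ⊕ pᴬ [ reg i# ] else (RT# ≔ reg RT#)) ⨾
  idᴬ [ reg i# ]≔ reg i# ⨾
  i# ≔ reg i# ⊕ 1ₑ
totals = while reg i# ⊕ 1ₑ ≤ₑ reg n# run totalStep
deadlineStep =
  D# ≔ dᴬ [ reg i# ] ⊕ reg K# ⨾
  (ifₚ lit (+ 0) ≤ₑ reg D#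
    then (ifₚ reg D# ≤ₑ reg P#
           then δᴬ [ reg i# ]≔ reg D# ⊕ 1ₑ
           else (δᴬ [ reg i# ]≔ reg P# ⊕ 1ₑ))
    else (δᴬ [ reg i# ]≔ lit (+ 0))) ⨾
  i# ≔ reg i# ⊕ 1ₑ
deadlines =
  i# ≔ lit (+ 0) ⨾
  while reg i# ⊕ 1ₑ ≤ₑ reg n# run deadlineStep
-- The second sort reads the jobs in EDD order, so stability gives EDD order within each label. It
-- writes to array 0, where the answer is expected, and `n#` receives the answer bit only afterwards
-- because the sort reads `n` there.
sortByDeadline solve sortByLabel main : Prog
sortByLabel =
  top# ≔ lit (+ 2) ⨾
  BucketSort.sort ordᴬ labᴬ pᴬ ⨾
  n# ≔ reg ans#
solve =
  thresholds ⨾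
  row₀ ⨾
  table ⨾
  labelling ⨾
  sortByLabel
sortByDeadline =
  top# ≔ reg P# ⊕ 1ₑ ⨾
  BucketSort.sort idᴬ δᴬ ordᴬ ⨾
  solve
main =
  totals ⨾
  deadlines ⨾
  sortByDeadline

contents-at : ∀ {n} (f : Fin n → ℤ) j → contents f (+ toℕ j) ≡ f j
contents-at {n} f j with toℕ j <? n
... | yes j<n = cong f (Fin.fromℕ<-toℕ j j<n)
... | no  j≮n = contradiction (Fin.toℕ<n j) j≮n

clip≤ : ∀ P z → clip P z ≤ suc P
clip≤ P (+ m)    = s≤s (m⊓n≤n m P)
clip≤ P -[1+ m ] = z≤n

module Algorithm (I : Instance) where

  open Sequences I

  N : ℕ
  N = n I

  1≤N : 1 ≤ N
  1≤N = ≤-trans (s≤s z≤n) (Fin.toℕ<n (j₀ I))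

  p′ : ℕ → ℕ
  p′ = ext 0 (p I)

  r′ : ℕ → Bool
  r′ = ext false isR

  RT′ : ℕ
  RT′ = ∑ N (λ k → r′ k ⊙ p′ k)

  record Given (s : Store) : Set where
    field
      n≡ : regs s n# ≡ + N
      p≡ : ∀ (j : Fin N) → arrays s pᴬ (+ toℕ j) ≡ + p I j
      r≡ : ∀ (j : Fin N) → arrays s rᴬ (+ toℕ j) ≡ + bit (isR j)

  record Due (s : Store) : Set where
    field
      K≡ : regs s K# ≡ K I
      d≡ : ∀ (j : Fin N) → arrays s dᴬ (+ toℕ j) ≡ d I j

  record Totals (s : Store) : Set where
    field
      given : Given s
      P≡    : regs s P# ≡ + P I
      RT≡   : regs s RT# ≡ + RT′

  record Upto (A : ℕ) (f : Fin N → ℕ) (k : ℕ) (s : Store) : Set where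
    field
      i≡   : regs s i# ≡ + k
      upto : ∀ (j : Fin N) → toℕ j < k → arrays s A (+ toℕ j) ≡ + f j

  open Given
  open Due
  open Totals
  open Upto

  for-jobs : ∀ {c s₀} (Inv : ℕ → Store → Set) → regs s₀ n# ≡ + N → {T (keepsReg n# c)} →
    (∀ {k s} → Inv k s → regs s i# ≡ + k) →
    (∀ (j : Fin N) s → Same c s₀ s → Inv (toℕ j) s → Exec c s (Inv (suc (toℕ j)))) →
    Inv 0 s₀ → Runᵀ (while reg i# ⊕ 1ₑ ≤ₑ reg n# run c) N s₀ (Inv N)
  for-jobs Inv n≡ {kept} at-i body inv₀ = moreᵀ (≤-reflexive (*-identityʳ N)) $
    while-upᵀ 1 N Inv ≤-refl 1≤N
      (λ k s k<N same inv → test-true (at-i inv ⊕≡ refl) (trans (reg≡ same n# {kept}) n≡) (subst (_≤ N) (+-comm 1 k) k<N) ,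
        execᵀ (∀-toℕ (λ k → Inv k s → Exec _ s (Inv (suc k))) (λ j → body j s same) k k<N inv))
      (λ s same inv → test-false (at-i inv ⊕≡ refl) (trans (reg≡ same n# {kept}) n≡) (≤-reflexive (+-comm 1 N)))
      inv₀

  upto-suc : ∀ (g : ℤ → ℤ) (f : Fin N → ℕ) j {v} → (∀ i → toℕ i < toℕ j → g (+ toℕ i) ≡ + f i) → v ≡ + f j →
    ∀ i → toℕ i < suc (toℕ j) → (if does (+ toℕ i ℤ.≟ + toℕ j) then v else g (+ toℕ i)) ≡ + f i
  upto-suc g f j below new i (s≤s i≤j) with m≤n⇒m<n∨m≡n i≤j
  ... | inj₁ i<j = trans (upd-other (<⇒+≢ i<j)) (below i i<j)
  ... | inj₂ eq with Fin.toℕ-injective eq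
  ...   | refl = trans (upd-same (+ toℕ j)) new

  record TotalInv (k : ℕ) (s : Store) : Set where
    field
      sofar : Upto idᴬ toℕ k s
      sumP≡  : regs s P# ≡ + ∑ k p′
      sumRT≡ : regs s RT# ≡ + ∑ k (λ k → r′ k ⊙ p′ k)

  given₀ : Given (input I)
  given₀ = record
    { n≡ = refl
    ; p≡ = contents-at _
    ; r≡ = λ j → trans (contents-at (λ j → if isR j then 1ℤ else 0ℤ) j) (bit-if (isR j)) }
    where
    bit-if : ∀ b → (if b then 1ℤ else 0ℤ) ≡ + bit b
    bit-if true  = refl
    bit-if false = refl

  due₀ : Due (input I)
  due₀ = record { K≡ = refl ; d≡ = contents-at _ }

  totals! : Runᵀ totals N (input I) (λ s → Totals s × Due s × Upto idᴬ toℕ N s)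
  totals! = mapᵀ (λ (same , inv) →
      record { given = record { n≡ = reg≡ same n# ; p≡ = λ j → trans (arr≡ same pᴬ _) (p≡ given₀ j)
                              ; r≡ = λ j → trans (arr≡ same rᴬ _) (r≡ given₀ j) }
             ; P≡ = trans (TotalInv.sumP≡ inv) (cong +_ (sym (sum≡∑ N {g = p′} λ i → sym (ext-toℕ (p I) i))))
             ; RT≡ = TotalInv.sumRT≡ inv } ,
      record { K≡ = reg≡ same K# ; d≡ = λ j → trans (arr≡ same dᴬ _) (d≡ due₀ j) } ,
      TotalInv.sofar inv) $
    framedᵀ $ for-jobs TotalInv refl (λ inv → i≡ (TotalInv.sofar inv)) body
      (record { sofar = record { i≡ = refl ; upto = λ _ () } ; sumP≡ = refl ; sumRT≡ = refl })
    where
    body : ∀ (j : Fin N) s → Same totalStep (input I) s → TotalInv (toℕ j) s → Exec totalStep s (TotalInv (suc (toℕ j)))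
    body j s same inv =
      set! (sumP≡ ⊕≡ p-at) $ seq! $
      if-bit! r-at
        (λ rj → assign! (trans (sumRT≡ ⊕≡ p-at) (cong (λ b → + (∑′ + b ⊙ p I j)) (sym rj))) rest)
        (λ rj → assign! (trans sumRT≡ (cong +_ (trans (sym (+-identityʳ ∑′)) (cong (λ b → ∑′ + b ⊙ p I j) (sym rj))))) rest)
      where
      open TotalInv inv
      i≡′ : regs s i# ≡ + toℕ j
      i≡′ = i≡ sofar
      p-at : arrays s pᴬ (regs s i#) ≡ + p I j
      p-at = trans (cong (arrays s pᴬ) i≡′) (trans (arr≡ same pᴬ _) (p≡ given₀ j))
      s₁ : Store
      s₁ = setReg P# (+ (∑ (toℕ j) p′ + p I j)) s
      ∑′ : ℕ
      ∑′ = ∑ (toℕ j) (λ k → r′ k ⊙ p′ k)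
      r-at : arrays s rᴬ (regs s i#) ≡ + bit (isR j)
      r-at = trans (cong (arrays s rᴬ) i≡′) (trans (arr≡ same rᴬ _) (r≡ given₀ j))
      rest : Exec (idᴬ [ reg i# ]≔ reg i# ⨾ i# ≔ reg i# ⊕ 1ₑ) (setReg RT# (+ (∑′ + isR j ⊙ p I j)) s₁)
                  (TotalInv (suc (toℕ j)))
      rest = put! i≡′ i≡′ $ assign! (i≡′ ⊕≡ refl) $ record
        { sofar = record { i≡ = cong +_ (+-comm (toℕ j) 1)
                         ; upto = upto-suc (arrays s idᴬ) toℕ j (upto sofar) refl }
        ; sumP≡ = cong (λ z → + (∑ (toℕ j) p′ + z)) (sym (ext-toℕ (p I) j))
        ; sumRT≡ = cong (λ z → + (∑′ + z)) (sym (cong₂ _⊙_ (ext-toℕ isR j) (ext-toℕ (p I) j))) }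

  clip! : ∀ {z k s Q} → regs s D# ≡ z → regs s P# ≡ + P I → regs s i# ≡ + k →
    Q (setCell δᴬ (+ k) (+ clip (P I) z) s) →
    Exec (ifₚ lit (+ 0) ≤ₑ reg D#
           then (ifₚ reg D# ≤ₑ reg P#
                  then δᴬ [ reg i# ]≔ reg D# ⊕ 1ₑ
                  else (δᴬ [ reg i# ]≔ reg P# ⊕ 1ₑ))
           else (δᴬ [ reg i# ]≔ lit (+ 0))) s Q
  clip! { -[1+ m ]} D≡ P≡ i≡ post = if-false! (cong (+ 0 ℤ.≤ᵇ_) D≡) (write! i≡ refl post)
  clip! {+ m} {k} {s} {Q} D≡ P≡ i≡ post = if-true! (test-true refl D≡ z≤n) $ if-≤! D≡ P≡
    (λ m≤P → write! i≡ (trans (D≡ ⊕≡ refl) (cong +_ (+-comm m 1)))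
      (subst (λ z → Q (setCell δᴬ (+ k) (+ suc z) s)) (m≤n⇒m⊓n≡m m≤P) post))
    (λ P<m → write! i≡ (trans (P≡ ⊕≡ refl) (cong +_ (+-comm (P I) 1)))
      (subst (λ z → Q (setCell δᴬ (+ k) (+ suc z) s)) (m≥n⇒m⊓n≡n (<⇒≤ P<m)) post))

  deadlines! : ∀ s → Totals s → Due s → Runᵀ deadlines N s (Upto δᴬ δ N)
  deadlines! s T Du = setᵀ 1≤N refl $ for-jobs (Upto δᴬ δ) (n≡ (given T)) i≡ body
    (record { i≡ = refl ; upto = λ _ () })
    where
    body : ∀ (j : Fin N) s′ → Same deadlineStep (setReg i# (+ 0) s) s′ → Upto δᴬ δ (toℕ j) s′ →
           Exec deadlineStep s′ (Upto δᴬ δ (suc (toℕ j)))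
    body j s′ same U =
      set! (cong₂ ℤ._+_ (trans (cong (arrays s′ dᴬ) (i≡ U)) (trans (arr≡ same dᴬ _) (d≡ Du j)))
                      (trans (reg≡ same K#) (K≡ Du))) $
      seq! $ clip! refl (trans (reg≡ same P#) (P≡ T)) (i≡ U) $ assign! (i≡ U ⊕≡ refl) $
      record { i≡ = cong +_ (+-comm (toℕ j) 1) ; upto = upto-suc (arrays s′ δᴬ) δ j (upto U) refl }

  -- `3 + P I` dominates the `P I + 2` buckets of the deadline sort, the `P I + 1` columns of a
  -- table row and the 3 labels of the second sort, even if `P I` is 0.
  Y : ℕ
  Y = N * (3 + P I)

  1≤Y : 1 ≤ Y
  1≤Y = *-mono-≤ 1≤N (s≤s (z≤n {2 + P I}))

  N*≤Y : ∀ {m} → m ≤ 3 + P I → N * m ≤ Y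
  N*≤Y = *-monoʳ-≤ N

  N≤Y : N ≤ Y
  N≤Y = subst (_≤ Y) (*-identityʳ N) (N*≤Y (s≤s z≤n))

  *N≤Y : ∀ {m} → m ≤ 3 + P I → m * N ≤ Y
  *N≤Y {m} h = subst (_≤ Y) (*-comm N m) (N*≤Y h)

  module Sorted (ω : Permutation′ N) (sorted : ∀ i j → i Fin.≤ j → δ (ω ⟨$⟩ʳ i) ≤ δ (ω ⟨$⟩ʳ j)) where

    open EDD ω sorted

    jb : ℕ → ℕ
    jb = ext 0 (λ k → toℕ (ω ⟨$⟩ʳ k))

    jb-injective : ∀ k → k < N → ∀ m → m < N → jb k ≡ jb m → k ≡ m
    jb-injective = ∀-toℕ _ λ k → ∀-toℕ _ λ m eq → cong toℕ
      (trans (sym (inverseˡ ω)) (trans (cong (ω ⟨$⟩ˡ_) (Fin.toℕ-injective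
        (trans (sym (ext-toℕ _ k)) (trans eq (ext-toℕ _ m))))) (inverseˡ ω)))

    open Dynamic N 1≤N q D r jb (λ k<n m<n → jb-injective _ k<n _ m<n)

    RT≡RT′ : RT ≡ RT′
    RT≡RT′ = trans (sym (sum≡∑∘ ω {f = λ j → isR j ⊙ p I j} λ i → sym (cong₂ _⊙_ (ext-toℕ _ i) (ext-toℕ _ i))))
                   (sum≡∑ N λ i → sym (cong₂ _⊙_ (ext-toℕ isR i) (ext-toℕ (p I) i)))

    env : ∀ {s} → Totals s → (∀ j → arrays s δᴬ (+ toℕ j) ≡ + δ j) →
          (∀ k → arrays s ordᴬ (+ toℕ k) ≡ + toℕ (ω ⟨$⟩ʳ k)) → Env s
    env {s} T δ≡ ord≡ = record
      { n≡   = n≡ (given T)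
      ; P≡   = trans (P≡ T) (cong +_ (sym Tot≡P))
      ; RT≡  = trans (RT≡ T) (cong +_ (sym RT≡RT′))
      ; ord≡ = ∀-toℕ (λ k → arrays s ordᴬ (+ k) ≡ + jb k)
                 (λ k → trans (ord≡ k) (cong +_ (sym (ext-toℕ _ k)))) _
      ; p≡   = λ {k} → ∀-toℕ (λ k → arrays s pᴬ (+ jb k) ≡ + q k)
                 (λ k → at-job pᴬ k (trans (p≡ (given T) _) (cong +_ (sym (ext-toℕ _ k))))) k
      ; δ≡   = λ {k} → ∀-toℕ (λ k → arrays s δᴬ (+ jb k) ≡ + D k)
                 (λ k → at-job δᴬ k (trans (δ≡ _) (cong +_ (sym (ext-toℕ _ k))))) k
      ; r≡   = λ {k} → ∀-toℕ (λ k → arrays s rᴬ (+ jb k) ≡ + bit (r k))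
                 (λ k → at-job rᴬ k (trans (r≡ (given T) _) (cong (λ b → + bit b) (sym (ext-toℕ _ k))))) k }
      where
      at-job : ∀ a k {v} → arrays s a (+ toℕ (ω ⟨$⟩ʳ k)) ≡ v → arrays s a (+ jb (toℕ k)) ≡ v
      at-job a k h = trans (cong (λ z → arrays s a (+ z)) (ext-toℕ _ k)) h

    answer : ∀ s (π : Sequence I) → ByLabel π → (∀ k → arrays s pᴬ (+ toℕ k) ≡ + toℕ (π ⟨$⟩ʳ k)) →
             Answers I (setReg n# (+ bit (V late N 0 ≤ᵇ Tot)) s)
    answer s π by out with V late N 0 ≤? Tot
    ... | yes V≤ = inj₁ (cong (λ b → + bit b) (≤ᵇ-true V≤) , π , optimal π by V≤ , out)
    ... | no  V≰ = inj₂ (cong (λ b → + bit b) (≤ᵇ-false (≰⇒> V≰)) , λ σ feas → V≰ (proj₁ (feasible⇒V σ feas)))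

    sortByLabel! : ∀ s → Env s → regs s ans# ≡ + bit (V late N 0 ≤ᵇ Tot) →
      (∀ k → k < N → arrays s labᴬ (+ jb k) ≡ + Lb k) → Runᵀ sortByLabel Y s (Answers I)
    sortByLabel! s E ans≡ lab≡ = setᵀ 1≤Y refl $ seqᵀ $ moreᵀ (*N≤Y (s≤s (s≤s (s≤s z≤n)))) $
      mapᵀ (λ {s′} (same , π , out , by) →
        onceᵀ 1≤Y $ assign! (trans (reg≡ same ans#) ans≡) (answer s′ π by out)) $
      framedᵀ $ BucketSortRun.sort! ordᴬ labᴬ pᴬ refl refl 1≤N ω lab 2 (λ j → labels≤2 late N 0 _) _ record
        { n≡ = Env.n≡ E ; top≡ = refl
        ; src≡ = λ k → trans (Env.ord≡ E (Fin.toℕ<n k)) (cong +_ (ext-toℕ _ k))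
        ; key≡ = λ j → subst (λ z → arrays s labᴬ (+ z) ≡ + lab j)
                   (trans (ext-toℕ _ (ω ⟨$⟩ˡ j)) (cong toℕ (inverseʳ ω))) (lab≡ _ (Fin.toℕ<n (ω ⟨$⟩ˡ j))) }

    W≤ : W ≤ 3 + P I
    W≤ = subst (λ z → suc z ≤ 3 + P I) (sym Tot≡P) (s≤s (≤-trans (n≤1+n _) (n≤1+n _)))

    W≤Y : W ≤ Y
    W≤Y = ≤-trans (subst (_≤ N * W) (*-identityˡ W) (*-monoˡ-≤ W 1≤N)) (N*≤Y W≤)

    solve! : ∀ s → Env s → Runᵀ solve Y s (Answers I)
    solve! s E =
      seqᵀ $ moreᵀ N≤Y $ mapᵀ (λ (same , W≡ , ρ≡) → row₀-on _ (carry same E) W≡ (λ {k} → ρ≡ {k})) $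
      framedᵀ $ thresholds! s E
      where
      labelling-on : ∀ s → Env s → TableInv N s → Runᵀ (labelling ⨾ sortByLabel) Y s (Answers I)
      labelling-on s E TI =
        seqᵀ $ moreᵀ N≤Y $ mapᵀ (λ (same , ans≡ , lab≡) → sortByLabel! _ (carry same E) ans≡ lab≡) $
        framedᵀ $ labelling! s E TI
      table-on : ∀ s → Env s → regs s W# ≡ + W → (∀ {k} → k ≤ N → arrays s ρᴬ (+ k) ≡ + ρ k) → Rows 0 s →
                 Runᵀ (table ⨾ labelling ⨾ sortByLabel) Y s (Answers I)
      table-on s E W≡ ρ≡ rows =
        seqᵀ $ moreᵀ (N*≤Y W≤) $ mapᵀ (λ (same , TI) → labelling-on _ (carry same E) TI) $
        framedᵀ $ table! s E W≡ ρ≡ rows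
      row₀-on : ∀ s → Env s → regs s W# ≡ + W → (∀ {k} → k ≤ N → arrays s ρᴬ (+ k) ≡ + ρ k) →
                Runᵀ (row₀ ⨾ table ⨾ labelling ⨾ sortByLabel) Y s (Answers I)
      row₀-on s E W≡ ρ≡ =
        seqᵀ $ moreᵀ W≤Y $ mapᵀ (λ (same , rows) → table-on _ (carry same E) (trans (reg≡ same W#) W≡)
          (λ k≤n → trans (arr≡ same ρᴬ _) (ρ≡ k≤n)) rows) $
        framedᵀ $ row₀! s E W≡ (ρ≡ z≤n)

  sortByDeadline! : ∀ s → Totals s → (∀ j → arrays s idᴬ (+ toℕ j) ≡ + toℕ j) → Upto δᴬ δ N s →
                     Runᵀ sortByDeadline Y s (Answers I)
  sortByDeadline! s T Id U =
    setᵀ 1≤Y (trans (P≡ T ⊕≡ refl) (cong +_ (+-comm (P I) 1))) $ seqᵀ $ moreᵀ (*N≤Y (s≤s (s≤s (n≤1+n _)))) $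
    mapᵀ (λ (same , ω , ord≡ , by) → Sorted.solve! ω (sorted ω by) _ (Sorted.env ω (sorted ω by)
      (record { given = record { n≡ = trans (reg≡ same n#) (n≡ (given T))
                               ; p≡ = λ j → trans (arr≡ same pᴬ _) (p≡ (given T) j)
                               ; r≡ = λ j → trans (arr≡ same rᴬ _) (r≡ (given T) j) }
              ; P≡ = trans (reg≡ same P#) (P≡ T) ; RT≡ = trans (reg≡ same RT#) (RT≡ T) })
      (λ j → trans (arr≡ same δᴬ _) (upto U j (Fin.toℕ<n j))) ord≡)) $
    framedᵀ $ BucketSortRun.sort! idᴬ δᴬ ordᴬ refl refl 1≤N Perm.id δ (suc (P I)) (λ j → clip≤ (P I) _) _ record
      { n≡ = n≡ (given T) ; top≡ = refl
      ; src≡ = λ k → Id k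
      ; key≡ = λ j → upto U j (Fin.toℕ<n j) }
    where
    sorted : ∀ (ω : Permutation′ N) →
      (∀ i j → ω ⟨$⟩ˡ i Fin.≤ ω ⟨$⟩ˡ j → δ i < δ j ⊎ δ i ≡ δ j × i Fin.≤ j) →
      ∀ i j → i Fin.≤ j → δ (ω ⟨$⟩ʳ i) ≤ δ (ω ⟨$⟩ʳ j)
    sorted ω by i j i≤j with by _ _ (subst₂ Fin._≤_ (sym (inverseˡ ω)) (sym (inverseˡ ω)) i≤j)
    ... | inj₁ δ<       = <⇒≤ δ<
    ... | inj₂ (δ≡ , _) = ≤-reflexive δ≡

  main! : Runᵀ main Y (input I) (Answers I)
  main! = seqᵀ $ moreᵀ N≤Y $ mapᵀ (λ {s} (T , Du , Id) → seqᵀ $ moreᵀ N≤Y $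
    mapᵀ (λ (same , U) → sortByDeadline! _
      (record { given = record { n≡ = trans (reg≡ same n#) (n≡ (given T))
                               ; p≡ = λ j → trans (arr≡ same pᴬ _) (p≡ (given T) j)
                               ; r≡ = λ j → trans (arr≡ same rᴬ _) (r≡ (given T) j) }
              ; P≡ = trans (reg≡ same P#) (P≡ T) ; RT≡ = trans (reg≡ same RT#) (RT≡ T) })
      (λ j → trans (arr≡ same idᴬ _) (upto Id j (Fin.toℕ<n j))) U) $
    framedᵀ $ deadlines! s T Du) totals!

  Y≤ : Y ≤ 4 * nP I
  Y≤ = begin
    N * (3 + P I)         ≤⟨ *-monoʳ-≤ N (+-mono-≤ (*-monoʳ-≤ 3 (m≤n⊔m (P I) 1)) (m≤m⊔n (P I) 1)) ⟩
    N * (3 * Q + Q)       ≡⟨ lem N Q ⟩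
    4 * (N * Q)           ∎
    where
    open ≤-Reasoning
    Q : ℕ
    Q = P I ⊔ 1
    lem : ∀ n q → n * (3 * q + q) ≡ 4 * (n * q)
    lem = solve-∀

-- The program is a variable here so that its size is not unfolded to a unary numeral.
solvable : ∀ c → (∀ I → Runᵀ c (Algorithm.Y I) (input I) (Answers I)) → SolvableInTimeO nP
solvable c runs = c , size c * 4 , solves
  where
  solves : ∀ I → ∃[ t ] ∃[ s ] (⟨ c , input I ⟩⇓[ t ] s) × t ≤ size c * 4 * nP I × Answers I s
  solves I with runs I
  ... | runᵀ (run exec t≤ post) = _ , _ , exec , ≤-trans t≤ (≤-trans (*-monoʳ-≤ (size c) (Algorithm.Y≤ I))
    (≤-reflexive (sym (*-assoc (size c) 4 (nP I))))) , post

theorem9 : SolvableInTimeO nP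
theorem9 = solvable main Algorithm.main!
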